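{- Let $r\ge 1$ be an integer. A set $A\subseteq\mathbb{F}_2^r\setminus\{0\}$ with $|A|>\frac{11}{36}\,2^r+3$ is a minimal $1$-saturating set if and only if there are a maximal sum-free set $S\subseteq\mathbb{F}_2^r$ and an element $s\in S\cup\{0\}$ such that $A=\big(s+(S\cup\{0\})\big)\setminus\{0\}$.
   Context: $\mathbb{F}_2^r$ denotes the elementary abelian $2$-group of rank $r$. For $X\subseteq\mathbb{F}_2^r$, $2X:=\{x_1+x_2\colon x_1,x_2\in X\}$ (with $x_1=x_2$ allowed), and for $g\in\mathbb{F}_2^r$, $g+X:=\{g+x\colon x\in X\}$. A set $A\subseteq\mathbb{F}_2^r\setminus\{0\}$ is $1$-saturating if $A\cup 2A=\mathbb{F}_2^r$; it is a minimal $1$-saturating set if it is $1$-saturating and no proper subset of it is $1$-saturating. A set $S\subseteq\mathbb{F}_2^r$ is sum-free if $S\cap 2S=\varnothing$; it is maximal sum-free if it is sum-free and not properly contained in another sum-free subset of $\mathbb{F}_2^r$. -}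

module Defs where

open import Data.Bool using (Bool; true; false; _xor_)
open import Data.Nat using (ℕ; zero; suc)
open import Data.Vec using (Vec; []; _∷_; zipWith; replicate)
open import Data.List using (List; []; _∷_; map; _++_; length; filter)
open import Data.Product using (Σ; ∃; ∃-syntax; _×_; _,_)
open import Data.Sum using (_⊎_)
open import Relation.Nullary using (¬_)
open import Relation.Binary.PropositionalEquality using (_≡_; _≢_)
open import Data.Bool.Properties using (T?)

F₂^ : ℕ → Set
F₂^ r = Vec Bool r

infixl 6 _⊕_
_⊕_ : ∀ {r} → F₂^ r → F₂^ r → F₂^ r
_⊕_ = zipWith _xor_

𝟎 : ∀ {r} → F₂^ r
𝟎 {r} = replicate r false

Subset : ℕ → Set
Subset r = F₂^ r → Bool

infix 4 _∈_ _∈2_ _⊆_ _⊂_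
_∈_ : ∀ {r} → F₂^ r → Subset r → Set
x ∈ X = X x ≡ true

_⊆_ : ∀ {r} → Subset r → Subset r → Set
X ⊆ Y = ∀ x → x ∈ X → x ∈ Y

_⊂_ : ∀ {r} → Subset r → Subset r → Set
X ⊂ Y = X ⊆ Y × ∃[ x ] (x ∈ Y × ¬ (x ∈ X))

_∈2_ : ∀ {r} → F₂^ r → Subset r → Set
y ∈2 X = ∃[ x₁ ] ∃[ x₂ ] (x₁ ∈ X × x₂ ∈ X × y ≡ x₁ ⊕ x₂)

allVec : (r : ℕ) → List (F₂^ r)
allVec zero = [] ∷ []
allVec (suc r) = map (false ∷_) (allVec r) ++ map (true ∷_) (allVec r)

card : ∀ {r} → Subset r → ℕ
card {r} X = length (filter (λ x → T? (X x)) (allVec r))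

OneSaturating : ∀ {r} → Subset r → Set
OneSaturating {r} A = ¬ (𝟎 ∈ A) × (∀ (y : F₂^ r) → y ∈ A ⊎ y ∈2 A)

MinimalOneSaturating : ∀ {r} → Subset r → Set
MinimalOneSaturating {r} A =
  OneSaturating A × (∀ (B : Subset r) → B ⊂ A → ¬ OneSaturating B)

SumFree : ∀ {r} → Subset r → Set
SumFree {r} S = ∀ (y : F₂^ r) → y ∈ S → ¬ (y ∈2 S)

MaximalSumFree : ∀ {r} → Subset r → Set
MaximalSumFree {r} S = SumFree S × (∀ (T : Subset r) → S ⊆ T → SumFree T → T ⊆ S)

{-# OPTIONS --safe #-}
-- Put B = A ∪ {0}, and let D consist of the d ≠ 0 that are the sum of exactly one pair of elements of B; join such pairs
-- by an edge. If A is minimal, then every element of A lies on an edge. The theorem amounts to the existence of a vertex u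
-- joined to all elements of A other than u, since then (u + B) ∖ {0} is a maximal sum-free set.
--
-- As B is large, D is sum-free, and more than an eighth of the group. Linear algebra and this density leave two cases.
-- * Some linear functional is 1 on D. The graph is then bipartite; for a vertex a on one side and an edge d at a, the
--   translates of the two sides by a + d and a, and a minimal edge cover E, lie in a common coset of index two and hardly
--   overlap. Such union bounds, also for sets made invariant under the sum z of two edges, force E to be a star.
-- * D contains d₁, …, d₅ with sum 0. They span a copy of F₂⁴, in every coset of which B is a nearly independent set of the
--   Clebsch graph, so usually the neighbourhood {v + d₁, …, v + d₅} of a centre v. The sums of two centres form a subgroup
--   complementary to this F₂⁴, which colours both B and D with five colours. Matching each colour of B with the colour of
--   an edge there is an involution of the colours; a fixed colour yields a vertex u joined to nearly all v + dᵢ, hence to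
--   more than a quarter of the group. By sum-freeness of D every edge then contains u.

module Submission where

open import Defs
open import Data.Bool using (Bool; true; false; _xor_; _∧_; _∨_; not; if_then_else_; T)
import Data.Bool as Bool
open import Data.Bool.Properties using (T?; xor-comm; xor-assoc; xor-same; not-involutive)
open import Data.Empty using (⊥; ⊥-elim)
open import Data.Fin using (Fin; zero; suc)
import Data.Fin as Fin
import Data.Fin.Properties as Finₚ
open import Data.Fin.Patterns
open import Data.List using (List; []; _∷_; _++_; length; filter; map)
open import Data.List.Properties using (length-++; filter-++)
open import Data.List.Relation.Unary.All using (All; []; _∷_)
import Data.List.Relation.Unary.All.Properties as Allₚ
open import Data.Nat using (ℕ; zero; suc; _≤_; _<_; _*_; _+_; _∸_; _^_; z≤n; s≤s; _≤ᵇ_)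
open import Data.Nat.Properties hiding (_≟_)
open import Data.Nat.Tactic.RingSolver using (solve-∀)
open import Data.Product using (∃; ∃-syntax; _×_; _,_; proj₁; proj₂)
open import Data.Sum using (_⊎_; inj₁; inj₂)
open import Data.Unit using (tt)
open import Data.Vec using (Vec; []; _∷_; lookup; zipWith; replicate)
open import Data.Vec.Properties using (≡-dec)
open import Function using (_∘_)
open import Function.Bundles using (_⇔_; mk⇔; Equivalence)
open import Relation.Nullary using (¬_; Dec; yes; no; ⌊_⌋)
open import Relation.Binary.PropositionalEquality

-- As the ends of an edge are determined by their sum, a coincidence between suitable translates of
-- `B` and `D` is an edge at a known vertex, so the overlaps in a union bound are measured by
-- degrees. A minimal edge cover keeps them under control: each of its edges has an end of degree
-- one. Let N be the order of the group. Unless the cover is a star, the bipartite bounds leave only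
-- about 3N/10 vertices, or at most N/4 + 3 in some subcases, which uses up the additive 3 of the
-- hypothesis. In the pentagon case `B` may have about 5N/16 elements, so size alone gives no
-- contradiction. But a coset of F₂⁴ holds at most about four elements of `B` without a centre and
-- five with one; hence the centres have density about 11/36 - 1/4 = 1/18 or more, where 1/16 would
-- mean one in every coset. This near-completeness makes their sums a subgroup. Minimality does not
-- put 0 on an edge. Therefore an exceptional vertex `o` is carried along, and there are two
-- thresholds: 109 = 36 * 3 + 1 for `A`, and 145 = 109 + 36 for `B`, where the 36 pays for a removal
-- of `o`.

private variable
  r k : ℕ

-- The group F₂^ r

⊕-assoc : (x y z : F₂^ r) → (x ⊕ y) ⊕ z ≡ x ⊕ (y ⊕ z)
⊕-assoc [] [] [] = refl
⊕-assoc (a ∷ x) (b ∷ y) (c ∷ z) = cong₂ _∷_ (xor-assoc a b c) (⊕-assoc x y z)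

⊕-comm : (x y : F₂^ r) → x ⊕ y ≡ y ⊕ x
⊕-comm [] [] = refl
⊕-comm (a ∷ x) (b ∷ y) = cong₂ _∷_ (xor-comm a b) (⊕-comm x y)

⊕-self : (x : F₂^ r) → x ⊕ x ≡ 𝟎
⊕-self [] = refl
⊕-self (a ∷ x) = cong₂ _∷_ (xor-same a) (⊕-self x)

⊕-identityˡ : (x : F₂^ r) → 𝟎 ⊕ x ≡ x
⊕-identityˡ [] = refl
⊕-identityˡ (a ∷ x) = cong (a ∷_) (⊕-identityˡ x)

⊕-identityʳ : (x : F₂^ r) → x ⊕ 𝟎 ≡ x
⊕-identityʳ x = trans (⊕-comm x 𝟎) (⊕-identityˡ x)

⊕-cancel : (x y : F₂^ r) → (x ⊕ y) ⊕ y ≡ x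
⊕-cancel x y = trans (⊕-assoc x y y) (trans (cong (x ⊕_) (⊕-self y)) (⊕-identityʳ x))

⊕≡𝟎⇒≡ : {x y : F₂^ r} → x ⊕ y ≡ 𝟎 → x ≡ y
⊕≡𝟎⇒≡ {x = x} {y} e = trans (sym (⊕-cancel x y)) (trans (cong (_⊕ y) e) (⊕-identityˡ y))

_≟_ : (x y : F₂^ r) → Dec (x ≡ y)
_≟_ = ≡-dec Bool._≟_

interchange : (a b c d : F₂^ r) → (a ⊕ b) ⊕ (c ⊕ d) ≡ (a ⊕ c) ⊕ (b ⊕ d)
interchange a b c d = begin
  (a ⊕ b) ⊕ (c ⊕ d)  ≡⟨ ⊕-assoc a b (c ⊕ d) ⟩
  a ⊕ (b ⊕ (c ⊕ d))  ≡⟨ cong (a ⊕_) (sym (⊕-assoc b c d)) ⟩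
  a ⊕ ((b ⊕ c) ⊕ d)  ≡⟨ cong (λ t → a ⊕ (t ⊕ d)) (⊕-comm b c) ⟩
  a ⊕ ((c ⊕ b) ⊕ d)  ≡⟨ cong (a ⊕_) (⊕-assoc c b d) ⟩
  a ⊕ (c ⊕ (b ⊕ d))  ≡⟨ sym (⊕-assoc a c (b ⊕ d)) ⟩
  (a ⊕ c) ⊕ (b ⊕ d)  ∎
  where open ≡-Reasoning

lin : F₂^ k → Vec (F₂^ r) k → F₂^ r
lin [] [] = 𝟎
lin (true ∷ b) (x ∷ ρ) = x ⊕ lin b ρ
lin (false ∷ b) (x ∷ ρ) = lin b ρ

lin-⊕ : (b c : F₂^ k) (ρ : Vec (F₂^ r) k) → lin (b ⊕ c) ρ ≡ lin b ρ ⊕ lin c ρ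
lin-⊕ [] [] [] = sym (⊕-identityˡ 𝟎)
lin-⊕ (false ∷ b) (false ∷ c) (x ∷ ρ) = lin-⊕ b c ρ
lin-⊕ (true ∷ b) (false ∷ c) (x ∷ ρ) = trans (cong (x ⊕_) (lin-⊕ b c ρ)) (sym (⊕-assoc x _ _))
lin-⊕ (false ∷ b) (true ∷ c) (x ∷ ρ) = begin
  x ⊕ lin (b ⊕ c) ρ           ≡⟨ cong (x ⊕_) (lin-⊕ b c ρ) ⟩
  x ⊕ (lin b ρ ⊕ lin c ρ)     ≡⟨ sym (⊕-assoc x _ _) ⟩
  (x ⊕ lin b ρ) ⊕ lin c ρ     ≡⟨ cong (_⊕ lin c ρ) (⊕-comm x _) ⟩
  (lin b ρ ⊕ x) ⊕ lin c ρ     ≡⟨ ⊕-assoc _ x _ ⟩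
  lin b ρ ⊕ (x ⊕ lin c ρ)     ∎
  where open ≡-Reasoning
lin-⊕ (true ∷ b) (true ∷ c) (x ∷ ρ) = begin
  lin (b ⊕ c) ρ                       ≡⟨ lin-⊕ b c ρ ⟩
  lin b ρ ⊕ lin c ρ                   ≡⟨ sym (⊕-identityˡ _) ⟩
  𝟎 ⊕ (lin b ρ ⊕ lin c ρ)             ≡⟨ cong (_⊕ _) (sym (⊕-self x)) ⟩
  (x ⊕ x) ⊕ (lin b ρ ⊕ lin c ρ)       ≡⟨ interchange x x _ _ ⟩
  (x ⊕ lin b ρ) ⊕ (x ⊕ lin c ρ)       ∎
  where open ≡-Reasoning

lin-𝟎 : (ρ : Vec (F₂^ r) k) → lin 𝟎 ρ ≡ 𝟎
lin-𝟎 [] = refl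
lin-𝟎 (x ∷ ρ) = lin-𝟎 ρ

-- A reflective solver for equations in groups of exponent two

infixl 6 _∔_
data Expr (k : ℕ) : Set where
  var : Fin k → Expr k
  nul : Expr k
  _∔_ : Expr k → Expr k → Expr k

⟦_⟧ : Expr k → Vec (F₂^ r) k → F₂^ r
⟦ var i ⟧ ρ = lookup ρ i
⟦ nul ⟧ ρ = 𝟎
⟦ a ∔ b ⟧ ρ = ⟦ a ⟧ ρ ⊕ ⟦ b ⟧ ρ

unit : Fin k → F₂^ k
unit zero = true ∷ 𝟎
unit (suc i) = false ∷ unit i

nf : Expr k → F₂^ k
nf (var i) = unit i
nf nul = 𝟎
nf (a ∔ b) = nf a ⊕ nf b

lin-unit : (i : Fin k) (ρ : Vec (F₂^ r) k) → lin (unit i) ρ ≡ lookup ρ i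
lin-unit zero (x ∷ ρ) = trans (cong (x ⊕_) (lin-𝟎 ρ)) (⊕-identityʳ x)
lin-unit (suc i) (x ∷ ρ) = lin-unit i ρ

nf-correct : (e : Expr k) (ρ : Vec (F₂^ r) k) → ⟦ e ⟧ ρ ≡ lin (nf e) ρ
nf-correct (var i) ρ = sym (lin-unit i ρ)
nf-correct nul ρ = sym (lin-𝟎 ρ)
nf-correct (a ∔ b) ρ = trans (cong₂ _⊕_ (nf-correct a ρ) (nf-correct b ρ)) (sym (lin-⊕ (nf a) (nf b) ρ))

group : (ρ : Vec (F₂^ r) k) (a b : Expr k) → nf a ≡ nf b → ⟦ a ⟧ ρ ≡ ⟦ b ⟧ ρ
group ρ a b e = trans (nf-correct a ρ) (trans (cong (λ t → lin t ρ) e) (sym (nf-correct b ρ)))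

x₀ : Expr (1 + k)
x₀ = var 0F
x₁ : Expr (2 + k)
x₁ = var 1F
x₂ : Expr (3 + k)
x₂ = var 2F
x₃ : Expr (4 + k)
x₃ = var 3F
x₄ : Expr (5 + k)
x₄ = var 4F
x₅ : Expr (6 + k)
x₅ = var 5F
x₆ : Expr (7 + k)
x₆ = var 6F

-- Linear arithmetic over ℕ by certificates

infixl 6 _⊞_
infixl 7 _⊠_
data LExpr (k : ℕ) : Set where
  `_ : Fin k → LExpr k
  $_ : ℕ → LExpr k
  _⊞_ : LExpr k → LExpr k → LExpr k
  _⊠_ : ℕ → LExpr k → LExpr k

⟪_⟫ : LExpr k → Vec ℕ k → ℕ
⟪ ` i ⟫ ρ = lookup ρ i
⟪ $ c ⟫ ρ = c
⟪ a ⊞ b ⟫ ρ = ⟪ a ⟫ ρ + ⟪ b ⟫ ρ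
⟪ c ⊠ a ⟫ ρ = c * ⟪ a ⟫ ρ

dot : Vec ℕ k → Vec ℕ k → ℕ
dot [] [] = 0
dot (c ∷ cs) (x ∷ ρ) = c * x + dot cs ρ

dot-+ : (a b ρ : Vec ℕ k) → dot (zipWith _+_ a b) ρ ≡ dot a ρ + dot b ρ
dot-+ [] [] [] = refl
dot-+ (a ∷ as) (b ∷ bs) (x ∷ ρ) rewrite dot-+ as bs ρ = lem a b x (dot as ρ) (dot bs ρ)
  where
  lem : ∀ a b x u v → (a + b) * x + (u + v) ≡ (a * x + u) + (b * x + v)
  lem = solve-∀

dot-* : (c : ℕ) (a ρ : Vec ℕ k) → dot (Data.Vec.map (c *_) a) ρ ≡ c * dot a ρ
dot-* c [] [] = sym (*-zeroʳ c)
dot-* c (a ∷ as) (x ∷ ρ) rewrite dot-* c as ρ = lem c a x (dot as ρ)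
  where
  lem : ∀ c a x u → c * a * x + c * u ≡ c * (a * x + u)
  lem = solve-∀

dot-0 : (ρ : Vec ℕ k) → dot (replicate k 0) ρ ≡ 0
dot-0 [] = refl
dot-0 (x ∷ ρ) = dot-0 ρ

single : Fin k → Vec ℕ k
single zero = 1 ∷ replicate _ 0
single (suc i) = 0 ∷ single i

dot-single : (i : Fin k) (ρ : Vec ℕ k) → dot (single i) ρ ≡ lookup ρ i
dot-single zero (x ∷ ρ) rewrite dot-0 ρ = trans (+-identityʳ _) (+-identityʳ x)
dot-single (suc i) (x ∷ ρ) = dot-single i ρ

Lin : ℕ → Set
Lin k = ℕ × Vec ℕ k

lnf : LExpr k → Lin k
lnf (` i) = 0 , single i
lnf ($ c) = c , replicate _ 0
lnf (a ⊞ b) = proj₁ (lnf a) + proj₁ (lnf b) , zipWith _+_ (proj₂ (lnf a)) (proj₂ (lnf b))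
lnf (c ⊠ a) = c * proj₁ (lnf a) , Data.Vec.map (c *_) (proj₂ (lnf a))

value : Lin k → Vec ℕ k → ℕ
value (c , cs) ρ = c + dot cs ρ

lnf-correct : (e : LExpr k) (ρ : Vec ℕ k) → ⟪ e ⟫ ρ ≡ value (lnf e) ρ
lnf-correct (` i) ρ = sym (dot-single i ρ)
lnf-correct ($ c) ρ rewrite dot-0 ρ = sym (+-identityʳ c)
lnf-correct (a ⊞ b) ρ rewrite lnf-correct a ρ | lnf-correct b ρ | dot-+ (proj₂ (lnf a)) (proj₂ (lnf b)) ρ =
  lem (proj₁ (lnf a)) (proj₁ (lnf b)) (dot (proj₂ (lnf a)) ρ) (dot (proj₂ (lnf b)) ρ)
  where
  lem : ∀ a b u v → (a + u) + (b + v) ≡ (a + b) + (u + v)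
  lem = solve-∀
lnf-correct (c ⊠ a) ρ rewrite lnf-correct a ρ | dot-* c (proj₂ (lnf a)) ρ = *-distribˡ-+ c _ _

infix 4 _≼_
record Ineq (k : ℕ) : Set where
  constructor _≼_
  field
    lhs rhs : LExpr k
open Ineq

Holds : Vec ℕ k → Ineq k → Set
Holds ρ h = ⟪ lhs h ⟫ ρ ≤ ⟪ rhs h ⟫ ρ

infixr 3 _⊗_by_∷_
-- A Farkas combination: hypotheses with multipliers. The indices accumulate the weighted left and
-- right sides, so that their coefficients can be compared by evaluation.
data Certificate {k} (ρ : Vec ℕ k) : LExpr k → LExpr k → Set where
  [] : Certificate ρ ($ 0) ($ 0)
  _⊗_by_∷_ : ∀ {L R} (m : ℕ) (h : Ineq k) → Holds ρ h → Certificate ρ L R →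
             Certificate ρ (m ⊠ lhs h ⊞ L) (m ⊠ rhs h ⊞ R)

certificate-≤ : {ρ : Vec ℕ k} {L R : LExpr k} → Certificate ρ L R → ⟪ L ⟫ ρ ≤ ⟪ R ⟫ ρ
certificate-≤ [] = z≤n
certificate-≤ (m ⊗ h by p ∷ c) = +-mono-≤ (*-monoʳ-≤ m p) (certificate-≤ c)

dominated : Vec ℕ k → Vec ℕ k → Bool
dominated [] [] = true
dominated (a ∷ as) (b ∷ bs) = (a ≤ᵇ b) ∧ dominated as bs

∧-true : ∀ {a b} → a ∧ b ≡ true → a ≡ true × b ≡ true
∧-true {true} {true} _ = refl , refl

∧-trueˡ : ∀ {a b} → a ∧ b ≡ true → a ≡ true
∧-trueˡ p = proj₁ (∧-true p)

∧-trueʳ : ∀ {a b} → a ∧ b ≡ true → b ≡ true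
∧-trueʳ {a} p = proj₂ (∧-true {a} p)

T-true : ∀ {b} → b ≡ true → T b
T-true refl = tt

T⇒true : ∀ {b} → T b → b ≡ true
T⇒true {true} _ = refl

dominated-sound : (a b ρ : Vec ℕ k) → dominated a b ≡ true → dot a ρ ≤ dot b ρ
dominated-sound [] [] [] _ = z≤n
dominated-sound (a ∷ as) (b ∷ bs) (x ∷ ρ) e with ∧-true {a ≤ᵇ b} e
... | p , q = +-mono-≤ (*-monoˡ-≤ x (≤ᵇ⇒≤ a b (T-true p))) (dominated-sound as bs ρ q)

-- Variables range over natural numbers, so larger coefficients and a strictly larger constant on
-- the left make the summed inequality impossible.
refuted : Lin k → Lin k → Bool
refuted (c , cs) (d , ds) = (suc d ≤ᵇ c) ∧ dominated ds cs

refute : {ρ : Vec ℕ k} {L R : LExpr k} → Certificate ρ L R → refuted (lnf L) (lnf R) ≡ true → ⊥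
refute {ρ = ρ} {L} {R} c e with ∧-true {suc (proj₁ (lnf R)) ≤ᵇ proj₁ (lnf L)} e
... | p , q = <⇒≱ strict (subst₂ _≤_ (lnf-correct L ρ) (lnf-correct R ρ) (certificate-≤ c))
  where
  strict : value (lnf R) ρ < value (lnf L) ρ
  strict = +-mono-<-≤ (≤ᵇ⇒≤ (suc (proj₁ (lnf R))) (proj₁ (lnf L)) (T-true p))
                      (dominated-sound (proj₂ (lnf R)) (proj₂ (lnf L)) ρ q)

-- To derive h, refute its negation together with the given inequalities.
derive : {ρ : Vec ℕ k} (h : Ineq k) (m : ℕ) {L R : LExpr k} → Certificate ρ L R →
         refuted (lnf (m ⊠ ($ 1 ⊞ rhs h) ⊞ L)) (lnf (m ⊠ lhs h ⊞ R)) ≡ true → Holds ρ h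
derive {ρ = ρ} h m {L} {R} c e with ⟪ lhs h ⟫ ρ ≤? ⟪ rhs h ⟫ ρ
... | yes p = p
... | no ¬p = ⊥-elim (refute {L = m ⊠ ($ 1 ⊞ rhs h) ⊞ L} {R = m ⊠ lhs h ⊞ R} (m ⊗ ($ 1 ⊞ rhs h) ≼ lhs h by ≰⇒> ¬p ∷ c) e)

y₀ : LExpr (1 + k)
y₀ = ` 0F
y₁ : LExpr (2 + k)
y₁ = ` 1F
y₂ : LExpr (3 + k)
y₂ = ` 2F
y₃ : LExpr (4 + k)
y₃ = ` 3F
y₄ : LExpr (5 + k)
y₄ = ` 4F
y₅ : LExpr (6 + k)
y₅ = ` 5F
y₆ : LExpr (7 + k)
y₆ = ` 6F
y₇ : LExpr (8 + k)
y₇ = ` 7F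
y₈ : LExpr (9 + k)
y₈ = ` 8F
y₉ : LExpr (10 + k)
y₉ = ` 9F
y₁₀ : LExpr (11 + k)
y₁₀ = ` (suc 9F)
y₁₁ : LExpr (12 + k)
y₁₁ = ` (suc (suc 9F))
y₁₂ : LExpr (13 + k)
y₁₂ = ` (suc (suc (suc 9F)))

-- Sums over F₂^ r and cardinalities

ind : Bool → ℕ
ind true = 1
ind false = 0

∑ : (F₂^ r → ℕ) → ℕ
∑ {zero} f = f []
∑ {suc r} f = ∑ (λ v → f (false ∷ v)) + ∑ (λ v → f (true ∷ v))

# : Subset r → ℕ
# X = ∑ (λ x → ind (X x))

∑-cong : {f g : F₂^ r → ℕ} → (∀ x → f x ≡ g x) → ∑ f ≡ ∑ g
∑-cong {zero} e = e []
∑-cong {suc r} e = cong₂ _+_ (∑-cong (λ v → e (false ∷ v))) (∑-cong (λ v → e (true ∷ v)))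

∑-mono : {f g : F₂^ r → ℕ} → (∀ x → f x ≤ g x) → ∑ f ≤ ∑ g
∑-mono {zero} e = e []
∑-mono {suc r} e = +-mono-≤ (∑-mono (λ v → e (false ∷ v))) (∑-mono (λ v → e (true ∷ v)))

∑-+ : (f g : F₂^ r → ℕ) → ∑ (λ x → f x + g x) ≡ ∑ f + ∑ g
∑-+ {zero} f g = refl
∑-+ {suc r} f g = trans (cong₂ _+_ (∑-+ (f ∘ (false ∷_)) (g ∘ (false ∷_))) (∑-+ (f ∘ (true ∷_)) (g ∘ (true ∷_))))
                        (lem (∑ (f ∘ (false ∷_))) _ _ _)
  where
  lem : ∀ a b c d → (a + b) + (c + d) ≡ (a + c) + (b + d)
  lem = solve-∀

∑-* : (c : ℕ) (f : F₂^ r → ℕ) → ∑ (λ x → c * f x) ≡ c * ∑ f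
∑-* {zero} c f = refl
∑-* {suc r} c f = trans (cong₂ _+_ (∑-* c (f ∘ (false ∷_))) (∑-* c (f ∘ (true ∷_)))) (sym (*-distribˡ-+ c _ _))

∑-const : (c : ℕ) → ∑ {r} (λ _ → c) ≡ c * 2 ^ r
∑-const {zero} c = sym (*-identityʳ c)
∑-const {suc r} c rewrite ∑-const {r} c = lem c (2 ^ r)
  where
  lem : ∀ c n → c * n + c * n ≡ c * (n + (n + 0))
  lem = solve-∀

∑-swap : {q : ℕ} (f : F₂^ r → F₂^ q → ℕ) → ∑ (λ x → ∑ (λ y → f x y)) ≡ ∑ (λ y → ∑ (λ x → f x y))
∑-swap {zero} f = refl
∑-swap {suc r} f = trans (cong₂ _+_ (∑-swap (f ∘ (false ∷_))) (∑-swap (f ∘ (true ∷_))))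
                         (sym (∑-+ (λ y → ∑ (λ v → f (false ∷ v) y)) (λ y → ∑ (λ v → f (true ∷ v) y))))

∑-shift : (f : F₂^ r → ℕ) (a : F₂^ r) → ∑ (λ x → f (x ⊕ a)) ≡ ∑ f
∑-shift f [] = refl
∑-shift f (false ∷ a) = cong₂ _+_ (∑-shift (f ∘ (false ∷_)) a) (∑-shift (f ∘ (true ∷_)) a)
∑-shift f (true ∷ a) = trans (cong₂ _+_ (∑-shift (f ∘ (true ∷_)) a) (∑-shift (f ∘ (false ∷_)) a)) (+-comm (∑ (f ∘ (true ∷_))) (∑ (f ∘ (false ∷_))))

term≤∑ : (f : F₂^ r → ℕ) (x : F₂^ r) → f x ≤ ∑ f
term≤∑ f [] = ≤-refl
term≤∑ f (false ∷ x) = ≤-trans (term≤∑ (f ∘ (false ∷_)) x) (m≤m+n _ _)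
term≤∑ f (true ∷ x) = ≤-trans (term≤∑ (f ∘ (true ∷_)) x) (m≤n+m _ _)

∑-pos : (f : F₂^ r → ℕ) → 0 < ∑ f → ∃[ x ] 0 < f x
∑-pos {zero} f p = [] , p
∑-pos {suc r} f p with ∑ (f ∘ (false ∷_)) in eq
... | suc _ with ∑-pos (f ∘ (false ∷_)) (subst (0 <_) (sym eq) (s≤s z≤n))
...   | x , q = false ∷ x , q
∑-pos {suc r} f p | zero with ∑-pos (f ∘ (true ∷_)) p
...   | x , q = true ∷ x , q

ind-pos : ∀ {b} → 0 < ind b → b ≡ true
ind-pos {true} _ = refl

ind-true : ∀ {b} → b ≡ true → 1 ≤ ind b
ind-true refl = ≤-refl

ind≤1 : ∀ b → ind b ≤ 1
ind≤1 true = ≤-refl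
ind≤1 false = z≤n

#-pos : {X : Subset r} → 0 < # X → ∃[ x ] x ∈ X
#-pos {X = X} p with ∑-pos (λ x → ind (X x)) p
... | x , q = x , ind-pos q

∈⇒#-pos : {X : Subset r} {x : F₂^ r} → x ∈ X → 1 ≤ # X
∈⇒#-pos {X = X} {x} p = ≤-trans (ind-true p) (term≤∑ (λ x → ind (X x)) x)

ind-mono : ∀ {a b} → (a ≡ true → b ≡ true) → ind a ≤ ind b
ind-mono {false} f = z≤n
ind-mono {true} f = ind-true (f refl)

#-mono : {X Y : Subset r} → X ⊆ Y → # X ≤ # Y
#-mono f = ∑-mono (λ x → ind-mono (f x))

⁅_⁆ : F₂^ r → Subset r
⁅ c ⁆ x = ⌊ x ≟ c ⌋

≟-true : {x y : F₂^ r} → ⌊ x ≟ y ⌋ ≡ true → x ≡ y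
≟-true {x = x} {y} e with x ≟ y
... | yes p = p

≟-refl : (x : F₂^ r) → ⌊ x ≟ x ⌋ ≡ true
≟-refl x with x ≟ x
... | yes _ = refl
... | no ¬p = ⊥-elim (¬p refl)

≟-false : {x y : F₂^ r} → x ≢ y → ⌊ x ≟ y ⌋ ≡ false
≟-false {x = x} {y} n with x ≟ y
... | yes p = ⊥-elim (n p)
... | no _ = refl

true≢false : ∀ {b} → b ≡ true → b ≡ false → ⊥
true≢false refl ()

¬true⇒false : ∀ {b} → (b ≡ true → ⊥) → b ≡ false
¬true⇒false {false} f = refl
¬true⇒false {true} f = ⊥-elim (f refl)

∑-at-most-one : {P : F₂^ r → Bool} → (∀ {x y} → P x ≡ true → P y ≡ true → x ≡ y) → # P ≤ 1
∑-at-most-one {zero} {P} u = ind≤1 (P [])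
∑-at-most-one {suc r} {P} u with # (P ∘ (false ∷_)) in eq | ∑-at-most-one {P = P ∘ (false ∷_)} (λ p q → cong Data.Vec.tail (u p q))
... | zero | _ = ∑-at-most-one {P = P ∘ (true ∷_)} (λ p q → cong Data.Vec.tail (u p q))
... | suc zero | _ = ≤-reflexive (cong suc (n≤0⇒n≡0 (≮⇒≥ none)))
  where
  none : ¬ (0 < # (P ∘ (true ∷_)))
  none p with #-pos {X = P ∘ (true ∷_)} p | #-pos {X = P ∘ (false ∷_)} (subst (0 <_) (sym eq) (s≤s z≤n))
  ... | x , hx | y , hy with u hx hy
  ... | ()
... | suc (suc _) | s≤s ()

#⁅⁆ : (c : F₂^ r) → # ⁅ c ⁆ ≡ 1
#⁅⁆ c = ≤-antisym (∑-at-most-one {P = ⁅ c ⁆} (λ p q → trans (≟-true p) (sym (≟-true q)))) (∈⇒#-pos {X = ⁅ c ⁆} (≟-refl c))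

#-shift : (X : Subset r) (a : F₂^ r) → # (λ x → X (x ⊕ a)) ≡ # X
#-shift X a = ∑-shift (λ x → ind (X x)) a

#-all : # {r} (λ _ → true) ≡ 2 ^ r
#-all {r} = trans (∑-const {r} 1) (+-identityʳ _)

card≡# : (X : Subset r) → card X ≡ # X
card≡# {zero} X with X []
... | true = refl
... | false = refl
card≡# {suc r} X = begin
  length (filter P? (map (false ∷_) (allVec r) ++ map (true ∷_) (allVec r)))
    ≡⟨ cong length (filter-++ P? (map (false ∷_) (allVec r)) _) ⟩
  length (filter P? (map (false ∷_) (allVec r)) ++ filter P? (map (true ∷_) (allVec r)))
    ≡⟨ length-++ (filter P? (map (false ∷_) (allVec r))) ⟩
  length (filter P? (map (false ∷_) (allVec r))) + length (filter P? (map (true ∷_) (allVec r)))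
    ≡⟨ cong₂ _+_ (half false (allVec r)) (half true (allVec r)) ⟩
  card (X ∘ (false ∷_)) + card (X ∘ (true ∷_))
    ≡⟨ cong₂ _+_ (card≡# (X ∘ (false ∷_))) (card≡# (X ∘ (true ∷_))) ⟩
  # X ∎
  where
  open ≡-Reasoning
  P? = λ x → T? (X x)
  half : ∀ b l → length (filter P? (map (b ∷_) l)) ≡ length (filter (λ x → T? (X (b ∷ x))) l)
  half b [] = refl
  half b (v ∷ l) with X (b ∷ v)
  ... | true = cong suc (half b l)
  ... | false = half b l

ind-∨∧ : ∀ a b → ind (a ∨ b) + ind (a ∧ b) ≡ ind a + ind b
ind-∨∧ true true = refl
ind-∨∧ true false = refl
ind-∨∧ false true = refl
ind-∨∧ false false = refl

_─_ : Subset r → F₂^ r → Subset r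
(X ─ a) x = X x ∧ not ⌊ x ≟ a ⌋

─-∈ : {X : Subset r} {a x : F₂^ r} → x ∈ (X ─ a) → x ∈ X × x ≢ a
─-∈ {X = X} {a} {x} p with X x | x ≟ a | p
... | true | no q | _ = refl , q

∈-─ : {X : Subset r} {a x : F₂^ r} → x ∈ X → x ≢ a → x ∈ (X ─ a)
∈-─ {X = X} {a} {x} p q rewrite p | ≟-false q = refl

#-─ : (X : Subset r) (a : F₂^ r) → # X ≤ # (X ─ a) + 1
#-─ X a = begin
  # X                                                ≤⟨ ∑-mono pt ⟩
  ∑ (λ x → ind ((X ─ a) x) + ind (⁅ a ⁆ x))           ≡⟨ ∑-+ (λ x → ind ((X ─ a) x)) (λ x → ind (⁅ a ⁆ x)) ⟩
  # (X ─ a) + # ⁅ a ⁆                                ≡⟨ cong (# (X ─ a) +_) (#⁅⁆ a) ⟩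
  # (X ─ a) + 1                                      ∎
  where
  open ≤-Reasoning
  pt : ∀ x → ind (X x) ≤ ind ((X ─ a) x) + ind (⁅ a ⁆ x)
  pt x with X x | ⌊ x ≟ a ⌋
  ... | false | _ = z≤n
  ... | true | true = ≤-refl
  ... | true | false = ≤-refl

#-─-∈ : {X : Subset r} {a : F₂^ r} → a ∈ X → # (X ─ a) + 1 ≤ # X
#-─-∈ {X = X} {a} p = begin
  # (X ─ a) + 1                                      ≡⟨ cong (# (X ─ a) +_) (sym (#⁅⁆ a)) ⟩
  # (X ─ a) + # ⁅ a ⁆                                ≡⟨ sym (∑-+ (λ x → ind ((X ─ a) x)) (λ x → ind (⁅ a ⁆ x))) ⟩
  ∑ (λ x → ind ((X ─ a) x) + ind (⁅ a ⁆ x))           ≤⟨ ∑-mono pt ⟩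
  # X                                                ∎
  where
  open ≤-Reasoning
  pt : ∀ x → ind ((X ─ a) x) + ind (⁅ a ⁆ x) ≤ ind (X x)
  pt x with x ≟ a
  ... | yes refl rewrite p = ≤-refl
  ... | no _ with X x
  ...   | true = ≤-refl
  ...   | false = ≤-refl

-- Finite search

any? : {P : F₂^ r → Set} → (∀ x → Dec (P x)) → Dec (∃ P)
any? {zero} P? with P? []
... | yes p = yes ([] , p)
... | no ¬p = no λ { ([] , p) → ¬p p }
any? {suc r} P? with any? (λ v → P? (false ∷ v))
... | yes (v , p) = yes (false ∷ v , p)
... | no ¬p with any? (λ v → P? (true ∷ v))
...   | yes (v , p) = yes (true ∷ v , p)
...   | no ¬q = no λ { (false ∷ v , p) → ¬p (v , p) ; (true ∷ v , p) → ¬q (v , p) }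

_∈?_ : (x : F₂^ r) (X : Subset r) → Dec (x ∈ X)
x ∈? X = X x Bool.≟ true

-- The alternatives need not be decidable or complementary, so `Q` can be whatever evidence the
-- failure of `P` should supply.
all⊎any : {P Q : F₂^ r → Set} → (∀ x → P x ⊎ Q x) → (∀ x → P x) ⊎ ∃ Q
all⊎any {zero} f with f []
... | inj₁ p = inj₁ λ { [] → p }
... | inj₂ q = inj₂ ([] , q)
all⊎any {suc r} f with all⊎any (λ v → f (false ∷ v)) | all⊎any (λ v → f (true ∷ v))
... | inj₂ (v , q) | _ = inj₂ (false ∷ v , q)
... | inj₁ _ | inj₂ (v , q) = inj₂ (true ∷ v , q)
... | inj₁ p | inj₁ p' = inj₁ λ { (false ∷ v) → p v ; (true ∷ v) → p' v }

-- Disjoint translates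

double : (X : Subset r) (a : F₂^ r) → Subset r
double X a x = X x ∨ X (x ⊕ a)

meet : Subset r → F₂^ r → Subset r
meet X a x = X x ∧ X (x ⊕ a)

#-double : (X : Subset r) (a : F₂^ r) → # (double X a) + # (meet X a) ≡ 2 * # X
#-double X a = begin
  # (double X a) + # (meet X a)                    ≡⟨ sym (∑-+ (λ x → ind (double X a x)) _) ⟩
  ∑ (λ x → ind (double X a x) + ind (meet X a x))  ≡⟨ ∑-cong (λ x → ind-∨∧ (X x) (X (x ⊕ a))) ⟩
  ∑ (λ x → ind (X x) + ind (X (x ⊕ a)))               ≡⟨ ∑-+ (λ x → ind (X x)) _ ⟩
  # X + # (λ x → X (x ⊕ a))                           ≡⟨ cong (# X +_) (#-shift X a) ⟩
  # X + # X                                           ≡⟨ cong (# X +_) (sym (+-identityʳ _)) ⟩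
  2 * # X                                             ∎
  where open ≡-Reasoning

Apart : Subset r → F₂^ r → Set
Apart X a = ∀ x → x ∈ X → x ⊕ a ∈ X → ⊥

#-empty : {X : Subset r} → (∀ x → x ∈ X → ⊥) → # X ≡ 0
#-empty {X = X} f = n≤0⇒n≡0 (≮⇒≥ λ p → let (x , q) = #-pos {X = X} p in f x q)

#-double-apart : (X : Subset r) (a : F₂^ r) → Apart X a → # (double X a) ≡ 2 * # X
#-double-apart X a ap = trans (sym (+-identityʳ _)) (trans (cong (# (double X a) +_) (sym none)) (#-double X a))
  where
  none : # (meet X a) ≡ 0
  none = #-empty {X = meet X a} λ x p → let (p₁ , p₂) = ∧-true p in ap x p₁ p₂

∨-true : ∀ {a b} → a ∨ b ≡ true → a ≡ true ⊎ b ≡ true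
∨-true {true} _ = inj₁ refl
∨-true {false} p = inj₂ p

-- Points of the doubled set that differ by `b` come from points of `X` that differ by `b` or
-- `a ⊕ b`. By iteration, `X` has disjoint translates under any subgroup whose non-zero elements are
-- not differences in `X`.
double-apart : {X : Subset r} {a b : F₂^ r} → Apart X b → Apart X (a ⊕ b) → Apart (double X a) b
double-apart {X = X} {a} {b} pb pab x p q with ∨-true {X x} p | ∨-true {X (x ⊕ b)} q
... | inj₁ p | inj₁ q = pb x p q
... | inj₁ p | inj₂ q = pab x p (subst (_∈ X) (group (x ∷ a ∷ b ∷ []) (x₀ ∔ x₂ ∔ x₁) (x₀ ∔ (x₁ ∔ x₂)) refl) q)
... | inj₂ p | inj₁ q = pab (x ⊕ a) p (subst (_∈ X) (group (x ∷ a ∷ b ∷ []) (x₀ ∔ x₂) (x₀ ∔ x₁ ∔ (x₁ ∔ x₂)) refl) q)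
... | inj₂ p | inj₂ q = pb (x ⊕ a) p (subst (_∈ X) (group (x ∷ a ∷ b ∷ []) (x₀ ∔ x₂ ∔ x₁) (x₀ ∔ x₁ ∔ x₂) refl) q)

#≤2^ : (X : Subset r) → # X ≤ 2 ^ r
#≤2^ {r} X = ≤-trans (∑-mono (λ x → ind≤1 (X x))) (≤-reflexive (#-all {r}))

four-apart : (X : Subset r) (a b : F₂^ r) → Apart X a → Apart X b → Apart X (a ⊕ b) → 4 * # X ≤ 2 ^ r
four-apart {r} X a b pa pb pab = begin
  4 * # X                      ≡⟨ *-assoc 2 2 (# X) ⟩
  2 * (2 * # X)                ≡⟨ cong (2 *_) (sym (#-double-apart X a pa)) ⟩
  2 * # (double X a)           ≡⟨ sym (#-double-apart (double X a) b (double-apart pb pab)) ⟩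
  # (double (double X a) b)    ≤⟨ #≤2^ (double (double X a) b) ⟩
  2 ^ r                        ∎
  where open ≤-Reasoning

eight-apart : (X : Subset r) (a b c : F₂^ r) → Apart X a → Apart X b → Apart X (a ⊕ b) →
              Apart X c → Apart X (a ⊕ c) → Apart X (b ⊕ c) → Apart X (a ⊕ (b ⊕ c)) → 8 * # X ≤ 2 ^ r
eight-apart {r} X a b c pa pb pab pc pac pbc pabc = begin
  8 * # X                      ≡⟨ *-assoc 4 2 (# X) ⟩
  4 * (2 * # X)                ≡⟨ cong (4 *_) (sym (#-double-apart X a pa)) ⟩
  4 * # (double X a)           ≤⟨ four-apart (double X a) b c (double-apart pb pab) (double-apart pc pac) (double-apart pbc pabc) ⟩
  2 ^ r                        ∎
  where open ≤-Reasoning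

-- Separation by linear functionals

Additive : (F₂^ r → Bool) → Set
Additive φ = ∀ x y → φ (x ⊕ y) ≡ φ x xor φ y

xsum : List (F₂^ r) → F₂^ r
xsum [] = 𝟎
xsum (x ∷ l) = x ⊕ xsum l

coordinate : Fin r → F₂^ r → Bool
coordinate i x = lookup x i

coordinate-additive : (i : Fin r) → Additive (coordinate i)
coordinate-additive zero (a ∷ x) (b ∷ y) = refl
coordinate-additive (suc i) (a ∷ x) (b ∷ y) = coordinate-additive i x y

zero⊎coordinate : (x : F₂^ r) → x ≡ 𝟎 ⊎ ∃[ i ] coordinate i x ≡ true
zero⊎coordinate [] = inj₁ refl
zero⊎coordinate (true ∷ x) = inj₂ (zero , refl)
zero⊎coordinate (false ∷ x) with zero⊎coordinate x
... | inj₁ e = inj₁ (cong (false ∷_) e)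
... | inj₂ (i , e) = inj₂ (suc i , e)

xor-additive : {φ ψ : F₂^ r → Bool} → Additive φ → Additive ψ → Additive (λ x → φ x xor ψ x)
xor-additive {φ = φ} {ψ} p q x y rewrite p x y | q x y = lem (φ x) (φ y) (ψ x) (ψ y)
  where
  lem : ∀ a b c d → (a xor b) xor (c xor d) ≡ (a xor c) xor (b xor d)
  lem false b false d = refl
  lem false false true d = refl
  lem false true true d = refl
  lem true false false d = refl
  lem true true false false = refl
  lem true true false true = refl
  lem true false true false = refl
  lem true false true true = refl
  lem true true true false = refl
  lem true true true true = refl

Span : Subset r → F₂^ r → Set
Span X t = ∃[ l ] All (_∈ X) l × xsum l ≡ t

Separated : Subset r → List (F₂^ r) → F₂^ r → Set
Separated X ds t = ∃[ φ ] Additive φ × All (λ d → d ∈ X → φ d ≡ false) ds × φ t ≡ true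

-- Suppose the functional `φ` found for `t` is 1 at a further element `e` of `X`. A representation
-- of `t ⊕ e` gives one of `t`. A functional `ψ` for `t ⊕ e` either vanishes at `e` and serves
-- itself, or is 1 at `e`, hence 0 at `t`, and the sum of `φ` and `ψ` serves.
separate : (X : Subset r) (ds : List (F₂^ r)) (t : F₂^ r) → Span X t ⊎ Separated X ds t
separate X [] t with zero⊎coordinate t
... | inj₁ e = inj₁ ([] , [] , sym e)
... | inj₂ (i , e) = inj₂ (coordinate i , coordinate-additive i , [] , e)
separate X (e ∷ ds) t with separate X ds t
... | inj₁ s = inj₁ s
... | inj₂ (φ , φ-add , φ-ds , φ-t) with X e in Xe | φ e in φe
...   | false | _ = inj₂ (φ , φ-add , (λ p → ⊥-elim (true≢false p Xe)) ∷ φ-ds , φ-t)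
...   | true | false = inj₂ (φ , φ-add , (λ _ → φe) ∷ φ-ds , φ-t)
...   | true | true with separate X ds (t ⊕ e)
...     | inj₁ (l , l∈ , s) = inj₁ (e ∷ l , Xe ∷ l∈ , trans (cong (e ⊕_) s) (group (t ∷ e ∷ []) (x₁ ∔ (x₀ ∔ x₁)) x₀ refl))
...     | inj₂ (ψ , ψ-add , ψ-ds , ψ-te) with ψ e in ψe
...       | false = inj₂ (ψ , ψ-add , (λ _ → ψe) ∷ ψ-ds , trans (sym (xor-false (ψ t) ψe)) (trans (sym (ψ-add t e)) ψ-te))
  where
  xor-false : ∀ a {b} → b ≡ false → a xor b ≡ a
  xor-false false refl = refl
  xor-false true refl = refl
...       | true = inj₂ ((λ x → φ x xor ψ x) , xor-additive {φ = φ} {ψ} φ-add ψ-add , (λ _ → cong₂ _xor_ φe ψe) ∷ both φ-ds ψ-ds , cong₂ _xor_ φ-t (ψ-t ψe))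
  where
  both : ∀ {ds} → All (λ d → d ∈ X → φ d ≡ false) ds → All (λ d → d ∈ X → ψ d ≡ false) ds →
         All (λ d → d ∈ X → φ d xor ψ d ≡ false) ds
  both [] [] = []
  both (p ∷ ps) (q ∷ qs) = (λ x → cong₂ _xor_ (p x) (q x)) ∷ both ps qs
  ψ-t : ψ e ≡ true → ψ t ≡ false
  ψ-t ψe with ψ t | trans (sym (ψ-add t e)) ψ-te
  ... | false | _ = refl
  ... | true | q rewrite ψe = sym q

All-allVec : {Q : F₂^ r → Set} → All Q (allVec r) → ∀ x → Q x
All-allVec (q ∷ []) [] = q
All-allVec {suc r} qs (false ∷ x) = All-allVec (Allₚ.map⁻ (Allₚ.++⁻ˡ (map (false ∷_) (allVec r)) qs)) x
All-allVec {suc r} qs (true ∷ x) = All-allVec (Allₚ.map⁻ (Allₚ.++⁻ʳ (map (false ∷_) (allVec r)) qs)) x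

parity : {A : Set} → List A → Bool
parity [] = false
parity (_ ∷ l) = not (parity l)

OddRelation : Subset r → Set
OddRelation D = ∃[ l ] All (_∈ D) l × parity l ≡ true × xsum l ≡ 𝟎

OddFunctional : Subset r → Set
OddFunctional D = ∃[ φ ] Additive φ × (∀ d → d ∈ D → φ d ≡ true)

-- The added coordinate of a sum counts its terms modulo two.
raise : Subset r → Subset (suc r)
raise D (true ∷ d) = D d
raise D (false ∷ d) = false

lower : {D : Subset r} (l : List (F₂^ (suc r))) → All (_∈ raise D) l →
        ∃[ l' ] All (_∈ D) l' × xsum l ≡ parity l' ∷ xsum l'
lower [] [] = [] , [] , refl
lower ((true ∷ d) ∷ l) (p ∷ ps) with lower l ps
... | l' , ps' , e = d ∷ l' , p ∷ ps' , cong ((true ∷ d) ⊕_) e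

-- Separate the vector (1 , 0) from the vectors (1 , d).
odd-relation⊎functional : (D : Subset r) → OddRelation D ⊎ OddFunctional D
odd-relation⊎functional {r} D with separate (raise D) (allVec (suc r)) (true ∷ 𝟎)
... | inj₁ (l , l∈ , s) with lower {D = D} l l∈
...   | l' , l'∈ , e = inj₁ (l' , l'∈ , cong Data.Vec.head s' , cong Data.Vec.tail s')
  where
  s' : parity l' ∷ xsum l' ≡ true ∷ 𝟎
  s' = trans (sym e) s
odd-relation⊎functional {r} D | inj₂ (φ , φ-add , φ-ds , φ-t) = inj₂ (ψ , ψ-add , ψ-D)
  where
  ψ : F₂^ r → Bool
  ψ x = φ (false ∷ x)
  ψ-add : Additive ψ
  ψ-add x y = φ-add (false ∷ x) (false ∷ y)
  ψ-D : ∀ d → d ∈ D → ψ d ≡ true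
  ψ-D d p = trans (cong (λ t → φ (false ∷ t)) (sym (⊕-identityˡ d)))
            (trans (φ-add (true ∷ 𝟎) (true ∷ d)) (cong₂ _xor_ φ-t (All-allVec φ-ds (true ∷ d) p)))

-- Short odd relations in a dense set

record FiveCycle (D : Subset r) : Set where
  constructor fiveCycle
  field
    {e₁ e₂ e₃ e₄ e₅} : F₂^ r
    e₁∈ : e₁ ∈ D
    e₂∈ : e₂ ∈ D
    e₃∈ : e₃ ∈ D
    e₄∈ : e₄ ∈ D
    e₅∈ : e₅ ∈ D
    closed : e₁ ⊕ (e₂ ⊕ (e₃ ⊕ e₄)) ≡ e₅

apart⊎ : (X : Subset r) (w : F₂^ r) → Apart X w ⊎ ∃[ y ] y ∈ X × y ⊕ w ∈ X
apart⊎ X w with all⊎any {P = λ x → x ∈ X → x ⊕ w ∈ X → ⊥} {Q = λ y → y ∈ X × y ⊕ w ∈ X} dec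
  where
  dec : ∀ x → (x ∈ X → x ⊕ w ∈ X → ⊥) ⊎ (x ∈ X × x ⊕ w ∈ X)
  dec x with X x | X (x ⊕ w)
  ... | true | true = inj₂ (refl , refl)
  ... | true | false = inj₁ λ _ ()
  ... | false | _ = inj₁ λ ()
... | inj₁ p = inj₁ p
... | inj₂ q = inj₂ q

-- Two elements y, y ⊕ w of D replace w = w₁ ⊕ w₂ ⊕ w₃ in a pentagon, or w = w₁ ⊕ w₂ ⊕ w₃ ⊕ w₄ in a shorter odd cycle;
-- the seven vectors w below are the nonzero elements of a subgroup of order eight.
odd-relation⇒five-cycle : (D : Subset r) → 2 ^ r < 8 * # D → OddRelation D → FiveCycle D
odd-relation⇒five-cycle {r} D large (l , l∈ , par , s) = go (length l) l ≤-refl l∈ par s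
  where
  3-sum : ∀ {y w a b c} → y ∈ D → y ⊕ w ∈ D → w ≡ a ⊕ (b ⊕ c) → a ∈ D → b ∈ D → c ∈ D → FiveCycle D
  3-sum {y} {w} {a} {b} {c} p q refl a∈ b∈ c∈ =
    fiveCycle a∈ b∈ c∈ p q (group (y ∷ a ∷ b ∷ c ∷ []) (x₁ ∔ (x₂ ∔ (x₃ ∔ x₀))) (x₀ ∔ (x₁ ∔ (x₂ ∔ x₃))) refl)
  six-nots : ∀ b → not (not (not (not (not (not b))))) ≡ true → b ≡ true
  six-nots true _ = refl
  go : ∀ n (l : List (F₂^ r)) → length l ≤ n → All (_∈ D) l → parity l ≡ true → xsum l ≡ 𝟎 → FiveCycle D
  -- Relations of length one and three are padded with repeated elements, so a `FiveCycle` may be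
  -- degenerate; for sum-free `D` this is excluded later by `d-injective`.
  go n (a ∷ []) _ (a∈ ∷ []) _ s = fiveCycle a∈ a∈ a∈ a∈ a∈
    (trans (group (a ∷ []) (x₀ ∔ (x₀ ∔ (x₀ ∔ x₀))) nul refl) (trans (sym s) (group (a ∷ []) (x₀ ∔ nul) x₀ refl)))
  go n (a ∷ b ∷ c ∷ []) _ (a∈ ∷ b∈ ∷ c∈ ∷ []) _ s = fiveCycle a∈ b∈ c∈ c∈ c∈
    (trans (group (a ∷ b ∷ c ∷ []) (x₀ ∔ (x₁ ∔ (x₂ ∔ x₂))) (x₀ ∔ (x₁ ∔ (x₂ ∔ nul)) ∔ x₂) refl)
           (trans (cong (_⊕ c) s) (⊕-identityˡ c)))
  go n (a ∷ b ∷ c ∷ d ∷ e ∷ []) _ (a∈ ∷ b∈ ∷ c∈ ∷ d∈ ∷ e∈ ∷ []) _ s = fiveCycle a∈ b∈ c∈ d∈ e∈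
    (trans (group (a ∷ b ∷ c ∷ d ∷ e ∷ []) (x₀ ∔ (x₁ ∔ (x₂ ∔ x₃))) (x₀ ∔ (x₁ ∔ (x₂ ∔ (x₃ ∔ (x₄ ∔ nul)))) ∔ x₄) refl)
           (trans (cong (_⊕ e) s) (⊕-identityˡ e)))
  go (suc n) (a ∷ b ∷ c ∷ d ∷ e ∷ f ∷ l) len (a∈ ∷ b∈ ∷ c∈ ∷ d∈ ∷ e∈ ∷ f∈ ∷ l∈) par s = by-cases
    where
    u v o : F₂^ r
    u = a ⊕ (b ⊕ (c ⊕ d))
    v = a ⊕ (b ⊕ (e ⊕ f))
    o = a ⊕ (c ⊕ e)
    ρ : Vec (F₂^ r) 6
    ρ = a ∷ b ∷ c ∷ d ∷ e ∷ f ∷ []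
    par' : parity l ≡ true
    par' = six-nots (parity l) par
    4-sum : ∀ {y w g h} → y ∈ D → y ⊕ w ∈ D → g ∈ D → h ∈ D → w ⊕ (g ⊕ h) ≡ a ⊕ (b ⊕ (c ⊕ (d ⊕ (e ⊕ f)))) → FiveCycle D
    4-sum {y} {w} {g} {h} p q g∈ h∈ eq = go n (y ∷ y ⊕ w ∷ g ∷ h ∷ l) (≤-pred (≤-trans (n≤1+n _) len)) (p ∷ q ∷ g∈ ∷ h∈ ∷ l∈)
      (cong (λ t → not (not (not (not t)))) par')
      (trans (group (y ∷ w ∷ g ∷ h ∷ xsum l ∷ []) (x₀ ∔ (x₀ ∔ x₁ ∔ (x₂ ∔ (x₃ ∔ x₄)))) (x₁ ∔ (x₂ ∔ x₃) ∔ x₄) refl)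
       (trans (cong (_⊕ xsum l) eq)
        (trans (group (a ∷ b ∷ c ∷ d ∷ e ∷ f ∷ xsum l ∷ []) (x₀ ∔ (x₁ ∔ (x₂ ∔ (x₃ ∔ (x₄ ∔ x₅)))) ∔ x₆)
                      (x₀ ∔ (x₁ ∔ (x₂ ∔ (x₃ ∔ (x₄ ∔ (x₅ ∔ x₆)))))) refl) s)))
    by-cases : FiveCycle D
    by-cases with apart⊎ D u | apart⊎ D v | apart⊎ D (u ⊕ v) | apart⊎ D o | apart⊎ D (u ⊕ o) | apart⊎ D (v ⊕ o) | apart⊎ D (u ⊕ (v ⊕ o))
    ... | inj₂ (y , p , q) | _ | _ | _ | _ | _ | _ =
          4-sum p q e∈ f∈ (group ρ (x₀ ∔ (x₁ ∔ (x₂ ∔ x₃)) ∔ (x₄ ∔ x₅)) (x₀ ∔ (x₁ ∔ (x₂ ∔ (x₃ ∔ (x₄ ∔ x₅))))) refl)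
    ... | _ | inj₂ (y , p , q) | _ | _ | _ | _ | _ =
          4-sum p q c∈ d∈ (group ρ (x₀ ∔ (x₁ ∔ (x₄ ∔ x₅)) ∔ (x₂ ∔ x₃)) (x₀ ∔ (x₁ ∔ (x₂ ∔ (x₃ ∔ (x₄ ∔ x₅))))) refl)
    ... | _ | _ | inj₂ (y , p , q) | _ | _ | _ | _ =
          4-sum p q a∈ b∈ (group ρ (x₀ ∔ (x₁ ∔ (x₂ ∔ x₃)) ∔ (x₀ ∔ (x₁ ∔ (x₄ ∔ x₅))) ∔ (x₀ ∔ x₁)) (x₀ ∔ (x₁ ∔ (x₂ ∔ (x₃ ∔ (x₄ ∔ x₅))))) refl)
    ... | _ | _ | _ | inj₂ (y , p , q) | _ | _ | _ = 3-sum p q refl a∈ c∈ e∈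
    ... | _ | _ | _ | _ | inj₂ (y , p , q) | _ | _ =
          3-sum p q (group ρ (x₀ ∔ (x₁ ∔ (x₂ ∔ x₃)) ∔ (x₀ ∔ (x₂ ∔ x₄))) (x₁ ∔ (x₃ ∔ x₄)) refl) b∈ d∈ e∈
    ... | _ | _ | _ | _ | _ | inj₂ (y , p , q) | _ =
          3-sum p q (group ρ (x₀ ∔ (x₁ ∔ (x₄ ∔ x₅)) ∔ (x₀ ∔ (x₂ ∔ x₄))) (x₁ ∔ (x₂ ∔ x₅)) refl) b∈ c∈ f∈
    ... | _ | _ | _ | _ | _ | _ | inj₂ (y , p , q) =
          3-sum p q (group ρ (x₀ ∔ (x₁ ∔ (x₂ ∔ x₃)) ∔ (x₀ ∔ (x₁ ∔ (x₄ ∔ x₅)) ∔ (x₀ ∔ (x₂ ∔ x₄)))) (x₀ ∔ (x₃ ∔ x₅)) refl) a∈ d∈ f∈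
    ... | inj₁ p₁ | inj₁ p₂ | inj₁ p₃ | inj₁ p₄ | inj₁ p₅ | inj₁ p₆ | inj₁ p₇ =
          ⊥-elim (<⇒≱ large (eight-apart D u v o p₁ p₂ p₃ p₄ p₅ p₆ p₇))

-- Unique sums

record UniqueSums (B D : Subset r) : Set where
  field
    represented : ∀ {d} → d ∈ D → ∃[ a ] a ∈ B × a ⊕ d ∈ B
    unique : ∀ {d x y} → d ∈ D → x ∈ B → x ⊕ d ∈ B → y ∈ B → y ⊕ d ∈ B → x ≡ y ⊎ x ≡ y ⊕ d

SumFree₂ : Subset r → Set
SumFree₂ D = ∀ {d e} → d ∈ D → e ∈ D → d ⊕ e ∈ D → ⊥

module _ {B D : Subset r} (U : UniqueSums B D) where
  open UniqueSums U

  apart-without : ∀ {d a} {X : Subset r} → d ∈ D → a ∈ B → a ⊕ d ∈ B → X ⊆ B → ¬ a ∈ X → Apart X d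
  apart-without {d} {a} {X} d∈ a∈ a'∈ X⊆ a∉ x p q with unique d∈ (X⊆ x p) (X⊆ (x ⊕ d) q) a∈ a'∈
  ... | inj₁ refl = a∉ p
  ... | inj₂ refl = a∉ (subst (_∈ X) (⊕-cancel a d) q)

  -- Drop one end of each of the edges `d`, `e` and `d ⊕ e`. The rest of `B` has four disjoint
  -- translates under the group they generate, hence at most a quarter of all elements, which is
  -- less than 11/36.
  unique-sums-sum-free : 11 * 2 ^ r + 145 ≤ 36 * # B → SumFree₂ D
  unique-sums-sum-free large {d} {e} d∈ e∈ de∈ with represented d∈ | represented e∈ | represented de∈
  ... | a , a∈ , a'∈ | b , b∈ , b'∈ | c , c∈ , c'∈ =
    refute {ρ = 2 ^ r ∷ # B ∷ # B₁ ∷ # B₂ ∷ # B₃ ∷ []}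
      (1 ⊗ 11 ⊠ y₀ ⊞ $ 145 ≼ 36 ⊠ y₁ by large ∷ 36 ⊗ y₁ ≼ y₂ ⊞ $ 1 by #-─ B a ∷ 36 ⊗ y₂ ≼ y₃ ⊞ $ 1 by #-─ B₁ b ∷
       36 ⊗ y₃ ≼ y₄ ⊞ $ 1 by #-─ B₂ c ∷ 9 ⊗ 4 ⊠ y₄ ≼ y₀ by small ∷ []) refl
    where
    B₁ B₂ B₃ : Subset r
    B₁ = B ─ a
    B₂ = B₁ ─ b
    B₃ = B₂ ─ c
    in₂ : ∀ {x} → x ∈ B₃ → x ∈ B₂ × x ≢ c
    in₂ = ─-∈ {X = B₂}
    in₁ : ∀ {x} → x ∈ B₃ → x ∈ B₁ × x ≢ b
    in₁ p = ─-∈ {X = B₁} (proj₁ (in₂ p))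
    in₀ : ∀ {x} → x ∈ B₃ → x ∈ B × x ≢ a
    in₀ p = ─-∈ {X = B} (proj₁ (in₁ p))
    small : 4 * # B₃ ≤ 2 ^ r
    small = four-apart B₃ d e
      (apart-without d∈ a∈ a'∈ (λ x p → proj₁ (in₀ p)) (λ p → proj₂ (in₀ p) refl))
      (apart-without e∈ b∈ b'∈ (λ x p → proj₁ (in₀ p)) (λ p → proj₂ (in₁ p) refl))
      (apart-without de∈ c∈ c'∈ (λ x p → proj₁ (in₀ p)) (λ p → proj₂ (in₂ p) refl))

  𝟎∉-sum-free : SumFree₂ D → ¬ 𝟎 ∈ D
  𝟎∉-sum-free sf p = sf p p (subst (_∈ D) (sym (⊕-self 𝟎)) p)

  Neighbours : F₂^ r → Subset r
  Neighbours u y = B y ∧ D (u ⊕ y)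

  -- If y ⊕ d missed u as well, the translates of the neighbourhood of u by the Klein group
  -- generated by u ⊕ y and d would be disjoint.
  hub-meets-all-edges : SumFree₂ D → ∀ {u} → u ∈ B → 2 ^ r < 4 * # (Neighbours u) →
        ∀ {y d} → y ∈ B → d ∈ D → y ⊕ d ∈ B → y ≢ u → y ⊕ d ≡ u
  hub-meets-all-edges sf {u} u∈ large {y} {d} y∈ d∈ y'∈ y≢u with (y ⊕ d) ≟ u
  ... | yes e = e
  ... | no y'≢u = ⊥-elim (<⇒≱ large (four-apart L (u ⊕ y) d (shift y∈ y≢u) dd
          (λ x p q → shift y'∈ y'≢u x p (subst (_∈ L) (group (x ∷ u ∷ y ∷ d ∷ []) (x₀ ∔ (x₁ ∔ x₂ ∔ x₃)) (x₀ ∔ (x₁ ∔ (x₂ ∔ x₃))) refl) q))))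
    where
    L = Neighbours u
    shift : ∀ {ρ} → ρ ∈ B → ρ ≢ u → Apart L (u ⊕ ρ)
    shift {ρ} ρ∈ ρ≢u x p q with ∧-true p | ∧-true {B (x ⊕ (u ⊕ ρ))} q
    ... | x∈ , xu∈ | x'∈ , _ with unique xu∈ x∈ (subst (_∈ B) (group (x ∷ u ∷ []) x₁ (x₀ ∔ (x₁ ∔ x₀)) refl) u∈)
                                          ρ∈ (subst (_∈ B) (group (x ∷ u ∷ ρ ∷ []) (x₀ ∔ (x₁ ∔ x₂)) (x₂ ∔ (x₁ ∔ x₀)) refl) x'∈)
    ... | inj₁ refl = 𝟎∉-sum-free sf (subst (_∈ D) (group (x ∷ u ∷ []) (x₁ ∔ (x₀ ∔ (x₁ ∔ x₀))) nul refl) (∧-trueʳ q))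
    ... | inj₂ e = ρ≢u (⊕≡𝟎⇒≡ (trans (group (x ∷ u ∷ ρ ∷ []) (x₂ ∔ x₁) (x₀ ∔ (x₂ ∔ (x₁ ∔ x₀))) refl) (trans (cong (x ⊕_) (sym e)) (⊕-self x))))
    dd : Apart L d
    dd x p q with ∧-true p | ∧-true {B (x ⊕ d)} q
    ... | _ , xu∈ | _ , x'u∈ = sf xu∈ d∈ (subst (_∈ D) (sym (⊕-assoc u x d)) x'u∈)

-- Union bounds

ind-tri : ∀ a b c {s} → (a ≡ true → s ≡ true) → (b ≡ true → s ≡ true) → (c ≡ true → s ≡ true) →
          (a ≡ true → c ≡ true → b ≡ true) → ind a + ind b + ind c ≤ ind s + (ind (a ∧ b) + ind (b ∧ c))
ind-tri false false false _ _ _ _ = z≤n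
ind-tri false false true _ _ hc _ rewrite hc refl = ≤-refl
ind-tri false true false _ hb _ _ rewrite hb refl = ≤-refl
ind-tri false true true _ hb _ _ rewrite hb refl = ≤-refl
ind-tri true false false ha _ _ _ rewrite ha refl = ≤-refl
ind-tri true false true _ _ _ h = ⊥-elim (true≢false (h refl refl) refl)
ind-tri true true false ha _ _ _ rewrite ha refl = ≤-refl
ind-tri true true true ha _ _ _ rewrite ha refl = ≤-refl

_∩_ : Subset r → Subset r → Subset r
(X ∩ Y) x = X x ∧ Y x

∧-intro : ∀ {a b} → a ≡ true → b ≡ true → a ∧ b ≡ true
∧-intro refl refl = refl

∨-introˡ : ∀ {a b} → a ≡ true → a ∨ b ≡ true
∨-introˡ refl = refl

∨-introʳ : ∀ {a b} → b ≡ true → a ∨ b ≡ true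
∨-introʳ {true} _ = refl
∨-introʳ {false} p = p

-- Inclusion and exclusion: as `A` and `C` meet only inside `B`, the triple intersection cancels the
-- term of `A ∩ C`.
union-bound : (S A B C : Subset r) → A ⊆ S → B ⊆ S → C ⊆ S → (∀ y → y ∈ A → y ∈ C → y ∈ B) →
              # A + # B + # C ≤ # S + (# (A ∩ B) + # (B ∩ C))
union-bound S A B C hA hB hC h = begin
  # A + # B + # C
    ≡⟨ cong (_+ # C) (sym (∑-+ (λ y → ind (A y)) (λ y → ind (B y)))) ⟩
  ∑ (λ y → ind (A y) + ind (B y)) + # C
    ≡⟨ sym (∑-+ (λ y → ind (A y) + ind (B y)) (λ y → ind (C y))) ⟩
  ∑ (λ y → ind (A y) + ind (B y) + ind (C y))
    ≤⟨ ∑-mono (λ y → ind-tri (A y) (B y) (C y) (hA y) (hB y) (hC y) (h y)) ⟩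
  ∑ (λ y → ind (S y) + (ind (A y ∧ B y) + ind (B y ∧ C y)))
    ≡⟨ ∑-+ (λ y → ind (S y)) (λ y → ind (A y ∧ B y) + ind (B y ∧ C y)) ⟩
  # S + ∑ (λ y → ind (A y ∧ B y) + ind (B y ∧ C y))
    ≡⟨ cong (# S +_) (∑-+ (λ y → ind (A y ∧ B y)) (λ y → ind (B y ∧ C y))) ⟩
  # S + (# (A ∩ B) + # (B ∩ C)) ∎
  where open ≤-Reasoning

disjoint-bound : (S A B : Subset r) → A ⊆ S → B ⊆ S → (∀ y → y ∈ A → y ∈ B → ⊥) → # A + # B ≤ # S
disjoint-bound S A B hA hB h = begin
  # A + # B                            ≡⟨ sym (∑-+ (λ y → ind (A y)) (λ y → ind (B y))) ⟩
  ∑ (λ y → ind (A y) + ind (B y))       ≤⟨ ∑-mono pt ⟩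
  # S                                  ∎
  where
  open ≤-Reasoning
  pt : ∀ y → ind (A y) + ind (B y) ≤ ind (S y)
  pt y with A y in eA | B y in eB
  ... | true | true = ⊥-elim (h y eA eB)
  ... | true | false rewrite hA y eA = ≤-refl
  ... | false | true rewrite hB y eB = ≤-refl
  ... | false | false = z≤n

ind-∨∧∨ : ∀ a a' b b' → ind ((a ∨ a') ∧ (b ∨ b')) ≤ (ind (a ∧ b) + ind (a ∧ b')) + (ind (a' ∧ b) + ind (a' ∧ b'))
ind-∨∧∨ false false b b' = z≤n
ind-∨∧∨ true a' true b' = s≤s z≤n
ind-∨∧∨ true a' false true = s≤s z≤n
ind-∨∧∨ true a' false false = z≤n
ind-∨∧∨ false true true b' = s≤s z≤n
ind-∨∧∨ false true false b' = ≤-refl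

ind-∨∧∧ : ∀ b b' c c' → ind ((b ∨ b') ∧ (c ∧ c')) ≤ ind (c ∧ b) + ind (c' ∧ b')
ind-∨∧∧ false false c c' = z≤n
ind-∨∧∧ b b' false c' with b ∨ b'
... | true = z≤n
... | false = z≤n
ind-∨∧∧ b b' true false with b ∨ b'
... | true = z≤n
... | false = z≤n
ind-∨∧∧ true b' true true = s≤s z≤n
ind-∨∧∧ false true true true = ≤-refl

-- The union bound for u ⊕ V, v ⊕ U and W, after all three are made invariant under z.
doubled-union-bound : (S U V W : Subset r) (z u v : F₂^ r) →
  (∀ y → y ⊕ v ∈ U → y ∈ S) → (∀ y → y ⊕ u ∈ V → y ∈ S) → W ⊆ S → (∀ y → y ⊕ z ∈ S → y ∈ S) →
  (∀ y → y ∈ meet W z → y ⊕ v ∈ double U z → y ⊕ u ∈ double V z) →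
  2 * # U + 2 * # V + # (meet W z) ≤
    # S + (# (meet U z) + # (meet V z) +
      (2 * (# (λ y → U y ∧ V (y ⊕ (u ⊕ v))) + # (λ y → U y ∧ V (y ⊕ (u ⊕ v ⊕ z)))) + 2 * # (λ y → W y ∧ V (y ⊕ u))))
doubled-union-bound {r} S U V W z u v hU hV hW hz h =
  derive {ρ = # (double U z) ∷ # (double V z) ∷ # (meet U z) ∷ # (meet V z) ∷ # U ∷ # V ∷ # C ∷ # S ∷ p ∷ q ∷ t ∷ # (A ∩ B) ∷ # (B ∩ C) ∷ []}
    (2 ⊠ y₄ ⊞ 2 ⊠ y₅ ⊞ y₆ ≼ y₇ ⊞ (y₂ ⊞ y₃ ⊞ (2 ⊠ (y₈ ⊞ y₉) ⊞ 2 ⊠ y₁₀))) 1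
    (1 ⊗ 2 ⊠ y₄ ≼ y₀ ⊞ y₂ by ≤-reflexive (sym (#-double U z)) ∷
     1 ⊗ 2 ⊠ y₅ ≼ y₁ ⊞ y₃ by ≤-reflexive (sym (#-double V z)) ∷
     1 ⊗ y₀ ⊞ y₁ ⊞ y₆ ≼ y₇ ⊞ (y₁₁ ⊞ y₁₂) by main ∷
     1 ⊗ y₁₁ ≼ 2 ⊠ (y₈ ⊞ y₉) by AB ∷
     1 ⊗ y₁₂ ≼ 2 ⊠ y₁₀ by BC ∷ []) refl
  where
  A B C : Subset r
  A y = double U z (y ⊕ v)
  B y = double V z (y ⊕ u)
  C = meet W z
  p q t : ℕ
  p = # (λ y → U y ∧ V (y ⊕ (u ⊕ v)))
  q = # (λ y → U y ∧ V (y ⊕ (u ⊕ v ⊕ z)))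
  t = # (λ y → W y ∧ V (y ⊕ u))
  inA : A ⊆ S
  inA y a with ∨-true {U (y ⊕ v)} a
  ... | inj₁ a = hU y a
  ... | inj₂ a = hz y (hU (y ⊕ z) (subst (_∈ U) (group (y ∷ v ∷ z ∷ []) (x₀ ∔ x₁ ∔ x₂) (x₀ ∔ x₂ ∔ x₁) refl) a))
  inB : B ⊆ S
  inB y b with ∨-true {V (y ⊕ u)} b
  ... | inj₁ b = hV y b
  ... | inj₂ b = hz y (hV (y ⊕ z) (subst (_∈ V) (group (y ∷ u ∷ z ∷ []) (x₀ ∔ x₁ ∔ x₂) (x₀ ∔ x₂ ∔ x₁) refl) b))
  main : # (double U z) + # (double V z) + # C ≤ # S + (# (A ∩ B) + # (B ∩ C))
  main = subst (λ t → t + # C ≤ # S + (# (A ∩ B) + # (B ∩ C)))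
    (cong₂ _+_ (#-shift (double U z) v) (#-shift (double V z) u))
    (union-bound S A B C inA inB (λ y c → hW y (∧-trueˡ c)) (λ y a c → h y c a))
  f f' g : F₂^ r → ℕ
  f y = ind (U y ∧ V (y ⊕ (u ⊕ v)))
  f' y = ind (U y ∧ V (y ⊕ (u ⊕ v ⊕ z)))
  g y = ind (W y ∧ V (y ⊕ u))
  -- A point of both doubled translates arises in four ways; measured from `y ⊕ v` or from
  -- `y ⊕ (v ⊕ z)`, they are the two kinds counted by `p` and `q`, each occurring twice.
  ptAB : ∀ y → ind ((A ∩ B) y) ≤ (f (y ⊕ v) + f' (y ⊕ v)) + (f' (y ⊕ (v ⊕ z)) + f (y ⊕ (v ⊕ z)))
  ptAB y = subst (ind ((A ∩ B) y) ≤_)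
    (cong₂ _+_
      (cong₂ _+_ (cong (λ t → ind (U (y ⊕ v) ∧ V t)) (group (y ∷ u ∷ v ∷ z ∷ []) (x₀ ∔ x₁) (x₀ ∔ x₂ ∔ (x₁ ∔ x₂)) refl))
                 (cong (λ t → ind (U (y ⊕ v) ∧ V t)) (group (y ∷ u ∷ v ∷ z ∷ []) (x₀ ∔ x₁ ∔ x₃) (x₀ ∔ x₂ ∔ (x₁ ∔ x₂ ∔ x₃)) refl)))
      (cong₂ _+_ (cong₂ (λ s t → ind (U s ∧ V t)) (⊕-assoc y v z) (group (y ∷ u ∷ v ∷ z ∷ []) (x₀ ∔ x₁) (x₀ ∔ (x₂ ∔ x₃) ∔ (x₁ ∔ x₂ ∔ x₃)) refl))
                 (cong₂ (λ s t → ind (U s ∧ V t)) (⊕-assoc y v z) (group (y ∷ u ∷ v ∷ z ∷ []) (x₀ ∔ x₁ ∔ x₃) (x₀ ∔ (x₂ ∔ x₃) ∔ (x₁ ∔ x₂)) refl))))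
    (ind-∨∧∨ (U (y ⊕ v)) (U (y ⊕ v ⊕ z)) (V (y ⊕ u)) (V (y ⊕ u ⊕ z)))
  AB : # (A ∩ B) ≤ 2 * (p + q)
  AB = begin
    # (A ∩ B)
      ≤⟨ ∑-mono ptAB ⟩
    ∑ (λ y → (f (y ⊕ v) + f' (y ⊕ v)) + (f' (y ⊕ (v ⊕ z)) + f (y ⊕ (v ⊕ z))))
      ≡⟨ ∑-+ (λ y → f (y ⊕ v) + f' (y ⊕ v)) (λ y → f' (y ⊕ (v ⊕ z)) + f (y ⊕ (v ⊕ z))) ⟩
    ∑ (λ y → f (y ⊕ v) + f' (y ⊕ v)) + ∑ (λ y → f' (y ⊕ (v ⊕ z)) + f (y ⊕ (v ⊕ z)))
      ≡⟨ cong₂ _+_ (∑-shift (λ y → f y + f' y) v) (∑-shift (λ y → f' y + f y) (v ⊕ z)) ⟩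
    ∑ (λ y → f y + f' y) + ∑ (λ y → f' y + f y)
      ≡⟨ cong₂ _+_ (∑-+ f f') (∑-+ f' f) ⟩
    (p + q) + (q + p)
      ≡⟨ lem p q ⟩
    2 * (p + q) ∎
    where
    open ≤-Reasoning
    lem : ∀ p q → (p + q) + (q + p) ≡ 2 * (p + q)
    lem = solve-∀
  ptBC : ∀ y → ind ((B ∩ C) y) ≤ g y + g (y ⊕ z)
  ptBC y = subst (λ t → ind ((B ∩ C) y) ≤ g y + ind (W (y ⊕ z) ∧ V t)) (group (y ∷ u ∷ z ∷ []) (x₀ ∔ x₁ ∔ x₂) (x₀ ∔ x₂ ∔ x₁) refl)
             (ind-∨∧∧ (V (y ⊕ u)) (V (y ⊕ u ⊕ z)) (W y) (W (y ⊕ z)))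
  BC : # (B ∩ C) ≤ 2 * t
  BC = begin
    # (B ∩ C)                      ≤⟨ ∑-mono ptBC ⟩
    ∑ (λ y → g y + g (y ⊕ z))       ≡⟨ ∑-+ g (λ y → g (y ⊕ z)) ⟩
    t + ∑ (λ y → g (y ⊕ z))         ≡⟨ cong (t +_) (∑-shift g z) ⟩
    t + t                          ≡⟨ cong (t +_) (sym (+-identityʳ t)) ⟩
    2 * t                          ∎
    where open ≤-Reasoning

∑-exceeds : (f : F₂^ r → ℕ) (c : ℕ) → c * 2 ^ r < ∑ f → ∃[ x ] c < f x
∑-exceeds {r} f c h with all⊎any {P = λ x → f x ≤ c} {Q = λ x → c < f x} (λ x → ≤-<-connex (f x) c)
... | inj₁ p = ⊥-elim (<⇒≱ h (≤-trans (∑-mono p) (≤-reflexive (∑-const {r} c))))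
... | inj₂ q = q

-- Sums over distinct points

data Distinct {r : ℕ} : List (F₂^ r) → Set where
  [] : Distinct []
  _∷_ : ∀ {x l} → All (x ≢_) l → Distinct l → Distinct (x ∷ l)

lsum : (F₂^ r → ℕ) → List (F₂^ r) → ℕ
lsum f [] = 0
lsum f (x ∷ l) = f x + lsum f l

∑-point : (v : F₂^ r) (c : ℕ) → ∑ (λ x → c * ind (⁅ v ⁆ x)) ≡ c
∑-point v c = trans (∑-* c (λ x → ind (⁅ v ⁆ x))) (trans (cong (c *_) (#⁅⁆ v)) (*-identityʳ c))

lsum≤∑ : (f : F₂^ r → ℕ) {l : List (F₂^ r)} → Distinct l → lsum f l ≤ ∑ f
lsum≤∑ f [] = z≤n
lsum≤∑ {r} f {v ∷ l} (v∉ ∷ dist) = begin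
  f v + lsum f l                              ≡⟨ cong (f v +_) (same l v∉) ⟩
  f v + lsum f' l                             ≤⟨ +-monoʳ-≤ (f v) (lsum≤∑ f' dist) ⟩
  f v + ∑ f'                                  ≡⟨ cong (_+ ∑ f') (sym (∑-point v (f v))) ⟩
  ∑ (λ x → f v * ind (⁅ v ⁆ x)) + ∑ f'         ≡⟨ sym (∑-+ (λ x → f v * ind (⁅ v ⁆ x)) f') ⟩
  ∑ (λ x → f v * ind (⁅ v ⁆ x) + f' x)         ≤⟨ ∑-mono pt ⟩
  ∑ f                                         ∎
  where
  open ≤-Reasoning
  f' : F₂^ r → ℕ
  f' x = if ⌊ x ≟ v ⌋ then 0 else f x
  pt : ∀ x → f v * ind (⁅ v ⁆ x) + f' x ≤ f x
  pt x with x ≟ v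
  ... | yes refl = ≤-reflexive (trans (+-identityʳ _) (*-identityʳ _))
  ... | no _ = ≤-reflexive (cong (_+ f x) (*-zeroʳ (f v)))
  same : ∀ l → All (v ≢_) l → lsum f l ≡ lsum f' l
  same [] [] = refl
  same (x ∷ l) (n ∷ ns) rewrite ≟-false (λ e → n (sym e)) = cong (f x +_) (same l ns)

#≤1⇒≡ : {P : Subset r} {x y : F₂^ r} → # P ≤ 1 → x ∈ P → y ∈ P → x ≡ y
#≤1⇒≡ {P = P} {x} {y} h p q with x ≟ y
... | yes e = e
... | no n = ⊥-elim (<⇒≱ (s≤s (s≤s z≤n))
    (≤-trans (+-mono-≤ (ind-true p) (+-monoˡ-≤ 0 (ind-true q))) (≤-trans (lsum≤∑ (λ x → ind (P x)) ((n ∷ []) ∷ ([] ∷ []))) h)))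

-- Edge covers

Cover : Subset r → Subset r → Set
Cover X E = ∀ x → x ∈ X → ∃[ d ] d ∈ E × x ⊕ d ∈ X

module Degree {r : ℕ} (X E : Subset r) where
  incident : F₂^ r → Subset r
  incident x d = E d ∧ X (x ⊕ d)

  deg : F₂^ r → ℕ
  deg x = # (incident x)

  Leaves : Set
  Leaves = ∀ {d} → d ∈ E → ∃[ x ] x ∈ X × x ⊕ d ∈ X × deg x ≤ 1

-- Edges are discarded while the rest still covers. An edge that cannot go is the only one at some
-- vertex, and this vertex is the required leaf.
minimal-cover : (X D : Subset r) → Cover X D → ∃[ E ] E ⊆ D × Cover X E × Degree.Leaves X E
minimal-cover {r} X D cov = go (# D) D ≤-refl (λ _ p → p) cov
  where
  Tight : Subset r → F₂^ r → Set
  Tight E d = d ∈ E → ∃[ x ] x ∈ X × x ⊕ d ∈ X × Degree.deg X E x ≤ 1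
  tight⊎slack : ∀ E → Cover X E → ∀ d → Tight E d ⊎ (d ∈ E × Cover X (E ─ d))
  tight⊎slack E cov d with d ∈? E
  ... | no d∉ = inj₁ (λ d∈ → ⊥-elim (d∉ d∈))
  ... | yes d∈ with all⊎any {P = λ x → x ∈ X → ∃[ e ] e ∈ (E ─ d) × x ⊕ e ∈ X} {Q = λ x → x ∈ X × (∀ e → e ∈ (E ─ d) → x ⊕ e ∈ X → ⊥)} dec
    where
    dec : ∀ x → (x ∈ X → ∃[ e ] e ∈ (E ─ d) × x ⊕ e ∈ X) ⊎ (x ∈ X × (∀ e → e ∈ (E ─ d) → x ⊕ e ∈ X → ⊥))
    dec x with x ∈? X
    ... | no x∉ = inj₁ (λ x∈ → ⊥-elim (x∉ x∈))
    ... | yes x∈ with any? {P = λ e → e ∈ ((E ─ d) ∩ (λ e → X (x ⊕ e)))} (λ e → e ∈? ((E ─ d) ∩ (λ e → X (x ⊕ e))))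
    ...   | yes (e , p) = inj₁ (λ _ → e , ∧-trueˡ p , ∧-trueʳ {(E ─ d) e} p)
    ...   | no none = inj₂ (x∈ , λ e p q → none (e , ∧-intro p q))
  ...   | inj₁ c = inj₂ (d∈ , c)
  ...   | inj₂ (x , x∈ , none) = inj₁ (λ _ → x , x∈ , x⊕d∈ , ∑-at-most-one {P = Degree.incident X E x} (λ p q → trans (only p) (sym (only q))))
    where
    only : ∀ {e} → e ∈ Degree.incident X E x → e ≡ d
    only {e} p with e ≟ d
    ... | yes q = q
    ... | no n = ⊥-elim (none e (∈-─ {X = E} (∧-trueˡ p) n) (∧-trueʳ {E e} p))
    x⊕d∈ : x ⊕ d ∈ X
    x⊕d∈ with cov x x∈
    ... | e , e∈ , q with only {e} (∧-intro e∈ q)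
    ... | refl = q
  go : ∀ n E → # E ≤ n → E ⊆ D → Cover X E → ∃[ E' ] E' ⊆ D × Cover X E' × Degree.Leaves X E'
  go n E size E⊆ cov with all⊎any (tight⊎slack E cov)
  ... | inj₁ tight = E , E⊆ , cov , λ {d} → tight d
  go zero E size E⊆ cov | inj₂ (d , d∈ , _) = ⊥-elim (<⇒≱ (∈⇒#-pos {X = E} d∈) size)
  go (suc n) E size E⊆ cov | inj₂ (d , d∈ , cov') =
    go n (E ─ d) (≤-pred (≤-trans (subst (_≤ # E) (+-comm _ 1) (#-─-∈ {X = E} d∈)) size)) (λ x p → E⊆ x (proj₁ (─-∈ {X = E} p))) cov'

-- Two sets whose sumset avoids both of them

module _ (S : Subset r) (closed : ∀ {x y} → x ∈ S → y ∈ S → x ⊕ y ∈ S) where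

  -- If the union `C` has more than half of `S`, it meets its translate by `a`, and necessarily
  -- inside `A`: some `u` and `u ⊕ a` both lie in `A`. As sums of `A` and `B` miss `C`, the doubled
  -- `B` moved by `u` is disjoint from the doubled `C`. Their sizes are 2|B| and at least 2|C| -
  -- |A|, in total at least 2|C|, which is too much for `S`.
  avoiding-sumset-≤ : {A B : Subset r} → A ⊆ S → B ⊆ S → (∀ {y} → y ∈ A → y ∈ B → ⊥) →
    (∀ {x y} → x ∈ A → y ∈ B → x ⊕ y ∈ A → ⊥) → (∀ {x y} → x ∈ A → y ∈ B → x ⊕ y ∈ B → ⊥) →
    ∀ {a} → a ∈ A → # A ≤ # B → 2 * (# A + # B) ≤ # S
  avoiding-sumset-≤ {A} {B} A⊆ B⊆ disj sumA sumB {a} a∈ A≤B with 2 * (# A + # B) ≤? # S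
  ... | yes p = p
  ... | no ¬p = ⊥-elim (refute {ρ = # A ∷ # B ∷ # S ∷ # (double C a) ∷ # (meet C a) ∷ # (double B a) ∷ # C ∷ []}
          (1 ⊗ y₅ ⊞ y₃ ≼ y₂ by total ∷
           1 ⊗ 2 ⊠ y₆ ≼ y₃ ⊞ y₄ by ≤-reflexive (sym (#-double C a)) ∷
           1 ⊗ 2 ⊠ y₁ ≼ y₅ by ≤-reflexive (sym (#-double-apart B a apartB)) ∷
           1 ⊗ y₄ ≼ y₀ by #-mono {X = meet C a} {Y = A} (λ y m → proj₁ (inA m)) ∷
           1 ⊗ y₀ ≼ y₁ by A≤B ∷
           2 ⊗ y₀ ⊞ y₁ ≼ y₆ by #C≥ ∷
           1 ⊗ $ 1 ⊞ y₂ ≼ 2 ⊠ (y₀ ⊞ y₁) by ≰⇒> ¬p ∷ []) refl)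
    where
    C : Subset r
    C y = A y ∨ B y
    #C≥ : # A + # B ≤ # C
    #C≥ = disjoint-bound C A B (λ y p → ∨-introˡ p) (λ y p → ∨-introʳ {A y} p) (λ y → disj)
    C⊆ : C ⊆ S
    C⊆ y p with ∨-true {A y} p
    ... | inj₁ p = A⊆ y p
    ... | inj₂ p = B⊆ y p
    inA : ∀ {y} → y ∈ meet C a → y ∈ A × y ⊕ a ∈ A
    inA {y} m with ∨-true {A y} (∧-trueˡ m) | ∨-true {A (y ⊕ a)} (∧-trueʳ {C y} m)
    ... | inj₁ p | inj₁ q = p , q
    ... | inj₁ p | inj₂ q = ⊥-elim (sumA a∈ q (subst (_∈ A) (group (y ∷ a ∷ []) x₀ (x₁ ∔ (x₀ ∔ x₁)) refl) p))
    ... | inj₂ p | inj₁ q = ⊥-elim (sumA a∈ p (subst (_∈ A) (⊕-comm y a) q))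
    ... | inj₂ p | inj₂ q = ⊥-elim (sumB a∈ p (subst (_∈ B) (⊕-comm y a) q))
    apartB : Apart B a
    apartB y p q = sumB a∈ p (subst (_∈ B) (⊕-comm y a) q)
    double⊆ : ∀ {Y} → Y ⊆ S → double Y a ⊆ S
    double⊆ {Y} Y⊆ y p with ∨-true {Y y} p
    ... | inj₁ p = Y⊆ y p
    ... | inj₂ p = subst (_∈ S) (⊕-cancel y a) (closed (Y⊆ _ p) (A⊆ a a∈))
    common : ∃[ u ] u ∈ meet C a
    common = #-pos {X = meet C a} (derive {ρ = # (double C a) ∷ # (meet C a) ∷ # C ∷ # S ∷ # A ∷ # B ∷ []} ($ 1 ≼ y₁) 1
      (1 ⊗ 2 ⊠ y₂ ≼ y₀ ⊞ y₁ by ≤-reflexive (sym (#-double C a)) ∷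
       1 ⊗ y₀ ≼ y₃ by #-mono {X = double C a} {Y = S} (double⊆ C⊆) ∷
       2 ⊗ y₄ ⊞ y₅ ≼ y₂ by #C≥ ∷
       1 ⊗ $ 1 ⊞ y₃ ≼ 2 ⊠ (y₄ ⊞ y₅) by ≰⇒> ¬p ∷ []) refl)
    u : F₂^ r
    u = proj₁ common
    u∈ : u ∈ A × u ⊕ a ∈ A
    u∈ = inA (proj₂ common)
    Y : Subset r
    Y y = double B a (y ⊕ u)
    sum-misses : ∀ {x y} → x ∈ A → y ∈ B → x ⊕ y ∈ C → ⊥
    sum-misses {x} {y} p q c with ∨-true {A (x ⊕ y)} c
    ... | inj₁ c = sumA p q c
    ... | inj₂ c = sumB p q c
    apart : ∀ y → y ∈ Y → y ∈ double C a → ⊥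
    apart y p q with ∨-true {B (y ⊕ u)} p | ∨-true {C y} q
    ... | inj₁ p | inj₁ q = sum-misses (proj₁ u∈) p (subst (_∈ C) (group (y ∷ u ∷ a ∷ []) x₀ (x₁ ∔ (x₀ ∔ x₁)) refl) q)
    ... | inj₁ p | inj₂ q = sum-misses (proj₂ u∈) p (subst (_∈ C) (group (y ∷ u ∷ a ∷ []) (x₀ ∔ x₂) (x₁ ∔ x₂ ∔ (x₀ ∔ x₁)) refl) q)
    ... | inj₂ p | inj₁ q = sum-misses (proj₂ u∈) p (subst (_∈ C) (group (y ∷ u ∷ a ∷ []) x₀ (x₁ ∔ x₂ ∔ (x₀ ∔ x₁ ∔ x₂)) refl) q)
    ... | inj₂ p | inj₂ q = sum-misses (proj₁ u∈) p (subst (_∈ C) (group (y ∷ u ∷ a ∷ []) (x₀ ∔ x₂) (x₁ ∔ (x₀ ∔ x₁ ∔ x₂)) refl) q)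
    Y⊆ : Y ⊆ S
    Y⊆ y p = subst (_∈ S) (⊕-cancel y u) (closed (double⊆ B⊆ (y ⊕ u) p) (A⊆ u (proj₁ u∈)))
    total : # (double B a) + # (double C a) ≤ # S
    total = subst (λ v → v + # (double C a) ≤ # S) (#-shift (double B a) u) (disjoint-bound S Y (double C a) Y⊆ (double⊆ C⊆) apart)

  avoiding-sumset : {A B : Subset r} → A ⊆ S → B ⊆ S → (∀ {y} → y ∈ A → y ∈ B → ⊥) →
    (∀ {x y} → x ∈ A → y ∈ B → x ⊕ y ∈ A → ⊥) → (∀ {x y} → x ∈ A → y ∈ B → x ⊕ y ∈ B → ⊥) →
    ∀ {a b} → a ∈ A → b ∈ B → 2 * (# A + # B) ≤ # S
  avoiding-sumset {A} {B} A⊆ B⊆ disj sumA sumB {a} {b} a∈ b∈ with ≤-total (# A) (# B)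
  ... | inj₁ A≤B = avoiding-sumset-≤ A⊆ B⊆ disj sumA sumB a∈ A≤B
  ... | inj₂ B≤A = subst (λ v → 2 * v ≤ # S) (+-comm (# B) (# A))
        (avoiding-sumset-≤ B⊆ A⊆ (λ p q → disj q p)
          (λ {x} {y} p q m → sumB q p (subst (_∈ B) (⊕-comm x y) m))
          (λ {x} {y} p q m → sumA q p (subst (_∈ A) (⊕-comm x y) m)) b∈ B≤A)

-- Large sets whose unique sums avoid a subgroup of index two

module Bipartite {r : ℕ} (φ : F₂^ r → Bool) (φ-add : Additive φ) (X E : Subset r)
  (U : UniqueSums X E) (odd : ∀ {d} → d ∈ E → φ d ≡ true) (cover : Cover X E) where
  open UniqueSums U
  open Degree X E public

  class : Bool → Subset r
  class true y = φ y
  class false y = not (φ y)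

  ∈class : ∀ {c y} → φ y ≡ c → y ∈ class c
  ∈class {true} e = e
  ∈class {false} e rewrite e = refl

  class∈ : ∀ {c y} → y ∈ class c → φ y ≡ c
  class∈ {true} e = e
  class∈ {false} {y} e with φ y
  ... | false = refl

  side : Bool → Subset r
  side c = X ∩ class c

  ∈side : ∀ {c y} → y ∈ X → φ y ≡ c → y ∈ side c
  ∈side {c} p e = ∧-intro p (∈class {c} e)

  side∈ : ∀ {c y} → y ∈ side c → y ∈ X × φ y ≡ c
  side∈ {c} {y} p = ∧-trueˡ p , class∈ {c} (∧-trueʳ {X y} p)

  φ-xor : ∀ {x y a b} → φ x ≡ a → φ y ≡ b → φ (x ⊕ y) ≡ a xor b
  φ-xor {x} {y} p q = trans (φ-add x y) (cong₂ _xor_ p q)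

  c≢c-xor-true : ∀ {c} → c ≡ c xor true → ⊥
  c≢c-xor-true {true} ()
  c≢c-xor-true {false} ()

  xor-true : ∀ c → c xor true ≡ not c
  xor-true true = refl
  xor-true false = refl

  unique-side : ∀ {c d x y} → d ∈ E → x ∈ side c → x ⊕ d ∈ X → y ∈ side c → y ⊕ d ∈ X → x ≡ y
  unique-side {c} d∈ p p' q q' with unique d∈ (proj₁ (side∈ {c} p)) p' (proj₁ (side∈ {c} q)) q'
  ... | inj₁ e = e
  ... | inj₂ e = ⊥-elim (c≢c-xor-true {c} (trans (sym (proj₂ (side∈ {c} p))) (trans (cong φ e) (φ-xor (proj₂ (side∈ {c} q)) (odd d∈)))))

  ∣X∣ ∣E∣ : ℕ
  ∣X∣ = # X
  ∣E∣ = # E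

  sides : # (side true) + # (side false) ≡ ∣X∣
  sides = trans (sym (∑-+ (λ x → ind (side true x)) (λ x → ind (side false x)))) (∑-cong λ x → pt (X x) (φ x))
    where
    pt : ∀ a b → ind (a ∧ b) + ind (a ∧ not b) ≡ ind a
    pt true true = refl
    pt true false = refl
    pt false b = refl

  sides' : ∀ c → # (side c) + # (side (not c)) ≡ ∣X∣
  sides' true = sides
  sides' false = trans (+-comm (# (side false)) _) sides

  n : ℕ
  n = # (class true)

  -- Translation by an edge interchanges the classes. Without an edge, `φ` could vanish identically
  -- and `class true` be empty.
  #class : ∀ {d} → d ∈ E → ∀ c → # (class c) ≡ n
  #class d∈ true = refl
  #class {d} d∈ false = trans (∑-cong (λ y → cong ind (lem y))) (#-shift (class true) d)
    where
    lem : ∀ y → not (φ y) ≡ φ (y ⊕ d)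
    lem y = sym (trans (φ-add y d) (trans (cong (φ y xor_) (odd d∈)) (xor-true (φ y))))

  2n≡ : ∀ {d} → d ∈ E → 2 * n ≡ 2 ^ r
  2n≡ d∈ = begin
    n + (n + 0)                              ≡⟨ cong (n +_) (+-identityʳ n) ⟩
    n + n                                    ≡⟨ cong (n +_) (sym (#class d∈ false)) ⟩
    n + # (class false)                      ≡⟨ sym (∑-+ (λ y → ind (φ y)) (λ y → ind (not (φ y)))) ⟩
    ∑ (λ y → ind (φ y) + ind (not (φ y)))     ≡⟨ ∑-cong (λ y → pt (φ y)) ⟩
    # {r} (λ _ → true)                       ≡⟨ #-all {r} ⟩
    2 ^ r                                    ∎
    where
    open ≡-Reasoning
    pt : ∀ b → ind b + ind (not b) ≡ 1
    pt true = refl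
    pt false = refl

  deg≥1 : ∀ {x} → x ∈ X → 1 ≤ deg x
  deg≥1 {x} x∈ with cover x x∈
  ... | d , d∈ , p = ∈⇒#-pos {X = incident x} (∧-intro d∈ p)

  volume : Subset r → ℕ
  volume Y = ∑ (λ x → ind (Y x) * deg x)

  ind-* : ∀ a b → ind a * ind b ≡ ind (a ∧ b)
  ind-* true b = +-identityʳ _
  ind-* false b = refl

  volume-swap : ∀ Y → volume Y ≡ ∑ (λ d → # (λ x → Y x ∧ incident x d))
  volume-swap Y = trans (∑-cong λ x → trans (sym (∑-* (ind (Y x)) (λ d → ind (incident x d)))) (∑-cong λ d → ind-* (Y x) (incident x d)))
                        (∑-swap (λ x d → ind (Y x ∧ incident x d)))

  #≤volume : ∀ Y → Y ⊆ X → # Y ≤ volume Y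
  #≤volume Y Y⊆ = ∑-mono pt
    where
    pt : ∀ x → ind (Y x) ≤ ind (Y x) * deg x
    pt x with Y x in e
    ... | false = z≤n
    ... | true = ≤-trans (deg≥1 (Y⊆ x e)) (≤-reflexive (sym (+-identityʳ _)))

  -- Incidences are counted from the edges: the condition says that no edge has both ends in `Y`.
  volume≤∣E∣ : ∀ Y → (∀ {d x y} → d ∈ E → x ∈ Y → x ⊕ d ∈ X → y ∈ Y → y ⊕ d ∈ X → x ≡ y) → volume Y ≤ ∣E∣
  volume≤∣E∣ Y h = subst (_≤ ∣E∣) (sym (volume-swap Y)) (∑-mono pt)
    where
    pt : ∀ d → # (λ x → Y x ∧ incident x d) ≤ ind (E d)
    pt d with E d in e
    ... | true = ∑-at-most-one {P = λ x → Y x ∧ X (x ⊕ d)} (λ {x} {y} p q →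
                   h e (∧-trueˡ p) (∧-trueʳ {Y x} p) (∧-trueˡ q) (∧-trueʳ {Y y} q))
    ... | false = ≤-reflexive (#-empty {X = λ x → Y x ∧ false} λ x p → true≢false (∧-trueʳ {Y x} p) refl)

  volume-side : ∀ c → volume (side c) ≤ ∣E∣
  volume-side c = volume≤∣E∣ (side c) (unique-side {c})

  #side≤∣E∣ : ∀ c → # (side c) ≤ ∣E∣
  #side≤∣E∣ c = ≤-trans (#≤volume (side c) (λ x p → proj₁ (side∈ {c} p))) (volume-side c)

  -- Degrees beyond one. Both sides have volume at most |E| and all degrees are positive, so the
  -- total excess is at most 2|E| - |X|; this caps the degree sum of any distinct vertices.
  excess : F₂^ r → ℕ
  excess x = ind (X x) * (deg x ∸ 1)

  ∑excess : ∑ excess + ∣X∣ ≤ 2 * ∣E∣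
  ∑excess = begin
    ∑ excess + ∣X∣                                       ≡⟨ sym (∑-+ excess (λ x → ind (X x))) ⟩
    ∑ (λ x → excess x + ind (X x))                      ≤⟨ ∑-mono pt ⟩
    ∑ (λ x → ind (side true x) * deg x + ind (side false x) * deg x) ≡⟨ ∑-+ (λ x → ind (side true x) * deg x) (λ x → ind (side false x) * deg x) ⟩
    volume (side true) + volume (side false)           ≤⟨ +-mono-≤ (volume-side true) (volume-side false) ⟩
    ∣E∣ + ∣E∣                                              ≡⟨ cong (∣E∣ +_) (sym (+-identityʳ ∣E∣)) ⟩
    2 * ∣E∣                                              ∎
    where
    open ≤-Reasoning
    pt : ∀ x → excess x + ind (X x) ≤ ind (side true x) * deg x + ind (side false x) * deg x
    pt x with X x in e | φ x
    ... | false | _ = z≤n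
    ... | true | true = ≤-reflexive (trans (cong (_+ 1) (+-identityʳ _)) (trans (m∸n+n≡m (deg≥1 e)) (trans (sym (+-identityʳ _)) (sym (+-identityʳ _)))))
    ... | true | false = ≤-reflexive (trans (cong (_+ 1) (+-identityʳ _)) (trans (m∸n+n≡m (deg≥1 e)) (sym (+-identityʳ _))))

  lsum-deg : ∀ {l} → All (_∈ X) l → lsum deg l ≡ lsum excess l + length l
  lsum-deg [] = refl
  lsum-deg {x ∷ l} (p ∷ ps) rewrite lsum-deg ps | p = trans (cong (_+ (lsum excess l + length l)) (sym (m∸n+n≡m (deg≥1 p)))) (lem (deg x ∸ 1) (lsum excess l) (length l))
    where
    lem : ∀ a b c → a + 1 + (b + c) ≡ a + 0 + b + suc c
    lem = solve-∀

  distinct-degrees : ∀ {l} → Distinct l → All (_∈ X) l → lsum deg l + ∣X∣ ≤ 2 * ∣E∣ + length l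
  distinct-degrees {l} dist l⊆ = begin
    lsum deg l + ∣X∣                       ≡⟨ cong (_+ ∣X∣) (lsum-deg l⊆) ⟩
    lsum excess l + length l + ∣X∣         ≡⟨ lem (lsum excess l) (length l) ∣X∣ ⟩
    lsum excess l + ∣X∣ + length l         ≤⟨ +-monoˡ-≤ (length l) (+-monoˡ-≤ ∣X∣ (lsum≤∑ excess dist)) ⟩
    ∑ excess + ∣X∣ + length l              ≤⟨ +-monoˡ-≤ (length l) ∑excess ⟩
    2 * ∣E∣ + length l                     ∎
    where
    open ≤-Reasoning
    lem : ∀ a b c → a + b + c ≡ a + c + b
    lem = solve-∀

  φ-end : ∀ {d a c} → d ∈ E → φ a ≡ c → φ (a ⊕ d) ≡ not c
  φ-end {c = c} d∈ e = trans (φ-xor e (odd d∈)) (xor-true c)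

  -- a ⊕ side (not c), (a ⊕ d) ⊕ side c and E all lie in class true.
  edge-bound : ∀ {d a} → d ∈ E → a ∈ X → a ⊕ d ∈ X → ∣X∣ + ∣E∣ ≤ n + (deg a + deg (a ⊕ d))
  edge-bound {d} {a} d∈ a∈ b∈ = begin
    ∣X∣ + ∣E∣
      ≡⟨ cong (_+ ∣E∣) (trans (sym (sides' c)) (sym (cong₂ _+_ (#-shift (side c) b) (#-shift (side (not c)) a)))) ⟩
    # A + # B + ∣E∣
      ≡⟨ lem (# A) (# B) ∣E∣ ⟩
    # A + ∣E∣ + # B
      ≤⟨ union-bound (class true) A E B inA (λ y p → odd p) inB AB ⟩
    n + (# (A ∩ E) + # (E ∩ B))
      ≤⟨ +-monoʳ-≤ n (+-mono-≤ (#-mono {X = A ∩ E} {Y = incident b} toB) (#-mono {X = E ∩ B} {Y = incident a} toA)) ⟩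
    n + (deg b + deg a)
      ≡⟨ cong (n +_) (+-comm (deg b) (deg a)) ⟩
    n + (deg a + deg b) ∎
    where
    open ≤-Reasoning
    b : F₂^ r
    b = a ⊕ d
    c : Bool
    c = φ a
    A B : Subset r
    A y = side c (y ⊕ b)
    B y = side (not c) (y ⊕ a)
    lem : ∀ a b c → a + b + c ≡ a + c + b
    lem = solve-∀
    swap : ∀ y t → (y ⊕ t) ⊕ t ≡ y
    swap = ⊕-cancel
    xor-not : ∀ c → c xor not c ≡ true
    xor-not true = refl
    xor-not false = refl
    not-xor : ∀ c → not c xor c ≡ true
    not-xor true = refl
    not-xor false = refl
    inA : A ⊆ class true
    inA y p = trans (cong φ (sym (swap y b))) (trans (φ-xor (proj₂ (side∈ {c} p)) (φ-end d∈ refl)) (xor-not c))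
    inB : B ⊆ class true
    inB y p = trans (cong φ (sym (swap y a))) (trans (φ-xor (proj₂ (side∈ {not c} p)) refl) (not-xor c))
    toB : (A ∩ E) ⊆ incident b
    toB y p = ∧-intro (∧-trueʳ {A y} p) (subst (_∈ X) (⊕-comm y b) (proj₁ (side∈ {c} (∧-trueˡ p))))
    toA : (E ∩ B) ⊆ incident a
    toA y p = ∧-intro (∧-trueˡ p) (subst (_∈ X) (⊕-comm y a) (proj₁ (side∈ {not c} (∧-trueʳ {E y} p))))
    -- A common point of the two translates of sides yields two vertices joined by `d`. By
    -- uniqueness they are `a` and `b`, and the point is `d` itself.
    AB : ∀ y → y ∈ A → y ∈ B → y ∈ E
    AB y p q = subst (_∈ E) (trans (group (a ∷ d ∷ []) x₁ (x₀ ∔ (x₀ ∔ x₁)) refl) (trans (cong (_⊕ b) (sym eq)) (⊕-cancel y b))) d∈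
      where
      eq : y ⊕ b ≡ a
      eq = unique-side {c} d∈ p (subst (_∈ X) (group (a ∷ d ∷ y ∷ []) (x₂ ∔ x₀) (x₂ ∔ (x₀ ∔ x₁) ∔ x₁) refl) (proj₁ (side∈ {not c} q))) (∈side {c} a∈ refl) b∈

  crossing≤1 : ∀ c {e} → e ∈ E → # (λ y → side c y ∧ side (not c) (y ⊕ e)) ≤ 1
  crossing≤1 c {e} e∈ = ∑-at-most-one {P = λ y → side c y ∧ side (not c) (y ⊕ e)} λ {x} {y} p q →
    unique-side {c} e∈ (∧-trueˡ p) (proj₁ (side∈ {not c} (∧-trueʳ {side c x} p)))
                       (∧-trueˡ q) (proj₁ (side∈ {not c} (∧-trueʳ {side c y} q)))

  -- An edge of the cover with both ends of degree one

  module IsolatedEdge {d₁ d₂ a : F₂^ r} (d₁∈ : d₁ ∈ E) (d₂∈ : d₂ ∈ E) (d₂≢d₁ : d₂ ≢ d₁)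
    (a∈ : a ∈ X) (b∈ : a ⊕ d₁ ∈ X) (deg-a : deg a ≤ 1) (deg-b : deg (a ⊕ d₁) ≤ 1) where

    b z : F₂^ r
    b = a ⊕ d₁
    z = d₁ ⊕ d₂

    φz : φ z ≡ false
    φz = φ-xor (odd d₁∈) (odd d₂∈)

    z≢𝟎 : z ≢ 𝟎
    z≢𝟎 e = d₂≢d₁ (sym (⊕≡𝟎⇒≡ e))

    t : Bool → ℕ
    t c = # (meet (side c) z)

    w : ℕ
    w = # (meet E z)

    class-z : ∀ c y → y ⊕ z ∈ class c → y ∈ class c
    class-z c y p = ∈class {c} (trans (cong φ (sym (⊕-cancel y z))) (trans (φ-xor (class∈ {c} p) φz) (xor-false c)))
      where
      xor-false : ∀ c → c xor false ≡ c
      xor-false true = refl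
      xor-false false = refl

    xor-cases : ∀ c → c xor not c ≡ true × not c xor c ≡ true × not c xor true ≡ c
    xor-cases true = refl , refl , refl
    xor-cases false = refl , refl , refl

    -- The shift `z` is chosen such that `a ⊕ b` and `a ⊕ b ⊕ z` are the edges `d₁` and `d₂`, each
    -- of which joins the sides only once. With `deg a` at most one the overlaps amount to 2 * (1 +
    -- 1) + 2 * 1 = 6.
    edge-sums-bound : let c = φ a in
      2 * # (side c) + 2 * # (side (not c)) + w ≤ n + (t c + t (not c) + 6)
    edge-sums-bound =
      ≤-trans (doubled-union-bound (class true) (side c) (side (not c)) E z a b hU hV (λ _ p → odd p) (class-z true) h)
        (+-monoʳ-≤ n (+-monoʳ-≤ (t c + t (not c)) (+-mono-≤ (*-monoʳ-≤ 2 (+-mono-≤ r₁ r₂)) (*-monoʳ-≤ 2 r₃))))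
      where
      c = φ a
      hU : ∀ y → y ⊕ b ∈ side c → y ∈ class true
      hU y p = trans (cong φ (sym (⊕-cancel y b))) (trans (φ-xor (proj₂ (side∈ {c} p)) (φ-end d₁∈ refl)) (proj₁ (xor-cases c)))
      hV : ∀ y → y ⊕ a ∈ side (not c) → y ∈ class true
      hV y p = trans (cong φ (sym (⊕-cancel y a))) (trans (φ-xor (proj₂ (side∈ {not c} p)) refl) (proj₁ (proj₂ (xor-cases c))))
      b∈side : b ∈ side (not c)
      b∈side = ∈side {not c} b∈ (φ-end d₁∈ refl)
      at-b : ∀ {y} → y ∈ E → y ⊕ b ∈ side c → y ≡ d₁
      at-b {y} y∈ p = #≤1⇒≡ {P = incident b} deg-b
        (∧-intro y∈ (subst (_∈ X) (⊕-comm y b) (proj₁ (side∈ {c} p))))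
        (∧-intro d₁∈ (subst (_∈ X) (sym (⊕-cancel a d₁)) a∈))
      h : ∀ y → y ∈ meet E z → y ⊕ b ∈ double (side c) z → y ⊕ a ∈ double (side (not c)) z
      h y m p with ∨-true {side c (y ⊕ b)} p
      ... | inj₁ p with at-b (∧-trueˡ m) p
      ...   | refl = ∨-introˡ (subst (_∈ side (not c)) (⊕-comm a y) b∈side)
      h y m _ | inj₂ p with at-b {y ⊕ z} (∧-trueʳ {E y} m) (subst (_∈ side c) (group (y ∷ b ∷ z ∷ []) (x₀ ∔ x₁ ∔ x₂) (x₀ ∔ x₂ ∔ x₁) refl) p)
      ...   | e = ∨-introʳ {side (not c) (y ⊕ a)} (subst (_∈ side (not c))
                (trans (cong (a ⊕_) (sym e)) (group (a ∷ y ∷ z ∷ []) (x₀ ∔ (x₁ ∔ x₂)) (x₁ ∔ x₀ ∔ x₂) refl)) b∈side)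
      r₁ : # (λ y → side c y ∧ side (not c) (y ⊕ (a ⊕ b))) ≤ 1
      r₁ = crossing≤1 c (subst (_∈ E) (group (a ∷ d₁ ∷ []) x₁ (x₀ ∔ (x₀ ∔ x₁)) refl) d₁∈)
      r₂ : # (λ y → side c y ∧ side (not c) (y ⊕ (a ⊕ b ⊕ z))) ≤ 1
      r₂ = crossing≤1 c (subst (_∈ E) (group (a ∷ d₁ ∷ d₂ ∷ []) x₂ (x₀ ∔ (x₀ ∔ x₁) ∔ (x₁ ∔ x₂)) refl) d₂∈)
      r₃ : # (λ y → E y ∧ side (not c) (y ⊕ a)) ≤ 1
      r₃ = ≤-trans (#-mono {X = λ y → E y ∧ side (not c) (y ⊕ a)} {Y = incident a}
             (λ y p → ∧-intro (∧-trueˡ p) (subst (_∈ X) (⊕-comm y a) (proj₁ (side∈ {not c} (∧-trueʳ {E y} p)))))) deg-a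

    -- Here the three sets are `side (not c)` moved by `d`, `E` moved by `p ⊕ d`, and `side c`, all
    -- inside `class c`; their overlaps are edges at `p`, `p ⊕ z` and `p ⊕ d`.
    vertex-sums-bound : ∀ {c p d} → p ∈ side c → p ⊕ z ∈ X → d ∈ E → p ⊕ d ∈ X →
      2 * # (side (not c)) + 2 * ∣E∣ + t c ≤ n + (t (not c) + w + (2 * (deg p + deg (p ⊕ z)) + 2 * deg (p ⊕ d)))
    vertex-sums-bound {c} {p} {d} p∈ p'∈ d∈ q∈ =
      ≤-trans (doubled-union-bound (class c) (side (not c)) E (side c) z q d hU hV (λ y p → ∧-trueʳ {X y} p) (class-z c) h)
        (+-mono-≤ (≤-reflexive (#class d∈ c)) (+-monoʳ-≤ (t (not c) + w) (+-mono-≤ (*-monoʳ-≤ 2 (+-mono-≤ r₁ r₂)) (*-monoʳ-≤ 2 r₃))))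
      where
      q : F₂^ r
      q = p ⊕ d
      hU : ∀ y → y ⊕ d ∈ side (not c) → y ∈ class c
      hU y u = ∈class {c} (trans (cong φ (sym (⊕-cancel y d))) (trans (φ-xor (proj₂ (side∈ {not c} u)) (odd d∈)) (proj₂ (proj₂ (xor-cases c)))))
      hV : ∀ y → y ⊕ q ∈ E → y ∈ class c
      hV y v = ∈class {c} (trans (cong φ (sym (⊕-cancel y q))) (trans (φ-xor (odd v) (φ-end d∈ (proj₂ (side∈ {c} p∈)))) (lem c)))
        where
        lem : ∀ c → true xor not c ≡ c
        lem true = refl
        lem false = refl
      h : ∀ y → y ∈ meet (side c) z → y ⊕ d ∈ double (side (not c)) z → y ⊕ q ∈ double E z
      h y m u with ∨-true {side (not c) (y ⊕ d)} u
      ... | inj₁ u with unique-side {c} d∈ (∧-trueˡ m) (proj₁ (side∈ {not c} u)) p∈ q∈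
      ...   | refl = ∨-introˡ (subst (_∈ E) (group (y ∷ d ∷ []) x₁ (x₀ ∔ (x₀ ∔ x₁)) refl) d∈)
      h y m _ | inj₂ u with unique-side {c} {x = y ⊕ z} d∈ (∧-trueʳ {side c y} m)
                           (subst (_∈ X) (group (y ∷ d ∷ z ∷ []) (x₀ ∔ x₁ ∔ x₂) (x₀ ∔ x₂ ∔ x₁) refl) (proj₁ (side∈ {not c} u))) p∈ q∈
      ...   | e = ∨-introʳ {E (y ⊕ q)} (subst (_∈ E) (trans (group (p ∷ d ∷ []) x₁ (x₀ ∔ (x₀ ∔ x₁)) refl)
                    (trans (cong (_⊕ q) (sym e)) (group (y ∷ z ∷ q ∷ []) (x₀ ∔ x₁ ∔ x₂) (x₀ ∔ x₂ ∔ x₁) refl))) d∈)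
      neighbours : ∀ v → # (λ y → side (not c) y ∧ E (y ⊕ v)) ≤ deg v
      neighbours v = ≤-trans (≤-reflexive (sym (#-shift (λ y → side (not c) y ∧ E (y ⊕ v)) v)))
        (#-mono {X = λ y → side (not c) (y ⊕ v) ∧ E (y ⊕ v ⊕ v)} {Y = incident v} λ y p →
          ∧-intro (subst (_∈ E) (⊕-cancel y v) (∧-trueʳ {side (not c) (y ⊕ v)} p))
                  (subst (_∈ X) (⊕-comm y v) (proj₁ (side∈ {not c} (∧-trueˡ p)))))
      r₁ : # (λ y → side (not c) y ∧ E (y ⊕ (q ⊕ d))) ≤ deg p
      r₁ = subst (λ v → # (λ y → side (not c) y ∧ E (y ⊕ v)) ≤ deg p) (sym (⊕-cancel p d)) (neighbours p)
      r₂ : # (λ y → side (not c) y ∧ E (y ⊕ (q ⊕ d ⊕ z))) ≤ deg (p ⊕ z)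
      r₂ = subst (λ v → # (λ y → side (not c) y ∧ E (y ⊕ v)) ≤ deg (p ⊕ z)) (cong (_⊕ z) (sym (⊕-cancel p d))) (neighbours (p ⊕ z))
      r₃ : # (λ y → side c y ∧ E (y ⊕ q)) ≤ deg q
      r₃ = ≤-trans (≤-reflexive (sym (#-shift (λ y → side c y ∧ E (y ⊕ q)) q)))
        (#-mono {X = λ y → side c (y ⊕ q) ∧ E (y ⊕ q ⊕ q)} {Y = incident q} λ y p →
          ∧-intro (subst (_∈ E) (⊕-cancel y q) (∧-trueʳ {side c (y ⊕ q)} p))
                  (subst (_∈ X) (⊕-comm y q) (proj₁ (side∈ {c} (∧-trueˡ p)))))

    -- The translate by `z` of such an edge would represent `d` again. Uniqueness makes `z` equal to
    -- 0 or to `d`; but `z` is non-zero, and `φ` differs at `z` and `d`.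
    independent : ∀ {d x} → d ∈ E → x ∈ meet X z → x ⊕ d ∈ meet X z → ⊥
    independent {d} {x} d∈ p q with ∧-true p | ∧-true {X (x ⊕ d)} q
    ... | p₁ , p₂ | q₁ , q₂ with unique d∈ p₂ (subst (_∈ X) (group (x ∷ z ∷ d ∷ []) (x₀ ∔ x₂ ∔ x₁) (x₀ ∔ x₁ ∔ x₂) refl) q₂) p₁ q₁
    ... | inj₁ e = z≢𝟎 (trans (group (x ∷ z ∷ []) x₁ (x₀ ∔ x₁ ∔ x₀) refl) (trans (cong (_⊕ x) e) (⊕-self x)))
    ... | inj₂ e = true≢false (odd d∈) (trans (cong φ (trans (group (x ∷ d ∷ []) x₁ (x₀ ∔ (x₀ ∔ x₁)) refl)
                    (trans (cong (x ⊕_) (sym e)) (group (x ∷ z ∷ []) (x₀ ∔ (x₀ ∔ x₁)) x₁ refl)))) φz)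

    meet-bound : t true + t false ≤ ∣E∣
    meet-bound = begin
      t true + t false      ≤⟨ disjoint-bound (meet X z) (meet (side true) z) (meet (side false) z) (into true) (into false) apart ⟩
      # (meet X z)          ≤⟨ #≤volume (meet X z) (λ x p → ∧-trueˡ p) ⟩
      volume (meet X z)     ≤⟨ volume≤∣E∣ (meet X z) one ⟩
      ∣E∣                   ∎
      where
      open ≤-Reasoning
      into : ∀ c → meet (side c) z ⊆ meet X z
      into c x p = ∧-intro (proj₁ (side∈ {c} (∧-trueˡ p))) (proj₁ (side∈ {c} (∧-trueʳ {side c x} p)))
      apart : ∀ y → y ∈ meet (side true) z → y ∈ meet (side false) z → ⊥
      apart y p q = true≢false (proj₂ (side∈ {true} (∧-trueˡ p))) (proj₂ (side∈ {false} (∧-trueˡ q)))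
      one : ∀ {d x y} → d ∈ E → x ∈ meet X z → x ⊕ d ∈ X → y ∈ meet X z → y ⊕ d ∈ X → x ≡ y
      one d∈ p p' q q' with unique d∈ (∧-trueˡ p) p' (∧-trueˡ q) q'
      ... | inj₁ e = e
      ... | inj₂ refl = ⊥-elim (independent d∈ q p)

    meet-bound' : ∀ c → t c + t (not c) ≤ ∣E∣
    meet-bound' true = meet-bound
    meet-bound' false = subst (_≤ ∣E∣) (+-comm (t true) (t false)) meet-bound

    edge-sums-bound' : ∀ c → 2 * # (side c) + 2 * # (side (not c)) + w ≤ n + (t c + t (not c) + 6)
    edge-sums-bound' c with φ a | edge-sums-bound
    edge-sums-bound' true | true | h = h
    edge-sums-bound' false | false | h = h
    edge-sums-bound' true | false | h = flip-bound {# (side false)} {# (side true)} {t false} h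
      where
      flip-bound : ∀ {A B C D} → 2 * A + 2 * B + w ≤ n + (C + D + 6) → 2 * B + 2 * A + w ≤ n + (D + C + 6)
      flip-bound {A} {B} {C} {D} = subst₂ (λ u v → u + w ≤ n + (v + 6)) (+-comm (2 * A) (2 * B)) (+-comm C D)
    edge-sums-bound' false | true | h = flip-bound {# (side true)} {# (side false)} {t true} h
      where
      flip-bound : ∀ {A B C D} → 2 * A + 2 * B + w ≤ n + (C + D + 6) → 2 * B + 2 * A + w ≤ n + (D + C + 6)
      flip-bound {A} {B} {C} {D} = subst₂ (λ u v → u + w ≤ n + (v + 6)) (+-comm (2 * A) (2 * B)) (+-comm C D)

    record Shared (c : Bool) : Set where
      field
        {p d} : F₂^ r
        p∈ : p ∈ side c
        p⊕z∈ : p ⊕ z ∈ X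
        d∈ : d ∈ E
        q∈ : p ⊕ d ∈ X

    shared : ∀ c → 0 < t c → Shared c
    shared c pos with #-pos {X = meet (side c) z} pos
    ... | p , m with cover p (proj₁ (side∈ {c} (∧-trueˡ m)))
    ... | d , d∈ , q∈ = record { p∈ = ∧-trueˡ m ; p⊕z∈ = proj₁ (side∈ {c} (∧-trueʳ {side c p} m)) ; d∈ = d∈ ; q∈ = q∈ }

    isolated-bound : ∣X∣ + ∣E∣ ≤ n + 2
    isolated-bound = ≤-trans (edge-bound d₁∈ a∈ b∈) (+-monoʳ-≤ n (+-mono-≤ deg-a deg-b))

    ≢-⊕z : ∀ {x} → x ≢ x ⊕ z
    ≢-⊕z {x} e = z≢𝟎 (trans (group (x ∷ z ∷ []) x₁ (x₀ ∔ (x₀ ∔ x₁)) refl) (trans (cong (x ⊕_) (sym e)) (⊕-self x)))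

    ≢-side : ∀ {x y c} → φ x ≡ c → φ y ≡ not c → x ≢ y
    ≢-side {c = true} p q refl = true≢false p q
    ≢-side {c = false} p q refl = true≢false q p

    φ-⊕z : ∀ {x c} → φ x ≡ c → φ (x ⊕ z) ≡ c
    φ-⊕z {x} {c} p = class∈ {c} (class-z c (x ⊕ z) (subst (_∈ class c) (sym (⊕-cancel x z)) (∈class {c} p)))

    module _ (large : 11 * (2 * n) + 109 ≤ 36 * ∣X∣) where

      -- Otherwise the two union bounds, with the degree sum of three distinct vertices, leave |X|
      -- at most 3n/5 + 2, whereas the hypothesis gives more than 11n/18 + 3.
      other-side : ∀ c → Shared c → 0 < t (not c)
      other-side c sh with 0 <? t (not c)
      ... | yes pos = pos
      ... | no none = ⊥-elim (refute
            {ρ = # (side c) ∷ # (side (not c)) ∷ ∣E∣ ∷ w ∷ n ∷ t c ∷ t (not c) ∷ deg p ∷ deg (p ⊕ z) ∷ deg (p ⊕ d) ∷ []}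
            (18 ⊗ 2 ⊠ y₀ ⊞ 2 ⊠ y₁ ⊞ y₃ ≼ y₄ ⊞ (y₅ ⊞ y₆ ⊞ $ 6) by edge-sums-bound' c ∷
             18 ⊗ 2 ⊠ y₁ ⊞ 2 ⊠ y₂ ⊞ y₅ ≼ y₄ ⊞ (y₆ ⊞ y₃ ⊞ (2 ⊠ (y₇ ⊞ y₈) ⊞ 2 ⊠ y₉)) by vertex-sums-bound {c} p∈ p⊕z∈ d∈ q∈ ∷
             36 ⊗ y₇ ⊞ (y₈ ⊞ (y₉ ⊞ $ 0)) ⊞ (y₀ ⊞ y₁) ≼ 2 ⊠ y₂ ⊞ $ 3 by
               subst (λ v → deg p + (deg (p ⊕ z) + (deg (p ⊕ d) + 0)) + v ≤ 2 * ∣E∣ + 3) (sym (sides' c)) (distinct-degrees dist all∈) ∷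
             36 ⊗ y₀ ≼ y₂ by #side≤∣E∣ c ∷
             72 ⊗ y₀ ⊞ y₁ ⊞ y₂ ≼ y₄ ⊞ $ 2 by subst (λ v → v + ∣E∣ ≤ n + 2) (sym (sides' c)) isolated-bound ∷
             36 ⊗ y₆ ≼ $ 0 by ≮⇒≥ none ∷
             5 ⊗ 11 ⊠ (2 ⊠ y₄) ⊞ $ 109 ≼ 36 ⊠ (y₀ ⊞ y₁) by subst (λ v → 11 * (2 * n) + 109 ≤ 36 * v) (sym (sides' c)) large ∷ []) refl)
        where
        open Shared sh
        φp : φ p ≡ c
        φp = proj₂ (side∈ {c} p∈)
        dist : Distinct (p ∷ p ⊕ z ∷ p ⊕ d ∷ [])
        dist = (≢-⊕z ∷ ≢-side φp (φ-end d∈ φp) ∷ []) ∷ (≢-side (φ-⊕z φp) (φ-end d∈ φp) ∷ []) ∷ [] ∷ []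
        all∈ : All (_∈ X) (p ∷ p ⊕ z ∷ p ⊕ d ∷ [])
        all∈ = proj₁ (side∈ {c} p∈) ∷ p⊕z∈ ∷ q∈ ∷ []

      -- Between the two vertex bounds the numbers `t` cancel; those of the edge bound are absorbed
      -- by `meet-bound'`. The degree sum of six distinct vertices then again leaves about 3n/5 for
      -- |X|. That `meet X z` is independent keeps the six distinct.
      both-sides : ∀ c → Shared c → Shared (not c) → ⊥
      both-sides c sh sh' = refute
            {ρ = # (side c) ∷ # (side (not c)) ∷ ∣E∣ ∷ w ∷ n ∷ t c ∷ t (not c) ∷ deg p ∷ deg (p ⊕ z) ∷ deg (p ⊕ d) ∷
                 deg p' ∷ deg (p' ⊕ z) ∷ deg (p' ⊕ d') ∷ []}
            (36 ⊗ 2 ⊠ y₀ ⊞ 2 ⊠ y₁ ⊞ y₃ ≼ y₄ ⊞ (y₅ ⊞ y₆ ⊞ $ 6) by edge-sums-bound' c ∷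
             18 ⊗ 2 ⊠ y₁ ⊞ 2 ⊠ y₂ ⊞ y₅ ≼ y₄ ⊞ (y₆ ⊞ y₃ ⊞ (2 ⊠ (y₇ ⊞ y₈) ⊞ 2 ⊠ y₉)) by vertex-sums-bound {c} p∈ p⊕z∈ d∈ q∈ ∷
             18 ⊗ 2 ⊠ y₀ ⊞ 2 ⊠ y₂ ⊞ y₆ ≼ y₄ ⊞ (y₅ ⊞ y₃ ⊞ (2 ⊠ (y₁₀ ⊞ y₁₁) ⊞ 2 ⊠ y₁₂)) by
               subst (λ e → 2 * # (side e) + 2 * ∣E∣ + t (not c) ≤ n + (t e + w + (2 * (deg p' + deg (p' ⊕ z)) + 2 * deg (p' ⊕ d'))))
                     (not-involutive c) (vertex-sums-bound {not c} p'∈ p'⊕z∈ d'∈ q'∈) ∷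
             36 ⊗ y₇ ⊞ (y₈ ⊞ (y₉ ⊞ (y₁₀ ⊞ (y₁₁ ⊞ (y₁₂ ⊞ $ 0))))) ⊞ (y₀ ⊞ y₁) ≼ 2 ⊠ y₂ ⊞ $ 6 by
               subst (λ v → lsum deg six + v ≤ 2 * ∣E∣ + 6) (sym (sides' c)) (distinct-degrees dist all∈) ∷
             36 ⊗ y₅ ⊞ y₆ ≼ y₂ by meet-bound' c ∷
             36 ⊗ y₀ ⊞ y₁ ⊞ y₂ ≼ y₄ ⊞ $ 2 by subst (λ v → v + ∣E∣ ≤ n + 2) (sym (sides' c)) isolated-bound ∷
             5 ⊗ 11 ⊠ (2 ⊠ y₄) ⊞ $ 109 ≼ 36 ⊠ (y₀ ⊞ y₁) by subst (λ v → 11 * (2 * n) + 109 ≤ 36 * v) (sym (sides' c)) large ∷ []) refl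
        where
        open Shared sh
        open Shared sh' renaming (p to p'; d to d'; p∈ to p'∈; p⊕z∈ to p'⊕z∈; d∈ to d'∈; q∈ to q'∈)
        φp : φ p ≡ c
        φp = proj₂ (side∈ {c} p∈)
        φp' : φ p' ≡ not c
        φp' = proj₂ (side∈ {not c} p'∈)
        φq' : φ (p' ⊕ d') ≡ c
        φq' = trans (φ-end d'∈ φp') (not-involutive c)
        pz : p ∈ meet X z
        pz = ∧-intro (proj₁ (side∈ {c} p∈)) p⊕z∈
        p'z : p' ∈ meet X z
        p'z = ∧-intro (proj₁ (side∈ {not c} p'∈)) p'⊕z∈
        turn : ∀ {x} → x ∈ meet X z → x ⊕ z ∈ meet X z
        turn {x} m = ∧-intro (∧-trueʳ {X x} m) (subst (_∈ X) (sym (⊕-cancel x z)) (∧-trueˡ m))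
        six : List (F₂^ r)
        six = p ∷ p ⊕ z ∷ p ⊕ d ∷ p' ∷ p' ⊕ z ∷ p' ⊕ d' ∷ []
        dist : Distinct six
        dist = (≢-⊕z ∷ ≢-side φp (φ-end d∈ φp) ∷ ≢-side φp φp' ∷ ≢-side φp (φ-⊕z φp') ∷ (λ e → independent d'∈ p'z (subst (_∈ meet X z) e pz)) ∷ [])
             ∷ (≢-side (φ-⊕z φp) (φ-end d∈ φp) ∷ ≢-side (φ-⊕z φp) φp' ∷ ≢-side (φ-⊕z φp) (φ-⊕z φp') ∷ (λ e → independent d'∈ p'z (subst (_∈ meet X z) e (turn pz))) ∷ [])
             ∷ ((λ e → independent d∈ pz (subst (_∈ meet X z) (sym e) p'z)) ∷ (λ e → independent d∈ pz (subst (_∈ meet X z) (sym e) (turn p'z))) ∷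
                (λ e → ≢-side φq' (φ-end d∈ φp) (sym e)) ∷ [])
             ∷ (≢-⊕z ∷ (λ e → ≢-side φq' φp' (sym e)) ∷ [])
             ∷ ((λ e → ≢-side φq' (φ-⊕z φp') (sym e)) ∷ [])
             ∷ [] ∷ []
        all∈ : All (_∈ X) six
        all∈ = proj₁ (side∈ {c} p∈) ∷ p⊕z∈ ∷ q∈ ∷ proj₁ (side∈ {not c} p'∈) ∷ p'⊕z∈ ∷ q'∈ ∷ []

      contradiction : ⊥
      contradiction with 0 <? t true | 0 <? t false
      ... | yes pos | _ = both-sides true (shared true pos) (shared false (other-side true (shared true pos)))
      ... | no _ | yes pos = both-sides false (shared false pos) (shared true (other-side false (shared false pos)))
      -- With nothing shared, 2|X| is at most n + 6. Here the additive constant is exhausted: 18 * 6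
      -- = 108, one less than 109.
      ... | no none | no none' = refute {ρ = # (side true) ∷ # (side false) ∷ w ∷ n ∷ t true ∷ t false ∷ []}
            (18 ⊗ 2 ⊠ y₀ ⊞ 2 ⊠ y₁ ⊞ y₂ ≼ y₃ ⊞ (y₄ ⊞ y₅ ⊞ $ 6) by edge-sums-bound' true ∷
             18 ⊗ y₄ ≼ $ 0 by ≮⇒≥ none ∷ 18 ⊗ y₅ ≼ $ 0 by ≮⇒≥ none' ∷
             1 ⊗ 11 ⊠ (2 ⊠ y₃) ⊞ $ 109 ≼ 36 ⊠ (y₀ ⊞ y₁) by subst (λ v → 11 * (2 * n) + 109 ≤ 36 * v) (sym sides) large ∷ []) refl

  -- Covers that are disjoint unions of stars

  module NoIsolatedEdge (leaves : Leaves)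
    (joined : ∀ {d x} → d ∈ E → x ∈ X → x ⊕ d ∈ X → deg x ≤ 1 → deg (x ⊕ d) ≤ 1 → ⊥)
    (large : 11 * (2 * n) + 109 ≤ 36 * ∣X∣) where

    -- Every edge now joins a leaf to a centre, so the components are stars and there are as many
    -- leaves as edges.
    Leaf Centre : Subset r
    Leaf x = X x ∧ (deg x ≤ᵇ 1)
    Centre x = X x ∧ not (deg x ≤ᵇ 1)

    ∈Leaf : ∀ {x} → x ∈ X → deg x ≤ 1 → x ∈ Leaf
    ∈Leaf p q = ∧-intro p (T⇒true (≤⇒≤ᵇ q))

    Leaf∈ : ∀ {x} → x ∈ Leaf → x ∈ X × deg x ≤ 1
    Leaf∈ {x} p = ∧-trueˡ p , ≤ᵇ⇒≤ _ _ (T-true (∧-trueʳ {X x} p))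

    leaf⊎centre : ∀ {x} → x ∈ X → x ∈ Leaf ⊎ x ∈ Centre
    leaf⊎centre {x} p with deg x ≤ᵇ 1
    ... | true = inj₁ (∧-intro p refl)
    ... | false = inj₂ (∧-intro p refl)

    leaf-centre-disjoint : ∀ {x} → x ∈ Leaf → x ∈ Centre → ⊥
    leaf-centre-disjoint {x} p q with deg x ≤ᵇ 1 | ∧-trueʳ {X x} p | ∧-trueʳ {X x} q
    ... | true | _ | ()
    ... | false | () | _

    Centre⊆X : Centre ⊆ X
    Centre⊆X x p = ∧-trueˡ p

    centre-deg : ∀ {x} → x ∈ Centre → 2 ≤ deg x
    centre-deg {x} p with deg x ≤? 1
    ... | yes q = ⊥-elim (leaf-centre-disjoint (∈Leaf (Centre⊆X x p) q) p)
    ... | no q = ≰⇒> q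

    opposite-leaf : ∀ {d x} → d ∈ E → x ∈ Centre → x ⊕ d ∈ X → x ⊕ d ∈ Leaf
    opposite-leaf {d} {x} d∈ x∈ x'∈ with leaves d∈
    ... | l , l∈ , l'∈ , l-deg with unique d∈ l∈ l'∈ (Centre⊆X x x∈) x'∈
    ... | inj₁ refl = ⊥-elim (leaf-centre-disjoint (∈Leaf l∈ l-deg) x∈)
    ... | inj₂ refl = ∈Leaf l∈ l-deg

    opposite-centre : ∀ {d x} → d ∈ E → x ∈ Leaf → x ⊕ d ∈ X → x ⊕ d ∈ Centre
    opposite-centre d∈ x∈ x'∈ with leaf⊎centre x'∈
    ... | inj₂ c = c
    ... | inj₁ l = ⊥-elim (joined d∈ (proj₁ (Leaf∈ x∈)) x'∈ (proj₂ (Leaf∈ x∈)) (proj₂ (Leaf∈ l)))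

    ∣E∣≤#Leaf : ∣E∣ ≤ # Leaf
    ∣E∣≤#Leaf = begin
      ∣E∣                                                ≤⟨ ∑-mono pt ⟩
      ∑ (λ d → # (λ x → Leaf x ∧ incident x d))           ≡⟨ sym (volume-swap Leaf) ⟩
      volume Leaf                                        ≤⟨ ∑-mono pt' ⟩
      # Leaf                                             ∎
      where
      open ≤-Reasoning
      pt : ∀ d → ind (E d) ≤ # (λ x → Leaf x ∧ incident x d)
      pt d with E d in e
      ... | false = z≤n
      ... | true with leaves e
      ...   | x , x∈ , x'∈ , x-deg = ∈⇒#-pos {X = λ x → Leaf x ∧ X (x ⊕ d)} (∧-intro (∈Leaf x∈ x-deg) x'∈)
      pt' : ∀ x → ind (Leaf x) * deg x ≤ ind (Leaf x)
      pt' x with Leaf x in e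
      ... | false = z≤n
      ... | true = ≤-trans (≤-reflexive (+-identityʳ _)) (proj₂ (Leaf∈ e))

    #Leaf≤∣E∣ : # Leaf ≤ ∣E∣
    #Leaf≤∣E∣ = ≤-trans (#≤volume Leaf (λ x p → proj₁ (Leaf∈ p))) (volume≤∣E∣ Leaf one)
      where
      one : ∀ {d x y} → d ∈ E → x ∈ Leaf → x ⊕ d ∈ X → y ∈ Leaf → y ⊕ d ∈ X → x ≡ y
      one d∈ p p' q q' with unique d∈ (proj₁ (Leaf∈ p)) p' (proj₁ (Leaf∈ q)) q'
      ... | inj₁ e = e
      ... | inj₂ refl = ⊥-elim (leaf-centre-disjoint p (opposite-centre d∈ q q'))

    volume-Centre : volume Centre ≤ ∣E∣
    volume-Centre = volume≤∣E∣ Centre one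
      where
      one : ∀ {d x y} → d ∈ E → x ∈ Centre → x ⊕ d ∈ X → y ∈ Centre → y ⊕ d ∈ X → x ≡ y
      one {x = x} {y} d∈ p p' q q' with unique d∈ (Centre⊆X x p) p' (Centre⊆X y q) q'
      ... | inj₁ e = e
      ... | inj₂ refl = ⊥-elim (leaf-centre-disjoint (opposite-leaf d∈ q q') p)

    m : ℕ
    m = # Centre

    #Leaf+m : # Leaf + m ≡ ∣X∣
    #Leaf+m = trans (sym (∑-+ (λ x → ind (Leaf x)) (λ x → ind (Centre x)))) (∑-cong (λ x → pt (X x) (deg x ≤ᵇ 1)))
      where
      pt : ∀ a b → ind (a ∧ b) + ind (a ∧ not b) ≡ ind a
      pt true true = refl
      pt true false = refl
      pt false b = refl

    2m≤∣E∣ : 2 * m ≤ ∣E∣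
    2m≤∣E∣ = ≤-trans (≤-reflexive (sym (∑-* 2 (λ x → ind (Centre x))))) (≤-trans (∑-mono pt) volume-Centre)
      where
      pt : ∀ x → 2 * ind (Centre x) ≤ ind (Centre x) * deg x
      pt x with Centre x in e
      ... | false = z≤n
      ... | true = ≤-trans (centre-deg e) (≤-reflexive (sym (+-identityʳ _)))

    -- Take `edge-bound` for one edge at each centre and add up: the far end is a leaf and
    -- contributes one, and the degrees of all centres sum to at most |E|.
    centres-bound : (∣X∣ + ∣E∣) * m ≤ suc n * m + ∣E∣
    centres-bound = begin
      (∣X∣ + ∣E∣) * m                                               ≡⟨ sym (∑-* (∣X∣ + ∣E∣) (λ x → ind (Centre x))) ⟩
      ∑ (λ x → (∣X∣ + ∣E∣) * ind (Centre x))                         ≤⟨ ∑-mono pt ⟩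
      ∑ (λ x → suc n * ind (Centre x) + ind (Centre x) * deg x)      ≡⟨ ∑-+ (λ x → suc n * ind (Centre x)) (λ x → ind (Centre x) * deg x) ⟩
      ∑ (λ x → suc n * ind (Centre x)) + volume Centre              ≡⟨ cong (_+ volume Centre) (∑-* (suc n) (λ x → ind (Centre x))) ⟩
      suc n * m + volume Centre                                    ≤⟨ +-monoʳ-≤ (suc n * m) volume-Centre ⟩
      suc n * m + ∣E∣                                               ∎
      where
      open ≤-Reasoning
      pt : ∀ x → (∣X∣ + ∣E∣) * ind (Centre x) ≤ suc n * ind (Centre x) + ind (Centre x) * deg x
      pt x with Centre x in e
      ... | false = ≤-reflexive (trans (*-zeroʳ (∣X∣ + ∣E∣)) (sym (trans (+-identityʳ _) (*-zeroʳ n))))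
      ... | true with cover x (Centre⊆X x e)
      ...   | d , d∈ , x'∈ = begin
        (∣X∣ + ∣E∣) * 1               ≡⟨ *-identityʳ _ ⟩
        ∣X∣ + ∣E∣                     ≤⟨ edge-bound d∈ (Centre⊆X x e) x'∈ ⟩
        n + (deg x + deg (x ⊕ d))    ≤⟨ +-monoʳ-≤ n (+-monoʳ-≤ (deg x) (proj₂ (Leaf∈ (opposite-leaf d∈ e x'∈)))) ⟩
        n + (deg x + 1)              ≡⟨ lem n (deg x) ⟩
        suc n * 1 + (deg x + 0)      ∎
        where
        lem : ∀ a b → a + (b + 1) ≡ suc a * 1 + (b + 0)
        lem = solve-∀

    -- With m ≥ 3 centres, write |E| = 2m + j, so that |X| = 3m + j.
    few-centres : m ≤ 2
    few-centres with m ≤? 2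
    ... | yes p = p
    ... | no ¬p = ⊥-elim (refute {ρ = n * m ∷ m ∷ j ∷ m * m ∷ m * j ∷ []}
           -- Products are treated as variables. The coefficients of m² are 110 against 108, since
           -- 11/36 exceeds 3/10; the terms in j leave 8mj against 22j, which needs m ≥ 3, so two
           -- centres require a separate argument.
           (22 ⊗ 5 ⊠ y₃ ⊞ 2 ⊠ y₄ ≼ y₀ ⊞ 3 ⊠ y₁ ⊞ y₂ by i₁ ∷
            1 ⊗ 22 ⊠ y₀ ⊞ 109 ⊠ y₁ ≼ 108 ⊠ y₃ ⊞ 36 ⊠ y₄ by i₂ ∷
            8 ⊗ 3 ⊠ y₂ ≼ y₄ by *-monoˡ-≤ j (≰⇒> ¬p) ∷
            1 ⊗ $ 3 ≼ y₁ by ≰⇒> ¬p ∷ []) refl)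
      where
      j : ℕ
      j = ∣E∣ ∸ 2 * m
      E≡ : ∣E∣ ≡ 2 * m + j
      E≡ = sym (m+[n∸m]≡n 2m≤∣E∣)
      X≡ : ∣X∣ ≡ 3 * m + j
      X≡ = trans (sym #Leaf+m) (trans (cong (_+ m) (trans (≤-antisym #Leaf≤∣E∣ ∣E∣≤#Leaf) E≡)) (lem m j))
        where
        lem : ∀ m j → 2 * m + j + m ≡ 3 * m + j
        lem = solve-∀
      i₁ : 5 * (m * m) + 2 * (m * j) ≤ n * m + 3 * m + j
      i₁ = subst₂ _≤_ (lem m j) (lem' n m j) (subst₂ (λ a b → (a + b) * m ≤ suc n * m + b) X≡ E≡ centres-bound)
        where
        lem : ∀ m j → (3 * m + j + (2 * m + j)) * m ≡ 5 * (m * m) + 2 * (m * j)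
        lem = solve-∀
        lem' : ∀ n m j → suc n * m + (2 * m + j) ≡ n * m + 3 * m + j
        lem' = solve-∀
      i₂ : 22 * (n * m) + 109 * m ≤ 108 * (m * m) + 36 * (m * j)
      i₂ = subst₂ _≤_ (lem n m) (lem' m j) (*-monoˡ-≤ m (subst (λ v → 11 * (2 * n) + 109 ≤ 36 * v) X≡ large))
        where
        lem : ∀ n m → (11 * (2 * n) + 109) * m ≡ 22 * (n * m) + 109 * m
        lem = solve-∀
        lem' : ∀ m j → (36 * (3 * m + j)) * m ≡ 108 * (m * m) + 36 * (m * j)
        lem' = solve-∀

    module TwoCentres {c₁ c₂ : F₂^ r} (c₁∈ : c₁ ∈ Centre) (c₂∈ : c₂ ∈ Centre) (c₂≢c₁ : c₂ ≢ c₁) where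

      z : F₂^ r
      z = c₁ ⊕ c₂

      c₁∈X : c₁ ∈ X
      c₁∈X = Centre⊆X c₁ c₁∈

      c₂∈X : c₂ ∈ X
      c₂∈X = Centre⊆X c₂ c₂∈

      no-third : ∀ {x} → x ∈ Centre → x ≢ c₁ → x ≢ c₂ → ⊥
      no-third {x} x∈ n₁ n₂ = <⇒≱ (s≤s (s≤s (s≤s z≤n))) (≤-trans
        (+-mono-≤ (ind-true c₁∈) (+-mono-≤ (ind-true c₂∈) (+-monoˡ-≤ 0 (ind-true x∈))))
        (≤-trans (lsum≤∑ (λ x → ind (Centre x)) dist) few-centres))
        where
        dist : Distinct (c₁ ∷ c₂ ∷ x ∷ [])
        dist = ((λ e → c₂≢c₁ (sym e)) ∷ (λ e → n₁ (sym e)) ∷ []) ∷ ((λ e → n₂ (sym e)) ∷ []) ∷ [] ∷ []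

      attached : ∀ {x} → x ∈ X → x ≢ c₁ → x ≢ c₂ → x ⊕ c₁ ∈ E ⊎ x ⊕ c₂ ∈ E
      attached {x} x∈ n₁ n₂ with leaf⊎centre x∈ | cover x x∈
      ... | inj₂ c | _ = ⊥-elim (no-third c n₁ n₂)
      ... | inj₁ l | d , d∈ , x'∈ with (x ⊕ d) ≟ c₁ | (x ⊕ d) ≟ c₂
      ...   | yes refl | _ = inj₁ (subst (_∈ E) (group (x ∷ d ∷ []) x₁ (x₀ ∔ (x₀ ∔ x₁)) refl) d∈)
      ...   | no _ | yes refl = inj₂ (subst (_∈ E) (group (x ∷ d ∷ []) x₁ (x₀ ∔ (x₀ ∔ x₁)) refl) d∈)
      ...   | no m₁ | no m₂ = ⊥-elim (no-third (opposite-centre d∈ l x'∈) m₁ m₂)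

      too-small : 2 * ∣X∣ ≤ n + 4 → ⊥
      too-small p = refute {ρ = ∣X∣ ∷ n ∷ []} (18 ⊗ 2 ⊠ y₀ ≼ y₁ ⊞ $ 4 by p ∷ 1 ⊗ 11 ⊠ (2 ⊠ y₁) ⊞ $ 109 ≼ 36 ⊠ y₀ by large ∷ []) refl

      edge : ∃[ d ] d ∈ E
      edge with cover c₁ c₁∈X
      ... | d , d∈ , _ = d , d∈

      not-c : ∀ {c c'} → c xor c' ≡ true → c ≡ not c'
      not-c {true} {false} _ = refl
      not-c {false} {true} _ = refl

      ≡-of-⊕ : ∀ {x y a b : F₂^ r} → x ⊕ y ≡ a ⊕ b → x ≡ a → y ≡ b
      ≡-of-⊕ {x} {y} {a} {b} e refl = trans (group (x ∷ y ∷ []) x₁ (x₀ ∔ (x₀ ∔ x₁)) refl) (trans (cong (x ⊕_) e) (group (x ∷ b ∷ []) (x₀ ∔ (x₀ ∔ x₁)) x₁ refl))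

      -- All leaves lie on the other side. If `x` is a leaf at one centre and `x ⊕ z` lies in `X`,
      -- then the other centre together with `x ⊕ z` represents the same edge again. So the leaves
      -- and their translate by `z` are disjoint inside one class.
      same-side : φ c₁ ≡ φ c₂ → ⊥
      same-side φ≡ = too-small (derive {ρ = ∣X∣ ∷ # (X ─ c₁) ∷ # L ∷ n ∷ # (double L z) ∷ []} (2 ⊠ y₀ ≼ y₃ ⊞ $ 4) 1
        (2 ⊗ y₀ ≼ y₁ ⊞ $ 1 by #-─ X c₁ ∷ 2 ⊗ y₁ ≼ y₂ ⊞ $ 1 by #-─ (X ─ c₁) c₂ ∷
         1 ⊗ 2 ⊠ y₂ ≼ y₄ by ≤-reflexive (sym (#-double-apart L z apart)) ∷
         1 ⊗ y₄ ≼ y₃ by ≤-trans (#-mono {X = double L z} {Y = class (not c)} into) (≤-reflexive (#class (proj₂ edge) (not c))) ∷ []) refl)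
        where
        c : Bool
        c = φ c₁
        L : Subset r
        L = (X ─ c₁) ─ c₂
        L∈ : ∀ {x} → x ∈ L → x ∈ X × x ≢ c₁ × x ≢ c₂
        L∈ {x} p with ─-∈ {X = X ─ c₁} p
        ... | q , n₂ with ─-∈ {X = X} q
        ... | x∈ , n₁ = x∈ , n₁ , n₂
        φL : ∀ {x} → x ∈ L → φ x ≡ not c
        φL {x} p with L∈ p
        ... | x∈ , n₁ , n₂ with attached x∈ n₁ n₂
        ... | inj₁ e = not-c (trans (sym (φ-add x c₁)) (odd e))
        ... | inj₂ e = trans (not-c {c' = φ c₂} (trans (sym (φ-add x c₂)) (odd e))) (cong not (sym φ≡))
        φz : φ z ≡ false
        φz = trans (φ-add c₁ c₂) (trans (cong (c xor_) (sym φ≡)) (xor-same c))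
        into : double L z ⊆ class (not c)
        into y p with ∨-true {L y} p
        ... | inj₁ p = ∈class {not c} (φL p)
        ... | inj₂ p = ∈class {not c} (trans (cong φ (sym (⊕-cancel y z))) (trans (φ-xor (φL p) φz) (lem (not c))))
          where
          lem : ∀ c → c xor false ≡ c
          lem true = refl
          lem false = refl
        moved : ∀ {x a b} → b ≢ a → x ∈ X → a ∈ X → b ∈ X → x ⊕ a ∈ E → x ⊕ (a ⊕ b) ∈ X → x ≢ b → ⊥
        moved {x} {a} {b} b≢a x∈ a∈ b∈ e x'∈ x≢b with unique e x∈ (subst (_∈ X) (group (x ∷ a ∷ []) x₁ (x₀ ∔ (x₀ ∔ x₁)) refl) a∈)
                                                         b∈ (subst (_∈ X) (group (x ∷ a ∷ b ∷ []) (x₀ ∔ (x₁ ∔ x₂)) (x₂ ∔ (x₀ ∔ x₁)) refl) x'∈)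
        ... | inj₁ q = x≢b q
        ... | inj₂ q = b≢a (sym (≡-of-⊕ (trans (group (x ∷ a ∷ []) (x₀ ∔ x₁ ∔ x₁) x₀ refl) (trans q (group (x ∷ a ∷ b ∷ []) (x₂ ∔ (x₀ ∔ x₁)) (x₀ ∔ x₁ ∔ x₂) refl))) refl))
        apart : Apart L z
        apart x p q with L∈ p | L∈ q
        ... | x∈ , n₁ , n₂ | x'∈ , _ with attached x∈ n₁ n₂
        ... | inj₁ e = moved c₂≢c₁ x∈ c₁∈X c₂∈X e x'∈ n₂
        ... | inj₂ e = moved (λ q → c₂≢c₁ (sym q)) x∈ c₂∈X c₁∈X e (subst (_∈ X) (cong (x ⊕_) (⊕-comm c₁ c₂)) x'∈) n₁

      -- Both sides are moved into the kernel of `φ` so that their centres become 0. For each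
      -- remaining `y` in `A` or `B`, `y ⊕ z` is an edge at `c₂` or `c₁`. Since `(x ⊕ y) ⊕ z` is
      -- also the sum of `x ⊕ c₁` and `y ⊕ c₂`, uniqueness keeps `x ⊕ y` out of `A` and `B`, and
      -- `avoiding-sumset` applies.
      opposite-sides : φ c₂ ≡ not (φ c₁) → ⊥
      opposite-sides φ≡ = too-small (derive {ρ = # (side c) ∷ # (side (not c)) ∷ # A ∷ # B ∷ n ∷ ∣X∣ ∷ []} (2 ⊠ y₅ ≼ y₄ ⊞ $ 4) 1
        (2 ⊗ y₀ ≼ y₂ ⊞ $ 1 by subst (_≤ # A + 1) (#-shift (side c) c₁) (#-─ A₀ 𝟎) ∷
         2 ⊗ y₁ ≼ y₃ ⊞ $ 1 by subst (_≤ # B + 1) (#-shift (side (not c)) c₂) (#-─ B₀ 𝟎) ∷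
         2 ⊗ y₅ ≼ y₀ ⊞ y₁ by ≤-reflexive (sym (sides' c)) ∷
         1 ⊗ 2 ⊠ (y₂ ⊞ y₃) ≼ y₄ by subst (2 * (# A + # B) ≤_) (#class (proj₂ edge) false)
            (avoiding-sumset (class false) closed A⊆ B⊆ disjoint sumA sumB (proj₂ anA) (proj₂ aB)) ∷ []) refl)
        where
        c : Bool
        c = φ c₁
        A₀ B₀ A B : Subset r
        A₀ y = side c (y ⊕ c₁)
        B₀ y = side (not c) (y ⊕ c₂)
        A = A₀ ─ 𝟎
        B = B₀ ─ 𝟎
        closed : ∀ {x y} → x ∈ class false → y ∈ class false → x ⊕ y ∈ class false
        closed p q = ∈class {false} (φ-xor (class∈ {false} p) (class∈ {false} q))
        A∈ : ∀ {y} → y ∈ A → y ⊕ c₁ ∈ X × φ (y ⊕ c₁) ≡ c × y ≢ 𝟎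
        A∈ p with ─-∈ {X = A₀} p
        ... | q , n = proj₁ (side∈ {c} q) , proj₂ (side∈ {c} q) , n
        B∈ : ∀ {y} → y ∈ B → y ⊕ c₂ ∈ X × φ (y ⊕ c₂) ≡ not c × y ≢ 𝟎
        B∈ p with ─-∈ {X = B₀} p
        ... | q , n = proj₁ (side∈ {not c} q) , proj₂ (side∈ {not c} q) , n
        A⊆ : A ⊆ class false
        A⊆ y p = ∈class {false} (trans (cong φ (sym (⊕-cancel y c₁))) (trans (φ-xor (proj₁ (proj₂ (A∈ p))) refl) (xor-same c)))
        B⊆ : B ⊆ class false
        B⊆ y p = ∈class {false} (trans (cong φ (sym (⊕-cancel y c₂))) (trans (φ-xor (proj₁ (proj₂ (B∈ p))) φ≡) (xor-same (not c))))
        shift≢ : ∀ {y a} → y ≢ 𝟎 → y ⊕ a ≢ a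
        shift≢ {y} {a} n e = n (trans (sym (⊕-cancel y a)) (trans (cong (_⊕ a) e) (⊕-self a)))
        side≢ : ∀ {x y c} → φ x ≡ c → φ y ≡ not c → x ≢ y
        side≢ {c = true} p q refl = true≢false p q
        side≢ {c = false} p q refl = true≢false q p
        edgeA : ∀ {y} → y ∈ A → y ⊕ z ∈ E
        edgeA {y} p with A∈ p
        ... | p∈ , φp , n with attached p∈ (shift≢ n) (side≢ φp φ≡)
        ... | inj₁ e = ⊥-elim (true≢false (odd e) (trans (φ-xor φp refl) (xor-same c)))
        ... | inj₂ e = subst (_∈ E) (⊕-assoc y c₁ c₂) e
        edgeB : ∀ {y} → y ∈ B → y ⊕ z ∈ E
        edgeB {y} p with B∈ p
        ... | p∈ , φp , n with attached p∈ (λ e → side≢ refl φp (sym e)) (shift≢ n)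
        ... | inj₁ e = subst (_∈ E) (group (y ∷ c₁ ∷ c₂ ∷ []) (x₀ ∔ x₂ ∔ x₁) (x₀ ∔ (x₁ ∔ x₂)) refl) e
        ... | inj₂ e = ⊥-elim (true≢false (odd e) (trans (φ-xor φp φ≡) (xor-same (not c))))
        disjoint : ∀ {y} → y ∈ A → y ∈ B → ⊥
        disjoint {y} p q with A∈ p | B∈ q
        ... | p∈ , φp , n | q∈ , _ with unique (edgeA p) p∈ (subst (_∈ X) (group (y ∷ c₁ ∷ c₂ ∷ []) x₂ (x₀ ∔ x₁ ∔ (x₀ ∔ (x₁ ∔ x₂))) refl) c₂∈X)
                                         c₁∈X (subst (_∈ X) (group (y ∷ c₁ ∷ c₂ ∷ []) (x₀ ∔ x₂) (x₁ ∔ (x₀ ∔ (x₁ ∔ x₂))) refl) q∈)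
        ... | inj₁ e = shift≢ n e
        ... | inj₂ e = c₂≢c₁ (sym (≡-of-⊕ (trans e (group (y ∷ c₁ ∷ c₂ ∷ []) (x₁ ∔ (x₀ ∔ (x₁ ∔ x₂))) (x₀ ∔ x₂) refl)) refl))
        crossing : ∀ {x y} → x ∈ A → y ∈ B → (x ⊕ y) ⊕ z ∈ E → ∀ {a} → a ∈ X → a ⊕ ((x ⊕ y) ⊕ z) ∈ X →
                   x ⊕ c₁ ≡ a ⊎ x ⊕ c₁ ≡ a ⊕ ((x ⊕ y) ⊕ z)
        crossing {x} {y} p q e a∈ a'∈ = unique e (proj₁ (A∈ p))
          (subst (_∈ X) (group (x ∷ y ∷ c₁ ∷ c₂ ∷ []) (x₁ ∔ x₃) (x₀ ∔ x₂ ∔ (x₀ ∔ x₁ ∔ (x₂ ∔ x₃))) refl) (proj₁ (B∈ q))) a∈ a'∈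
        sumA : ∀ {x y} → x ∈ A → y ∈ B → x ⊕ y ∈ A → ⊥
        sumA {x} {y} p q m with crossing p q (edgeA m) c₂∈X
               (subst (_∈ X) (group (x ∷ y ∷ c₁ ∷ c₂ ∷ []) (x₀ ∔ x₁ ∔ x₂) (x₃ ∔ (x₀ ∔ x₁ ∔ (x₂ ∔ x₃))) refl) (proj₁ (A∈ m)))
        ... | inj₁ e = side≢ (proj₁ (proj₂ (A∈ p))) φ≡ e
        ... | inj₂ e = proj₂ (proj₂ (B∈ q)) (sym (≡-of-⊕ (trans (trans (⊕-identityʳ _) e) (group (x ∷ y ∷ c₁ ∷ c₂ ∷ []) (x₃ ∔ (x₀ ∔ x₁ ∔ (x₂ ∔ x₃))) (x₀ ∔ x₂ ∔ x₁) refl)) refl))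
        sumB : ∀ {x y} → x ∈ A → y ∈ B → x ⊕ y ∈ B → ⊥
        sumB {x} {y} p q m with crossing p q (edgeB m) c₁∈X
               (subst (_∈ X) (group (x ∷ y ∷ c₁ ∷ c₂ ∷ []) (x₀ ∔ x₁ ∔ x₃) (x₂ ∔ (x₀ ∔ x₁ ∔ (x₂ ∔ x₃))) refl) (proj₁ (B∈ m)))
        ... | inj₁ e = shift≢ (proj₂ (proj₂ (A∈ p))) e
        ... | inj₂ e = side≢ (proj₁ (proj₂ (A∈ p))) (proj₁ (proj₂ (B∈ m))) (trans e (group (x ∷ y ∷ c₁ ∷ c₂ ∷ []) (x₂ ∔ (x₀ ∔ x₁ ∔ (x₂ ∔ x₃))) (x₀ ∔ x₁ ∔ x₃) refl))
        anA : ∃[ y ] y ∈ A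
        anA with cover c₂ c₂∈X
        ... | d , d∈ , l∈ = (c₂ ⊕ d) ⊕ c₁ , ∈-─ {X = A₀} (subst (_∈ side c) (sym (⊕-cancel (c₂ ⊕ d) c₁)) (∈side {c} l∈ (trans (φ-end d∈ φ≡) (not-involutive c))))
                (λ e → leaf-centre-disjoint (subst (_∈ Leaf) (⊕≡𝟎⇒≡ e) (opposite-leaf d∈ c₂∈ l∈)) c₁∈)
        aB : ∃[ y ] y ∈ B
        aB with cover c₁ c₁∈X
        ... | d , d∈ , l∈ = (c₁ ⊕ d) ⊕ c₂ , ∈-─ {X = B₀} (subst (_∈ side (not c)) (sym (⊕-cancel (c₁ ⊕ d) c₂)) (∈side {not c} l∈ (φ-end d∈ refl)))
                (λ e → leaf-centre-disjoint (subst (_∈ Leaf) (⊕≡𝟎⇒≡ e) (opposite-leaf d∈ c₁∈ l∈)) c₂∈)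

      contradiction : ⊥
      contradiction with φ c₁ in e₁ | φ c₂ in e₂
      ... | true | true = same-side (trans e₁ (sym e₂))
      ... | false | false = same-side (trans e₁ (sym e₂))
      ... | true | false = opposite-sides (trans e₂ (cong not (sym e₁)))
      ... | false | true = opposite-sides (trans e₂ (cong not (sym e₁)))

    star : ∃[ u ] u ∈ X × (∀ x → x ∈ X → x ≢ u → u ⊕ x ∈ E)
    star with #-pos {X = X} (derive {ρ = ∣X∣ ∷ n ∷ []} ($ 1 ≼ y₀) 36 (1 ⊗ 11 ⊠ (2 ⊠ y₁) ⊞ $ 109 ≼ 36 ⊠ y₀ by large ∷ []) refl)
    ... | x , x∈ with centre x∈
      where
      centre : ∀ {x} → x ∈ X → ∃[ c ] c ∈ Centre
      centre {x} x∈ with leaf⊎centre x∈ | cover x x∈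
      ... | inj₂ p | _ = x , p
      ... | inj₁ p | d , d∈ , x'∈ = x ⊕ d , opposite-centre d∈ p x'∈
    ... | u , u∈ with any? (λ c → c ∈? (Centre ─ u))
    ...   | yes (c , p) = ⊥-elim (TwoCentres.contradiction u∈ (proj₁ (─-∈ {X = Centre} p)) (proj₂ (─-∈ {X = Centre} p)))
    ...   | no none = u , Centre⊆X u u∈ , joins
      where
      joins : ∀ x → x ∈ X → x ≢ u → u ⊕ x ∈ E
      joins x x∈ n with leaf⊎centre x∈ | cover x x∈
      ... | inj₂ c | _ = ⊥-elim (none (x , ∈-─ {X = Centre} c n))
      ... | inj₁ l | d , d∈ , x'∈ with (x ⊕ d) ≟ u
      ...   | yes refl = subst (_∈ E) (group (x ∷ d ∷ []) x₁ (x₀ ∔ x₁ ∔ x₀) refl) d∈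
      ...   | no n' = ⊥-elim (none (x ⊕ d , ∈-─ {X = Centre} (opposite-centre d∈ l x'∈) n'))

bipartite-star : (φ : F₂^ r → Bool) → Additive φ → (X D : Subset r) → UniqueSums X D → (∀ {d} → d ∈ D → φ d ≡ true) →
  Cover X D → 11 * 2 ^ r + 109 ≤ 36 * # X → ∃[ u ] u ∈ X × (∀ x → x ∈ X → x ≢ u → u ⊕ x ∈ D)
bipartite-star {r} φ φ-add X D U odd cov large = conclude (all⊎any isolated?)
  where
  open UniqueSums U
  E : Subset r
  E = proj₁ (minimal-cover X D cov)
  E⊆D : E ⊆ D
  E⊆D = proj₁ (proj₂ (minimal-cover X D cov))
  covE : Cover X E
  covE = proj₁ (proj₂ (proj₂ (minimal-cover X D cov)))
  leaves : Degree.Leaves X E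
  leaves = proj₂ (proj₂ (proj₂ (minimal-cover X D cov)))
  UE : UniqueSums X E
  UE = record { represented = λ d∈ → represented (E⊆D _ d∈) ; unique = λ d∈ → unique (E⊆D _ d∈) }
  open Bipartite φ φ-add X E UE (λ d∈ → odd (E⊆D _ d∈)) covE

  an-edge : ∃[ d ] ∃[ x ] d ∈ E × x ∈ X × x ⊕ d ∈ X
  an-edge = let (x , x∈) = #-pos {X = X} (derive {ρ = # X ∷ 2 ^ r ∷ []} ($ 1 ≼ y₀) 36 (1 ⊗ 11 ⊠ y₁ ⊞ $ 109 ≼ 36 ⊠ y₀ by large ∷ []) refl)
                (d , d∈ , x'∈) = covE x x∈
            in d , x , d∈ , x∈ , x'∈

  large' : 11 * (2 * n) + 109 ≤ 36 * # X
  large' = subst (λ N → 11 * N + 109 ≤ 36 * # X) (sym (2n≡ (proj₁ (proj₂ (proj₂ an-edge))))) large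

  Joined : F₂^ r → Set
  Joined d = ∀ x → d ∈ E → x ∈ X → x ⊕ d ∈ X → deg x ≤ 1 → deg (x ⊕ d) ≤ 1 → ⊥

  Isolated : F₂^ r → Set
  Isolated d = ∃[ x ] d ∈ E × x ∈ X × x ⊕ d ∈ X × deg x ≤ 1 × deg (x ⊕ d) ≤ 1

  isolated? : ∀ d → Joined d ⊎ Isolated d
  isolated? d = all⊎any {P = λ x → d ∈ E → x ∈ X → x ⊕ d ∈ X → deg x ≤ 1 → deg (x ⊕ d) ≤ 1 → ⊥} at
    where
    at : ∀ x → (d ∈ E → x ∈ X → x ⊕ d ∈ X → deg x ≤ 1 → deg (x ⊕ d) ≤ 1 → ⊥) ⊎ (d ∈ E × x ∈ X × x ⊕ d ∈ X × deg x ≤ 1 × deg (x ⊕ d) ≤ 1)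
    at x with d ∈? E | x ∈? X | (x ⊕ d) ∈? X | deg x ≤? 1 | deg (x ⊕ d) ≤? 1
    ... | yes p₁ | yes p₂ | yes p₃ | yes p₄ | yes p₅ = inj₂ (p₁ , p₂ , p₃ , p₄ , p₅)
    ... | no n | _ | _ | _ | _ = inj₁ λ p _ _ _ _ → n p
    ... | yes _ | no n | _ | _ | _ = inj₁ λ _ p _ _ _ → n p
    ... | yes _ | yes _ | no n | _ | _ = inj₁ λ _ _ p _ _ → n p
    ... | yes _ | yes _ | yes _ | no n | _ = inj₁ λ _ _ _ p _ → n p
    ... | yes _ | yes _ | yes _ | yes _ | no n = inj₁ λ _ _ _ _ p → n p

  second-edge : ∀ {d a} → d ∈ E → a ∈ X → a ⊕ d ∈ X → ∃[ e ] e ∈ E × e ≢ d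
  second-edge {d} {a} d∈ a∈ b∈ with any? (λ e → e ∈? (E ─ d))
  ... | yes (e , p) = e , ─-∈ {X = E} p
  ... | no none = ⊥-elim (refute {ρ = # X ∷ 2 ^ r ∷ []} (36 ⊗ y₀ ≼ $ 2 by small ∷ 1 ⊗ 11 ⊠ y₁ ⊞ $ 109 ≼ 36 ⊠ y₀ by large ∷ []) refl)
    where
    ends : ∀ x → x ∈ X → x ≡ a ⊎ x ≡ a ⊕ d
    ends x x∈ with covE x x∈
    ... | e , e∈ , x'∈ with e ≟ d
    ...   | yes refl = unique (E⊆D e e∈) x∈ x'∈ a∈ b∈
    ...   | no n = ⊥-elim (none (e , ∈-─ {X = E} e∈ n))
    pt : ∀ x → ind (X x) ≤ ind (⁅ a ⁆ x) + ind (⁅ a ⊕ d ⁆ x)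
    pt x with X x in p
    ... | false = z≤n
    ... | true with ends x p
    ...   | inj₁ q rewrite q | ≟-refl a = s≤s z≤n
    ...   | inj₂ q rewrite q | ≟-refl (a ⊕ d) = m≤n+m 1 _
    small : # X ≤ 2
    small = ≤-trans (∑-mono pt) (≤-reflexive (trans (∑-+ (λ x → ind (⁅ a ⁆ x)) (λ x → ind (⁅ a ⊕ d ⁆ x))) (cong₂ _+_ (#⁅⁆ a) (#⁅⁆ (a ⊕ d)))))

  conclude : (∀ d → Joined d) ⊎ ∃ Isolated → ∃[ u ] u ∈ X × (∀ x → x ∈ X → x ≢ u → u ⊕ x ∈ D)
  conclude (inj₁ joined) = let (u , u∈ , h) = NoIsolatedEdge.star leaves (λ {d} {x} → joined d x) large'
                           in u , u∈ , λ x x∈ n → E⊆D (u ⊕ x) (h x x∈ n)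
  conclude (inj₂ (d , a , d∈ , a∈ , b∈ , deg-a , deg-b)) = let (e , e∈ , n) = second-edge d∈ a∈ b∈
    in ⊥-elim (IsolatedEdge.contradiction d∈ e∈ n a∈ b∈ deg-a deg-b large')

-- The Clebsch graph: the Cayley graph of F₂^ 4 generated by the basis and its sum

δ : Fin 5 → F₂^ 4
δ 0F = true ∷ false ∷ false ∷ false ∷ []
δ 1F = false ∷ true ∷ false ∷ false ∷ []
δ 2F = false ∷ false ∷ true ∷ false ∷ []
δ 3F = false ∷ false ∷ false ∷ true ∷ []
δ 4F = true ∷ true ∷ true ∷ true ∷ []

-- Think of F₂⁵ modulo the all-ones vector, with `δ i` the standard basis: every class has a
-- representative of weight at most two. `even` records two sums of generators with different first
-- terms, as `two-shifts` needs.
data Kind (b : F₂^ 4) : Set where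
  generator : ∀ i → b ≡ δ i → Kind b
  even : ∀ i j i' j' → i ≢ j → b ≡ δ i ⊕ δ i' → b ≡ δ j ⊕ δ j' → Kind b

isGen : F₂^ 4 → Bool
isGen (true ∷ false ∷ false ∷ false ∷ []) = true
isGen (false ∷ true ∷ false ∷ false ∷ []) = true
isGen (false ∷ false ∷ true ∷ false ∷ []) = true
isGen (false ∷ false ∷ false ∷ true ∷ []) = true
isGen (true ∷ true ∷ true ∷ true ∷ []) = true
isGen _ = false

kind : ∀ b → Kind b
kind (false ∷ false ∷ false ∷ false ∷ []) = even 0F 1F 0F 1F (λ ()) refl refl
kind (false ∷ false ∷ false ∷ true ∷ []) = generator 3F refl
kind (false ∷ false ∷ true ∷ false ∷ []) = generator 2F refl
kind (false ∷ false ∷ true ∷ true ∷ []) = even 3F 2F 2F 3F (λ ()) refl refl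
kind (false ∷ true ∷ false ∷ false ∷ []) = generator 1F refl
kind (false ∷ true ∷ false ∷ true ∷ []) = even 3F 1F 1F 3F (λ ()) refl refl
kind (false ∷ true ∷ true ∷ false ∷ []) = even 2F 1F 1F 2F (λ ()) refl refl
kind (false ∷ true ∷ true ∷ true ∷ []) = even 4F 0F 0F 4F (λ ()) refl refl
kind (true ∷ false ∷ false ∷ false ∷ []) = generator 0F refl
kind (true ∷ false ∷ false ∷ true ∷ []) = even 3F 0F 0F 3F (λ ()) refl refl
kind (true ∷ false ∷ true ∷ false ∷ []) = even 2F 0F 0F 2F (λ ()) refl refl
kind (true ∷ false ∷ true ∷ true ∷ []) = even 4F 1F 1F 4F (λ ()) refl refl
kind (true ∷ true ∷ false ∷ false ∷ []) = even 1F 0F 0F 1F (λ ()) refl refl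
kind (true ∷ true ∷ false ∷ true ∷ []) = even 4F 2F 2F 4F (λ ()) refl refl
kind (true ∷ true ∷ true ∷ false ∷ []) = even 4F 3F 3F 4F (λ ()) refl refl
kind (true ∷ true ∷ true ∷ true ∷ []) = generator 4F refl

-- A non-zero translation cannot carry the neighbourhood of 0 onto itself, since two vertices have
-- at most two common neighbours.
even-shift : ∀ b → b ≢ 𝟎 → ∃[ t ] isGen (b ⊕ δ t) ≡ false
even-shift (false ∷ false ∷ false ∷ false ∷ []) n = ⊥-elim (n refl)
even-shift (false ∷ false ∷ false ∷ true ∷ []) _ = 0F , refl
even-shift (false ∷ false ∷ true ∷ false ∷ []) _ = 0F , refl
even-shift (false ∷ false ∷ true ∷ true ∷ []) _ = 0F , refl
even-shift (false ∷ true ∷ false ∷ false ∷ []) _ = 0F , refl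
even-shift (false ∷ true ∷ false ∷ true ∷ []) _ = 0F , refl
even-shift (false ∷ true ∷ true ∷ false ∷ []) _ = 0F , refl
even-shift (false ∷ true ∷ true ∷ true ∷ []) _ = 1F , refl
even-shift (true ∷ false ∷ false ∷ false ∷ []) _ = 0F , refl
even-shift (true ∷ false ∷ false ∷ true ∷ []) _ = 1F , refl
even-shift (true ∷ false ∷ true ∷ false ∷ []) _ = 1F , refl
even-shift (true ∷ false ∷ true ∷ true ∷ []) _ = 0F , refl
even-shift (true ∷ true ∷ false ∷ false ∷ []) _ = 2F , refl
even-shift (true ∷ true ∷ false ∷ true ∷ []) _ = 0F , refl
even-shift (true ∷ true ∷ true ∷ false ∷ []) _ = 0F , refl
even-shift (true ∷ true ∷ true ∷ true ∷ []) _ = 0F , refl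

-- The five generators sum to zero.
δ-distinct : ∀ i j → i ≢ j → ∃[ a ] ∃[ b ] ∃[ c ] δ i ⊕ δ j ≡ δ a ⊕ (δ b ⊕ δ c)
δ-distinct 0F 0F n = ⊥-elim (n refl)
δ-distinct 0F 1F _ = 2F , 3F , 4F , refl
δ-distinct 0F 2F _ = 1F , 3F , 4F , refl
δ-distinct 0F 3F _ = 1F , 2F , 4F , refl
δ-distinct 0F 4F _ = 1F , 2F , 3F , refl
δ-distinct 1F 0F _ = 2F , 3F , 4F , refl
δ-distinct 1F 1F n = ⊥-elim (n refl)
δ-distinct 1F 2F _ = 0F , 3F , 4F , refl
δ-distinct 1F 3F _ = 0F , 2F , 4F , refl
δ-distinct 1F 4F _ = 0F , 2F , 3F , refl
δ-distinct 2F 0F _ = 1F , 3F , 4F , refl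
δ-distinct 2F 1F _ = 0F , 3F , 4F , refl
δ-distinct 2F 2F n = ⊥-elim (n refl)
δ-distinct 2F 3F _ = 0F , 1F , 4F , refl
δ-distinct 2F 4F _ = 0F , 1F , 3F , refl
δ-distinct 3F 0F _ = 1F , 2F , 4F , refl
δ-distinct 3F 1F _ = 0F , 2F , 4F , refl
δ-distinct 3F 2F _ = 0F , 1F , 4F , refl
δ-distinct 3F 3F n = ⊥-elim (n refl)
δ-distinct 3F 4F _ = 0F , 1F , 2F , refl
δ-distinct 4F 0F _ = 1F , 2F , 3F , refl
δ-distinct 4F 1F _ = 0F , 2F , 3F , refl
δ-distinct 4F 2F _ = 0F , 1F , 3F , refl
δ-distinct 4F 3F _ = 0F , 1F , 2F , refl
δ-distinct 4F 4F n = ⊥-elim (n refl)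

-- Exhaustive checks on the Clebsch graph

all-points : (F₂^ k → Bool) → Bool
all-points {zero} P = P []
all-points {suc k} P = all-points (λ v → P (false ∷ v)) ∧ all-points (λ v → P (true ∷ v))

all-points-sound : (P : F₂^ k → Bool) → all-points P ≡ true → ∀ b → P b ≡ true
all-points-sound P e [] = e
all-points-sound P e (false ∷ b) = all-points-sound _ (∧-trueˡ e) b
all-points-sound P e (true ∷ b) = all-points-sound _ (∧-trueʳ {all-points (λ v → P (false ∷ v))} e) b

all-points-complete : (P : F₂^ k → Bool) → (∀ b → P b ≡ true) → all-points P ≡ true
all-points-complete {zero} P h = h []
all-points-complete {suc k} P h = ∧-intro (all-points-complete _ (λ v → h (false ∷ v))) (all-points-complete _ (λ v → h (true ∷ v)))

all-fin : (Fin 5 → Bool) → Bool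
all-fin P = P 0F ∧ (P 1F ∧ (P 2F ∧ (P 3F ∧ P 4F)))

all-fin-complete : (P : Fin 5 → Bool) → (∀ i → P i ≡ true) → all-fin P ≡ true
all-fin-complete P h = ∧-intro (h 0F) (∧-intro (h 1F) (∧-intro (h 2F) (∧-intro (h 3F) (h 4F))))

all-fin-sound : (P : Fin 5 → Bool) → all-fin P ≡ true → ∀ i → P i ≡ true
all-fin-sound P e 0F = ∧-trueˡ e
all-fin-sound P e 1F = ∧-trueˡ (∧-trueʳ {P 0F} e)
all-fin-sound P e 2F = ∧-trueˡ (∧-trueʳ {P 1F} (∧-trueʳ {P 0F} e))
all-fin-sound P e 3F = ∧-trueˡ (∧-trueʳ {P 2F} (∧-trueʳ {P 1F} (∧-trueʳ {P 0F} e)))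
all-fin-sound P e 4F = ∧-trueʳ {P 3F} (∧-trueʳ {P 2F} (∧-trueʳ {P 1F} (∧-trueʳ {P 0F} e)))

sum-fin : (Fin 5 → ℕ) → ℕ
sum-fin f = f 0F + (f 1F + (f 2F + (f 3F + f 4F)))

ifᵇ : {a b : Bool} → (if a then b else true) ≡ true → a ≡ true → b ≡ true
ifᵇ e refl = e

-- The Clebsch graph has no triangles.
generators-far : ∀ i j → isGen (δ i ⊕ δ j) ≡ false
generators-far i j = lem (isGen (δ i ⊕ δ j)) (all-fin-sound (λ j → not (isGen (δ i ⊕ δ j))) (all-fin-sound (λ i → all-fin (λ j → not (isGen (δ i ⊕ δ j)))) refl i) j)
  where
  lem : ∀ b → not b ≡ true → b ≡ false
  lem false _ = refl

-- The Clebsch graph is strongly regular with parameters (16, 5, 0, 2).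
common-neighbours : ∀ b → b ≢ 𝟎 → # (λ x → isGen x ∧ isGen (x ⊕ b)) ≤ 2
common-neighbours b n = ≤ᵇ⇒≤ _ 2 (T-true (ifᵇ (all-points-sound (λ b → if not ⌊ b ≟ 𝟎 ⌋ then # (λ x → isGen x ∧ isGen (x ⊕ b)) ≤ᵇ 2 else true) refl b) (cong not (≟-false n))))

join : (F₂^ k → Bool) → (F₂^ k → Bool) → F₂^ (suc k) → Bool
join f g (false ∷ v) = f v
join f g (true ∷ v) = g v

-- A check that consults its argument only at closed points computes to the same value on `table h`
-- as on `h`, so enumerating tables covers all functions without extensionality.
table : (F₂^ k → Bool) → F₂^ k → Bool
table {zero} h _ = h []
table {suc k} h = join (table (λ v → h (false ∷ v))) (table (λ v → h (true ∷ v)))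

all-tables : ((F₂^ k → Bool) → Bool) → Bool
all-tables {zero} P = P (λ _ → false) ∧ P (λ _ → true)
all-tables {suc k} P = all-tables (λ f → all-tables (λ g → P (join f g)))

all-tables-sound : (P : (F₂^ k → Bool) → Bool) → all-tables P ≡ true → ∀ h → P (table h) ≡ true
all-tables-sound {zero} P e h with h []
... | false = ∧-trueˡ e
... | true = ∧-trueʳ {P (λ _ → false)} e
all-tables-sound {suc k} P e h = all-tables-sound _ (all-tables-sound _ e (λ v → h (false ∷ v))) (λ v → h (true ∷ v))

edges-at : (F₂^ 4 → Bool) → Fin 5 → Subset 4
edges-at h i b = h b ∧ h (b ⊕ δ i)

centres : (F₂^ 4 → Bool) → Subset 4
centres h b = all-fin (λ i → h (b ⊕ δ i))

independent : (F₂^ 4 → Bool) → Bool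
independent h = all-fin (λ i → all-points (λ b → not (edges-at h i b)))

sparse : (F₂^ 4 → Bool) → Bool
sparse h = all-fin (λ i → # (edges-at h i) ≤ᵇ 2)

-- Tested on all 2¹⁶ subsets. An independent set has at most five elements, and five only if it is
-- the neighbourhood of a vertex.
independent-size : ∀ h → independent h ≡ true → # h ≤ 4 + # (centres h)
independent-size h e = ≤ᵇ⇒≤ _ _ (T-true (ifᵇ
  (all-tables-sound {4} (λ h → if independent h then # h ≤ᵇ 4 + # (centres h) else true) refl h) e))

-- Also tested on all subsets. As `edges-at` counts both ends, each edge allows half an element
-- beyond five.
sparse-size : ∀ h → sparse h ≡ true → 4 * # h ≤ 20 + sum-fin (λ i → # (edges-at h i))
sparse-size h e = ≤ᵇ⇒≤ _ _ (T-true (ifᵇ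
  (all-tables-sound {4} (λ h → if sparse h then 4 * # h ≤ᵇ 20 + sum-fin (λ i → # (edges-at h i)) else true) refl h) e))

-- Five is odd; the check simply runs through all 5⁵ maps.
involution-fixes : (I : Fin 5 → Fin 5) → (∀ m → I (I m) ≡ m) → ∃[ m ] I m ≡ m
involution-fixes I inv with Finₚ.any? (λ m → I m Fin.≟ m)
... | yes p = p
... | no none = ⊥-elim (true≢false (check (I 0F) (I 1F) (I 2F) (I 3F) (I 4F)) (¬true⇒false bad))
  where
  eval : Fin 5 → Fin 5 → Fin 5 → Fin 5 → Fin 5 → Fin 5 → Fin 5
  eval a b c d e 0F = a
  eval a b c d e 1F = b
  eval a b c d e 2F = c
  eval a b c d e 3F = d
  eval a b c d e 4F = e
  P : Fin 5 → Fin 5 → Fin 5 → Fin 5 → Fin 5 → Bool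
  P a b c d e = not (all-fin (λ m → not ⌊ I′ m Fin.≟ m ⌋ ∧ ⌊ I′ (I′ m) Fin.≟ m ⌋))
    where
    I′ = eval a b c d e
  check : ∀ a b c d e → P a b c d e ≡ true
  check a b c d = all-fin-sound (P a b c d) (all-fin-sound (λ d → all-fin (P a b c d)) (all-fin-sound (λ c → all-fin λ d → all-fin (P a b c d))
    (all-fin-sound (λ b → all-fin λ c → all-fin λ d → all-fin (P a b c d)) (all-fin-sound (λ a → all-fin λ b → all-fin λ c → all-fin λ d → all-fin (P a b c d)) refl a) b) c) d)
  I′ : Fin 5 → Fin 5
  I′ = eval (I 0F) (I 1F) (I 2F) (I 3F) (I 4F)
  I′≡ : ∀ m → I′ m ≡ I m
  I′≡ 0F = refl
  I′≡ 1F = refl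
  I′≡ 2F = refl
  I′≡ 3F = refl
  I′≡ 4F = refl
  good : ∀ m → not ⌊ I′ m Fin.≟ m ⌋ ∧ ⌊ I′ (I′ m) Fin.≟ m ⌋ ≡ true
  good m with I′ m Fin.≟ m | I′ (I′ m) Fin.≟ m
  ... | yes e | _ = ⊥-elim (none (m , trans (sym (I′≡ m)) e))
  ... | no _ | yes _ = refl
  ... | no _ | no n = ⊥-elim (n (trans (I′≡ (I′ m)) (trans (cong I (I′≡ m)) (inv m))))
  bad : P (I 0F) (I 1F) (I 2F) (I 3F) (I 4F) ≡ true → ⊥
  bad e with all-fin-complete (λ m → not ⌊ I′ m Fin.≟ m ⌋ ∧ ⌊ I′ (I′ m) Fin.≟ m ⌋) good
  ... | g = true≢false e (cong not g)

sum-fin-∑ : (f : Fin 5 → F₂^ r → ℕ) → ∑ (λ x → sum-fin (λ i → f i x)) ≡ sum-fin (λ i → ∑ (f i))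
sum-fin-∑ f = trans (∑-+ (f 0F) (λ x → f 1F x + (f 2F x + (f 3F x + f 4F x)))) (cong (∑ (f 0F) +_)
  (trans (∑-+ (f 1F) (λ x → f 2F x + (f 3F x + f 4F x))) (cong (∑ (f 1F) +_)
  (trans (∑-+ (f 2F) (λ x → f 3F x + f 4F x)) (cong (∑ (f 2F) +_) (∑-+ (f 3F) (f 4F)))))))

sum-fin-mono : {f g : Fin 5 → ℕ} → (∀ i → f i ≤ g i) → sum-fin f ≤ sum-fin g
sum-fin-mono h = +-mono-≤ (h 0F) (+-mono-≤ (h 1F) (+-mono-≤ (h 2F) (+-mono-≤ (h 3F) (h 4F))))

sum-fin-but-one : (f : Fin 5 → ℕ) (c : ℕ) → (∀ i → f i ≤ c) → ∀ i → sum-fin f ≤ f i + 4 * c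
sum-fin-but-one f c h 0F = derive {ρ = f 0F ∷ f 1F ∷ f 2F ∷ f 3F ∷ f 4F ∷ c ∷ []} (y₀ ⊞ (y₁ ⊞ (y₂ ⊞ (y₃ ⊞ y₄))) ≼ y₀ ⊞ 4 ⊠ y₅) 1
  (1 ⊗ y₁ ≼ y₅ by h 1F ∷ 1 ⊗ y₂ ≼ y₅ by h 2F ∷ 1 ⊗ y₃ ≼ y₅ by h 3F ∷ 1 ⊗ y₄ ≼ y₅ by h 4F ∷ []) refl
sum-fin-but-one f c h 1F = derive {ρ = f 0F ∷ f 1F ∷ f 2F ∷ f 3F ∷ f 4F ∷ c ∷ []} (y₀ ⊞ (y₁ ⊞ (y₂ ⊞ (y₃ ⊞ y₄))) ≼ y₁ ⊞ 4 ⊠ y₅) 1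
  (1 ⊗ y₀ ≼ y₅ by h 0F ∷ 1 ⊗ y₂ ≼ y₅ by h 2F ∷ 1 ⊗ y₃ ≼ y₅ by h 3F ∷ 1 ⊗ y₄ ≼ y₅ by h 4F ∷ []) refl
sum-fin-but-one f c h 2F = derive {ρ = f 0F ∷ f 1F ∷ f 2F ∷ f 3F ∷ f 4F ∷ c ∷ []} (y₀ ⊞ (y₁ ⊞ (y₂ ⊞ (y₃ ⊞ y₄))) ≼ y₂ ⊞ 4 ⊠ y₅) 1
  (1 ⊗ y₀ ≼ y₅ by h 0F ∷ 1 ⊗ y₁ ≼ y₅ by h 1F ∷ 1 ⊗ y₃ ≼ y₅ by h 3F ∷ 1 ⊗ y₄ ≼ y₅ by h 4F ∷ []) refl
sum-fin-but-one f c h 3F = derive {ρ = f 0F ∷ f 1F ∷ f 2F ∷ f 3F ∷ f 4F ∷ c ∷ []} (y₀ ⊞ (y₁ ⊞ (y₂ ⊞ (y₃ ⊞ y₄))) ≼ y₃ ⊞ 4 ⊠ y₅) 1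
  (1 ⊗ y₀ ≼ y₅ by h 0F ∷ 1 ⊗ y₁ ≼ y₅ by h 1F ∷ 1 ⊗ y₂ ≼ y₅ by h 2F ∷ 1 ⊗ y₄ ≼ y₅ by h 4F ∷ []) refl
sum-fin-but-one f c h 4F = derive {ρ = f 0F ∷ f 1F ∷ f 2F ∷ f 3F ∷ f 4F ∷ c ∷ []} (y₀ ⊞ (y₁ ⊞ (y₂ ⊞ (y₃ ⊞ y₄))) ≼ y₄ ⊞ 4 ⊠ y₅) 1
  (1 ⊗ y₀ ≼ y₅ by h 0F ∷ 1 ⊗ y₁ ≼ y₅ by h 1F ∷ 1 ⊗ y₂ ≼ y₅ by h 2F ∷ 1 ⊗ y₃ ≼ y₅ by h 3F ∷ []) refl

-- Large sets whose unique sums contain a pentagon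

-- The two densities 5/16 and 11/36 differ by only 1/144, so in small groups the additive terms
-- decide. From dimension nine on, the order is a multiple of 512 and the later estimates become
-- linear in `q`.
dimension : ∀ r b → 64 * b ≤ 20 * 2 ^ r + 160 → 11 * 2 ^ r + 145 ≤ 36 * b → ∃[ q ] 2 ^ r ≡ 512 * q × 1 ≤ q
dimension r b u l with r
... | 0 = ⊥-elim (refute {ρ = b ∷ []} (9 ⊗ 64 ⊠ y₀ ≼ $ 180 by u ∷ 16 ⊗ $ 156 ≼ 36 ⊠ y₀ by l ∷ []) refl)
... | 1 = ⊥-elim (refute {ρ = b ∷ []} (9 ⊗ 64 ⊠ y₀ ≼ $ 200 by u ∷ 16 ⊗ $ 167 ≼ 36 ⊠ y₀ by l ∷ []) refl)
... | 2 = ⊥-elim (refute {ρ = b ∷ []} (9 ⊗ 64 ⊠ y₀ ≼ $ 240 by u ∷ 16 ⊗ $ 189 ≼ 36 ⊠ y₀ by l ∷ []) refl)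
... | 3 = ⊥-elim (refute {ρ = b ∷ []} (9 ⊗ 64 ⊠ y₀ ≼ $ 320 by u ∷ 16 ⊗ $ 233 ≼ 36 ⊠ y₀ by l ∷ []) refl)
... | 4 = ⊥-elim (refute {ρ = b ∷ []} (9 ⊗ 64 ⊠ y₀ ≼ $ 480 by u ∷ 16 ⊗ $ 321 ≼ 36 ⊠ y₀ by l ∷ []) refl)
... | 5 = ⊥-elim (refute {ρ = b ∷ []} (9 ⊗ 64 ⊠ y₀ ≼ $ 800 by u ∷ 16 ⊗ $ 497 ≼ 36 ⊠ y₀ by l ∷ []) refl)
... | 6 = ⊥-elim (refute {ρ = b ∷ []} (9 ⊗ 64 ⊠ y₀ ≼ $ 1440 by u ∷ 16 ⊗ $ 849 ≼ 36 ⊠ y₀ by l ∷ []) refl)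
... | 7 = ⊥-elim (refute {ρ = b ∷ []} (9 ⊗ 64 ⊠ y₀ ≼ $ 2720 by u ∷ 16 ⊗ $ 1553 ≼ 36 ⊠ y₀ by l ∷ []) refl)
-- Only integrality excludes dimension eight: the bounds are 82.25 and 82.5.
... | 8 = ⊥-elim (refute {ρ = b ∷ []} (36 ⊗ y₀ ≼ $ 82 by derive {ρ = b ∷ []} (y₀ ≼ $ 82) 64 (1 ⊗ 64 ⊠ y₀ ≼ $ 5280 by u ∷ []) refl ∷
                                       1 ⊗ $ 2961 ≼ 36 ⊠ y₀ by l ∷ []) refl)
... | suc (suc (suc (suc (suc (suc (suc (suc (suc j)))))))) = 2 ^ j , ^-distribˡ-+-* 2 9 j , m^n>0 2 j

module Pentagon {r : ℕ} {B D : Subset r} (U : UniqueSums B D) (sf : SumFree₂ D) (o : F₂^ r)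
  (cover : ∀ x → x ∈ B → x ≢ o → ∃[ e ] e ∈ D × x ⊕ e ∈ B)
  (large : 11 * 2 ^ r + 145 ≤ 36 * # B) (pentagon : FiveCycle D) where
  open UniqueSums U
  open FiveCycle pentagon

  ι : F₂^ 4 → F₂^ r
  ι b = lin b (e₁ ∷ e₂ ∷ e₃ ∷ e₄ ∷ [])

  ι-⊕ : ∀ b c → ι (b ⊕ c) ≡ ι b ⊕ ι c
  ι-⊕ b c = lin-⊕ b c (e₁ ∷ e₂ ∷ e₃ ∷ e₄ ∷ [])

  d : Fin 5 → F₂^ r
  d i = ι (δ i)

  d∈ : ∀ i → d i ∈ D
  d∈ 0F = subst (_∈ D) (sym (⊕-identityʳ e₁)) e₁∈
  d∈ 1F = subst (_∈ D) (sym (⊕-identityʳ e₂)) e₂∈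
  d∈ 2F = subst (_∈ D) (sym (⊕-identityʳ e₃)) e₃∈
  d∈ 3F = subst (_∈ D) (sym (⊕-identityʳ e₄)) e₄∈
  d∈ 4F = subst (_∈ D) (trans (sym closed) (cong (λ t → e₁ ⊕ (e₂ ⊕ (e₃ ⊕ t))) (sym (⊕-identityʳ e₄)))) e₅∈

  𝟎∉D : ¬ 𝟎 ∈ D
  𝟎∉D = 𝟎∉-sum-free U sf

  opaque
    -- If two of the five elements agreed, the other three would sum to zero, against sum-freeness.
    -- So the pentagon is not degenerate.
    d-injective : ∀ {i j} → i ≢ j → d i ≢ d j
    d-injective {i} {j} n e with δ-distinct i j n
    ... | a , b , c , eq = sf (d∈ b) (d∈ c) (subst (_∈ D) (⊕≡𝟎⇒≡ triangle) (d∈ a))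
      where
      triangle : d a ⊕ (d b ⊕ d c) ≡ 𝟎
      triangle = trans (sym (trans (ι-⊕ (δ a) (δ b ⊕ δ c)) (cong (d a ⊕_) (ι-⊕ (δ b) (δ c)))))
        (trans (cong ι (sym eq)) (trans (ι-⊕ (δ i) (δ j)) (trans (cong (_⊕ d j) e) (⊕-self (d j)))))

  opaque
    ι-injective : ∀ b → ι b ≡ 𝟎 → b ≡ 𝟎
    ι-injective b e with kind b
    ... | generator i refl = ⊥-elim (𝟎∉D (subst (_∈ D) e (d∈ i)))
    ... | even i _ i' _ _ refl _ with i Fin.≟ i'
    ...   | yes refl = ⊕-self (δ i)
    ...   | no n = ⊥-elim (d-injective n (⊕≡𝟎⇒≡ (trans (sym (ι-⊕ (δ i) (δ i'))) e)))

  -- Sums over cosets of the image of ι, opaque lest they unfold to sixteen terms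

  opaque
    fibre : Subset r → F₂^ r → ℕ
    fibre Y g = # (λ b → Y (g ⊕ ι b))

    fibre-# : ∀ Y g → fibre Y g ≡ # (λ b → Y (g ⊕ ι b))
    fibre-# Y g = refl

  opaque
    -- Cosets are indexed by all their points, which counts each of them sixteen times and avoids
    -- choosing representatives.
    ∑-fibre : ∀ Y → ∑ (fibre Y) ≡ 16 * # Y
    ∑-fibre Y = begin
      ∑ (fibre Y)                              ≡⟨ ∑-cong (fibre-# Y) ⟩
      ∑ (λ g → ∑ (λ b → ind (Y (g ⊕ ι b))))    ≡⟨ ∑-swap (λ g b → ind (Y (g ⊕ ι b))) ⟩
      ∑ (λ b → ∑ (λ g → ind (Y (g ⊕ ι b))))    ≡⟨ ∑-cong (λ b → #-shift Y (ι b)) ⟩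
      ∑ {4} (λ _ → # Y)                        ≡⟨ ∑-const {4} (# Y) ⟩
      # Y * 16                                 ≡⟨ *-comm (# Y) 16 ⟩
      16 * # Y                                 ∎
      where open ≡-Reasoning

  opaque
    fibre-shift : ∀ Y g b → fibre Y (g ⊕ ι b) ≡ fibre Y g
    fibre-shift Y g b = trans (fibre-# Y (g ⊕ ι b)) (trans (∑-cong (λ c → cong (λ t → ind (Y t)) (lem c)))
      (trans (#-shift (λ c → Y (g ⊕ ι c)) b) (sym (fibre-# Y g))))
      where
      lem : ∀ c → g ⊕ ι b ⊕ ι c ≡ g ⊕ ι (c ⊕ b)
      lem c = trans (group (g ∷ ι b ∷ ι c ∷ []) (x₀ ∔ x₁ ∔ x₂) (x₀ ∔ (x₂ ∔ x₁)) refl) (cong (g ⊕_) (sym (ι-⊕ c b)))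

  opaque
    fibre-pos : ∀ Y {g} → 0 < fibre Y g → ∃[ b ] g ⊕ ι b ∈ Y
    fibre-pos Y {g} p = #-pos {X = λ b → Y (g ⊕ ι b)} (subst (0 <_) (fibre-# Y g) p)

  opaque
    fibre≤1 : ∀ Y → (∀ {x b} → x ∈ Y → x ⊕ ι b ∈ Y → b ≡ 𝟎) → ∀ g → fibre Y g ≤ 1
    fibre≤1 Y h g = subst (_≤ 1) (sym (fibre-# Y g)) (∑-at-most-one {P = λ b → Y (g ⊕ ι b)} λ {b} {c} p q → ⊕≡𝟎⇒≡ (h p (subst (_∈ Y)
      (trans (group (g ∷ ι b ∷ ι c ∷ []) (x₀ ∔ x₂) (x₀ ∔ x₁ ∔ (x₁ ∔ x₂)) refl) (cong (g ⊕ ι b ⊕_) (sym (ι-⊕ b c)))) q)))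

  centresOf : Subset r → Subset r
  centresOf Y v = all-fin (λ i → Y (v ⊕ d i))

  -- Deleting one end of the edge d i for each i makes B independent in every coset.

  end : Fin 5 → F₂^ r
  end i = proj₁ (represented (d∈ i))

  B₁ B₂ B₃ B₄ B₅ : Subset r
  B₁ = B ─ end 0F
  B₂ = B₁ ─ end 1F
  B₃ = B₂ ─ end 2F
  B₄ = B₃ ─ end 3F
  B₅ = B₄ ─ end 4F

  B₅⊆ : ∀ {x} → x ∈ B₅ → x ∈ B × (∀ i → x ≢ end i)
  B₅⊆ {x} p₅ with ─-∈ {X = B₄} p₅
  ... | p₄ , n₄ with ─-∈ {X = B₃} p₄
  ... | p₃ , n₃ with ─-∈ {X = B₂} p₃
  ... | p₂ , n₂ with ─-∈ {X = B₁} p₂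
  ... | p₁ , n₁ with ─-∈ {X = B} p₁
  ... | p₀ , n₀ = p₀ , λ { 0F → n₀ ; 1F → n₁ ; 2F → n₂ ; 3F → n₃ ; 4F → n₄ }

  apart₅ : ∀ i → Apart B₅ (d i)
  apart₅ i = apart-without U (d∈ i) (proj₁ (proj₂ (represented (d∈ i)))) (proj₂ (proj₂ (represented (d∈ i))))
    (λ x p → proj₁ (B₅⊆ p)) (λ p → proj₂ (B₅⊆ p) i refl)

  step : ∀ {Y : Subset r} g b i → g ⊕ ι (b ⊕ δ i) ∈ Y → g ⊕ ι b ⊕ d i ∈ Y
  step {Y} g b i = subst (_∈ Y) (trans (cong (g ⊕_) (ι-⊕ b (δ i))) (sym (⊕-assoc g (ι b) (d i))))

  opaque
    local-independent : ∀ g → fibre B₅ g ≤ 4 + fibre (centresOf B₅) g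
    local-independent g = subst₂ (λ a b → a ≤ 4 + b) (sym (fibre-# B₅ g)) (sym (fibre-# (centresOf B₅) g))
      (≤-trans (independent-size h ind-h) (+-monoʳ-≤ 4 (#-mono {X = centres h} {Y = λ b → centresOf B₅ (g ⊕ ι b)} λ b p →
        all-fin-complete (λ i → B₅ (g ⊕ ι b ⊕ d i)) (λ i → step {B₅} g b i (all-fin-sound (λ i → h (b ⊕ δ i)) p i)))))
      where
      h : Subset 4
      h b = B₅ (g ⊕ ι b)
      none : ∀ i b → not (edges-at h i b) ≡ true
      none i b = cong not (¬true⇒false λ p → apart₅ i (g ⊕ ι b) (∧-trueˡ p) (step {B₅} g b i (∧-trueʳ {h b} p)))
      ind-h : independent h ≡ true
      ind-h = all-fin-complete (λ i → all-points (λ b → not (edges-at h i b))) λ i → all-points-complete (λ b → not (edges-at h i b)) (none i)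

  C : Subset r
  C = centresOf B

  f : ℕ
  f = # C

  C∈ : ∀ {v} → v ∈ C → ∀ i → v ⊕ d i ∈ B
  C∈ {v} p i = all-fin-sound (λ i → B (v ⊕ d i)) p i

  opaque
    #B₅-bound : 16 * # B₅ ≤ 4 * 2 ^ r + 16 * f
    #B₅-bound = begin
      16 * # B₅                                       ≡⟨ sym (∑-fibre B₅) ⟩
      ∑ (fibre B₅)                                    ≤⟨ ∑-mono local-independent ⟩
      ∑ (λ g → 4 + fibre (centresOf B₅) g)            ≡⟨ ∑-+ (λ _ → 4) (fibre (centresOf B₅)) ⟩
      ∑ {r} (λ _ → 4) + ∑ (fibre (centresOf B₅))      ≡⟨ cong₂ _+_ (∑-const {r} 4) (∑-fibre (centresOf B₅)) ⟩
      4 * 2 ^ r + 16 * # (centresOf B₅)               ≤⟨ +-monoʳ-≤ (4 * 2 ^ r) (*-monoʳ-≤ 16 (#-mono {X = centresOf B₅} {Y = C} sub)) ⟩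
      4 * 2 ^ r + 16 * f                              ∎
      where
      open ≤-Reasoning
      sub : centresOf B₅ ⊆ C
      sub v p = all-fin-complete (λ i → B (v ⊕ d i)) (λ i → proj₁ (B₅⊆ (all-fin-sound (λ i → B₅ (v ⊕ d i)) p i)))

  opaque
    #B≤#B₅ : # B ≤ # B₅ + 5
    #B≤#B₅ = derive {ρ = # B ∷ # B₁ ∷ # B₂ ∷ # B₃ ∷ # B₄ ∷ # B₅ ∷ []} (y₀ ≼ y₅ ⊞ $ 5) 1
      (1 ⊗ y₀ ≼ y₁ ⊞ $ 1 by #-─ B (end 0F) ∷ 1 ⊗ y₁ ≼ y₂ ⊞ $ 1 by #-─ B₁ (end 1F) ∷ 1 ⊗ y₂ ≼ y₃ ⊞ $ 1 by #-─ B₂ (end 2F) ∷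
       1 ⊗ y₃ ≼ y₄ ⊞ $ 1 by #-─ B₃ (end 3F) ∷ 1 ⊗ y₄ ≼ y₅ ⊞ $ 1 by #-─ B₄ (end 4F) ∷ []) refl

  pairs : Fin 5 → Subset r
  pairs i x = B x ∧ B (x ⊕ d i)

  pairs-ends : ∀ {i x} → x ∈ pairs i → x ≡ end i ⊎ x ≡ end i ⊕ d i
  pairs-ends {i} {x} p = unique (d∈ i) (∧-trueˡ p) (∧-trueʳ {B x} p)
    (proj₁ (proj₂ (represented (d∈ i)))) (proj₂ (proj₂ (represented (d∈ i))))

  point-fibre : ∀ a g → fibre ⁅ a ⁆ g ≤ 1
  point-fibre a = fibre≤1 ⁅ a ⁆ λ {x} {b} p q → ι-injective b
    (trans (group (x ∷ ι b ∷ []) x₁ (x₀ ∔ (x₀ ∔ x₁)) refl) (trans (cong₂ _⊕_ (≟-true p) (≟-true q)) (⊕-self a)))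

  pairs-ind : ∀ i x → ind (pairs i x) ≤ ind (⁅ end i ⁆ x) + ind (⁅ end i ⊕ d i ⁆ x)
  pairs-ind i x with pairs i x in e
  ... | false = z≤n
  ... | true with pairs-ends {i} {x} e
  ...   | inj₁ q rewrite q | ≟-refl (end i) = s≤s z≤n
  ...   | inj₂ q rewrite q | ≟-refl (end i ⊕ d i) = m≤n+m 1 _

  opaque
    fibre-pairs : ∀ i g → fibre (pairs i) g ≤ 2
    fibre-pairs i g = begin
      fibre (pairs i) g                                       ≡⟨ fibre-# (pairs i) g ⟩
      # (λ b → pairs i (g ⊕ ι b))                             ≤⟨ ∑-mono (λ b → pairs-ind i (g ⊕ ι b)) ⟩
      ∑ (λ b → ind (⁅ end i ⁆ (g ⊕ ι b)) + ind (⁅ end i ⊕ d i ⁆ (g ⊕ ι b)))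
        ≡⟨ ∑-+ (λ b → ind (⁅ end i ⁆ (g ⊕ ι b))) (λ b → ind (⁅ end i ⊕ d i ⁆ (g ⊕ ι b))) ⟩
      # (λ b → ⁅ end i ⁆ (g ⊕ ι b)) + # (λ b → ⁅ end i ⊕ d i ⁆ (g ⊕ ι b))
        ≡⟨ sym (cong₂ _+_ (fibre-# ⁅ end i ⁆ g) (fibre-# ⁅ end i ⊕ d i ⁆ g)) ⟩
      fibre ⁅ end i ⁆ g + fibre ⁅ end i ⊕ d i ⁆ g             ≤⟨ +-mono-≤ (point-fibre (end i) g) (point-fibre (end i ⊕ d i) g) ⟩
      2                                                       ∎
      where open ≤-Reasoning

  opaque
    #pairs : ∀ i → # (pairs i) ≤ 2
    #pairs i = ≤-trans (∑-mono (pairs-ind i)) (≤-reflexive (trans (∑-+ (λ x → ind (⁅ end i ⁆ x)) (λ x → ind (⁅ end i ⊕ d i ⁆ x)))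
      (cong₂ _+_ (#⁅⁆ (end i)) (#⁅⁆ (end i ⊕ d i)))))

  opaque
    local-sparse : ∀ g → 4 * fibre B g ≤ 20 + sum-fin (λ i → fibre (pairs i) g)
    local-sparse g = subst (λ a → 4 * a ≤ 20 + sum-fin (λ i → fibre (pairs i) g)) (sym (fibre-# B g)) (≤-trans (sparse-size h sparse-h) (+-monoʳ-≤ 20 (sum-fin-mono (λ i → to-pairs i))))
      where
      h : Subset 4
      h b = B (g ⊕ ι b)
      to-pairs : ∀ i → # (edges-at h i) ≤ fibre (pairs i) g
      to-pairs i = subst (# (edges-at h i) ≤_) (sym (fibre-# (pairs i) g)) (#-mono {X = edges-at h i} {Y = λ b → pairs i (g ⊕ ι b)} λ b p → ∧-intro (∧-trueˡ p) (step {B} g b i (∧-trueʳ {h b} p)))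
      sparse-h : sparse h ≡ true
      sparse-h = all-fin-complete (λ i → # (edges-at h i) ≤ᵇ 2) λ i → T⇒true (≤⇒≤ᵇ (≤-trans (to-pairs i) (fibre-pairs i g)))

  opaque
    #B-bound : 64 * # B ≤ 20 * 2 ^ r + 160
    #B-bound = begin
      64 * # B                                                      ≡⟨ *-assoc 4 16 (# B) ⟩
      4 * (16 * # B)                                                ≡⟨ cong (4 *_) (sym (∑-fibre B)) ⟩
      4 * ∑ (fibre B)                                               ≡⟨ sym (∑-* 4 (fibre B)) ⟩
      ∑ (λ g → 4 * fibre B g)                                       ≤⟨ ∑-mono local-sparse ⟩
      ∑ (λ g → 20 + sum-fin (λ i → fibre (pairs i) g))              ≡⟨ ∑-+ (λ _ → 20) (λ g → sum-fin (λ i → fibre (pairs i) g)) ⟩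
      ∑ {r} (λ _ → 20) + ∑ (λ g → sum-fin (λ i → fibre (pairs i) g)) ≡⟨ cong₂ _+_ (∑-const {r} 20) (sum-fin-∑ (λ i → fibre (pairs i))) ⟩
      20 * 2 ^ r + sum-fin (λ i → ∑ (fibre (pairs i)))              ≤⟨ +-monoʳ-≤ (20 * 2 ^ r) (sum-fin-mono {g = λ _ → 32} λ i →
                                                                        ≤-trans (≤-reflexive (∑-fibre (pairs i))) (*-monoʳ-≤ 16 (#pairs i))) ⟩
      20 * 2 ^ r + 160                                              ∎
      where open ≤-Reasoning

  opaque
    q : ℕ
    q = proj₁ (dimension r (# B) #B-bound large)

    2^r≡ : 2 ^ r ≡ 512 * q
    2^r≡ = proj₁ (proj₂ (dimension r (# B) #B-bound large))

    q≥1 : 1 ≤ q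
    q≥1 = proj₂ (proj₂ (dimension r (# B) #B-bound large))

  opaque
    -- From 11/36 - 1/4 = 1/18 and 512/18 > 28. As there are 32q cosets with at most one centre each
    -- (`c≤1`), at least seven eighths of them contain a centre.
    f≥ : 28 * q ≤ f
    f≥ = derive {ρ = # B ∷ # B₅ ∷ f ∷ q ∷ []} (28 ⊠ y₃ ≼ y₂) 576
      (36 ⊗ 16 ⊠ y₁ ≼ 4 ⊠ (512 ⊠ y₃) ⊞ 16 ⊠ y₂ by subst (λ N → 16 * # B₅ ≤ 4 * N + 16 * f) 2^r≡ #B₅-bound ∷
       576 ⊗ y₀ ≼ y₁ ⊞ $ 5 by #B≤#B₅ ∷
       16 ⊗ 11 ⊠ (512 ⊠ y₃) ⊞ $ 145 ≼ 36 ⊠ y₀ by subst (λ N → 11 * N + 145 ≤ 36 * # B) 2^r≡ large ∷ []) refl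

  -- The set C + C meets every coset in one point and is a subgroup.

  opaque
    -- The sum `x` would have edges at `v ⊕ d i` and `v ⊕ d j`. By uniqueness these points agree, or
    -- `x` is `d i ⊕ d j`, against sum-freeness.
    two-shifts : ∀ {v x i j} → i ≢ j → v ∈ C → v ⊕ d i ⊕ x ∈ B → v ⊕ d j ⊕ x ∈ B → x ∈ D → ⊥
    two-shifts {v} {x} {i} {j} n v∈ p p' x∈ with unique x∈ (C∈ v∈ i) p (C∈ v∈ j) p'
    ... | inj₁ e = d-injective n (trans (group (v ∷ d i ∷ []) x₁ (x₀ ∔ (x₀ ∔ x₁)) refl) (trans (cong (v ⊕_) e) (group (v ∷ d j ∷ []) (x₀ ∔ (x₀ ∔ x₁)) x₁ refl)))
    ... | inj₂ e = sf (d∈ i) (d∈ j) (subst (_∈ D) (trans (group (v ∷ d j ∷ x ∷ []) x₂ (x₀ ∔ x₁ ∔ x₂ ∔ x₀ ∔ x₁) refl)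
                      (trans (cong (λ t → t ⊕ v ⊕ d j) (sym e)) (group (v ∷ d i ∷ d j ∷ []) (x₀ ∔ x₁ ∔ x₀ ∔ x₂) (x₁ ∔ x₂) refl))) x∈)

  opaque
    -- If `b` is `δ i ⊕ δ i'`, then adding `(v ⊕ v') ⊕ ι b` carries the neighbour `v ⊕ d i` of `v`
    -- to the neighbour `v' ⊕ d i'` of `v'`. An even `b` has two such decompositions, hence two
    -- edges with the same sum.
    sums-of-centres : ∀ {v v' b} → v ∈ C → v' ∈ C → (v ⊕ v') ⊕ ι b ∈ D → isGen b ≡ true
    sums-of-centres {v} {v'} {b} p p' m with kind b
    ... | generator i refl = isGen-δ i
      where
      isGen-δ : ∀ i → isGen (δ i) ≡ true
      isGen-δ 0F = refl
      isGen-δ 1F = refl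
      isGen-δ 2F = refl
      isGen-δ 3F = refl
      isGen-δ 4F = refl
    ... | even i j i' j' n e e' = ⊥-elim (two-shifts n p (hit i i' e) (hit j j' e') m)
      where
      hit : ∀ i i' → b ≡ δ i ⊕ δ i' → v ⊕ d i ⊕ ((v ⊕ v') ⊕ ι b) ∈ B
      hit i i' refl = subst (_∈ B) (trans (group (v ∷ v' ∷ d i ∷ d i' ∷ []) (x₁ ∔ x₃) (x₀ ∔ x₂ ∔ (x₀ ∔ x₁ ∔ (x₂ ∔ x₃))) refl)
                         (cong (λ t → v ⊕ d i ⊕ ((v ⊕ v') ⊕ t)) (sym (ι-⊕ (δ i) (δ i'))))) (C∈ p' i')

  opaque
    -- Every `d t` is the sum of these two centres and `ι (b ⊕ δ t)`, so `b ⊕ δ t` would be a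
    -- generator for all `t`, against `even-shift`.
    one-centre : ∀ {v b} → v ∈ C → v ⊕ ι b ∈ C → b ≡ 𝟎
    one-centre {v} {b} p p' with b ≟ 𝟎
    ... | yes e = e
    ... | no n with even-shift b n
    ... | t , e = ⊥-elim (true≢false (sums-of-centres {v} {v ⊕ ι b} {b ⊕ δ t} p p' (subst (_∈ D)
          (trans (group (v ∷ ι b ∷ d t ∷ []) x₂ (x₀ ∔ (x₀ ∔ x₁) ∔ (x₁ ∔ x₂)) refl) (cong ((v ⊕ (v ⊕ ι b)) ⊕_) (sym (ι-⊕ b (δ t))))) (d∈ t))) e)

  c : F₂^ r → ℕ
  c = fibre C

  opaque
    c≤1 : ∀ g → c g ≤ 1
    c≤1 = fibre≤1 C one-centre

  h : F₂^ r → ℕ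
  h = fibre D

  opaque
    h-centres : ∀ {v v' g b} → v ∈ C → v' ∈ C → v ⊕ v' ≡ g ⊕ ι b → h g ≤ 5
    h-centres {v} {v'} {g} {b} p p' e = ≤-trans (≤-reflexive (trans (sym (fibre-shift D g b)) (trans (cong h (sym e)) (fibre-# D (v ⊕ v')))))
      (#-mono {X = λ b → D ((v ⊕ v') ⊕ ι b)} {Y = isGen} (λ _ → sums-of-centres p p'))

  opaque
    -- Within this coset `D` is confined to the common neighbours of two distinct vertices of the
    -- Clebsch graph.
    two-centres : ∀ {v v' w w' b} → v ∈ C → v' ∈ C → w ∈ C → w' ∈ C → (v ⊕ v') ⊕ (w ⊕ w') ≡ ι b → b ≢ 𝟎 → h (v ⊕ v') ≤ 2
    two-centres {v} {v'} {w} {w'} {b} p p' m m' e n = subst (_≤ 2) (sym (fibre-# D (v ⊕ v'))) (≤-trans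
      (#-mono {X = λ c → D ((v ⊕ v') ⊕ ι c)} {Y = λ c → isGen c ∧ isGen (c ⊕ b)} λ c x → ∧-intro (sums-of-centres {b = c} p p' x)
        (sums-of-centres {b = c ⊕ b} m m' (subst (_∈ D) (trans (group (v ∷ v' ∷ w ∷ w' ∷ ι c ∷ []) (x₀ ∔ x₁ ∔ x₄) (x₂ ∔ x₃ ∔ (x₄ ∔ (x₀ ∔ x₁ ∔ (x₂ ∔ x₃)))) refl)
           (cong ((w ⊕ w') ⊕_) (trans (cong (ι c ⊕_) e) (sym (ι-⊕ c b))))) x)))
      (common-neighbours b n))

  opaque
    ∑-c-shift : ∀ g → ∑ (λ x → c (x ⊕ g)) ≡ 16 * f
    ∑-c-shift g = trans (∑-shift c g) (∑-fibre C)

  opaque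
    two-fibres : ∀ g → 1 * 2 ^ r < ∑ (λ x → c x + c (x ⊕ g))
    two-fibres g = begin-strict
      1 * 2 ^ r                           ≡⟨ trans (*-identityˡ (2 ^ r)) 2^r≡ ⟩
      512 * q                             <⟨ derive {ρ = q ∷ f ∷ []} ($ 1 ⊞ 512 ⊠ y₀ ≼ 16 ⊠ y₁ ⊞ 16 ⊠ y₁) 1 (32 ⊗ 28 ⊠ y₀ ≼ y₁ by f≥ ∷ 1 ⊗ $ 1 ≼ y₀ by q≥1 ∷ []) refl ⟩
      16 * f + 16 * f                     ≡⟨ sym (cong₂ _+_ (∑-fibre C) (∑-c-shift g)) ⟩
      ∑ c + ∑ (λ x → c (x ⊕ g))           ≡⟨ sym (∑-+ c (λ x → c (x ⊕ g))) ⟩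
      ∑ (λ x → c x + c (x ⊕ g))           ∎
      where open ≤-Reasoning

  both-positive : ∀ {a b} → 1 < a + b → a ≤ 1 → b ≤ 1 → 0 < a × 0 < b
  both-positive {0} p _ b≤ = ⊥-elim (<⇒≱ p b≤)
  both-positive {suc a} {0} p a≤ _ = ⊥-elim (<⇒≱ p (≤-trans (≤-reflexive (+-identityʳ (suc a))) a≤))
  both-positive {suc a} {suc b} _ _ _ = s≤s z≤n , s≤s z≤n

  opaque
    -- More than half of the cosets contain a centre, so some two that differ by `g` both do.
    covered : ∀ g → ∃[ v ] ∃[ v' ] ∃[ b ] v ∈ C × v' ∈ C × v ⊕ v' ≡ g ⊕ ι b
    covered g with ∑-exceeds (λ x → c x + c (x ⊕ g)) 1 (two-fibres g)
    ... | x , p with both-positive p (c≤1 x) (c≤1 (x ⊕ g))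
    ... | p₁ , p₂ with fibre-pos C {x} p₁ | fibre-pos C {x ⊕ g} p₂
    ... | b , v∈ | b' , v'∈ = x ⊕ ι b , x ⊕ g ⊕ ι b' , b ⊕ b' , v∈ , v'∈ ,
            trans (group (x ∷ g ∷ ι b ∷ ι b' ∷ []) (x₀ ∔ x₂ ∔ (x₀ ∔ x₁ ∔ x₃)) (x₁ ∔ (x₂ ∔ x₃)) refl) (cong (g ⊕_) (sym (ι-⊕ b b')))

  opaque
    h≤5 : ∀ g → h g ≤ 5
    h≤5 g with covered g
    ... | v , v' , b , p , p' , e = h-centres {v} {v'} {g} {b} p p' e

  -- Typical elements of B: those next to a centre

  Typical : Subset r
  Typical y = not (all-fin (λ i → not (C (y ⊕ d i))))

  opaque
    typical : ∀ {y} → y ∈ Typical → ∃[ i ] y ⊕ d i ∈ C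
    typical {y} p with Finₚ.any? (λ i → (y ⊕ d i) ∈? C)
    ... | yes x = x
    ... | no none = ⊥-elim (true≢false p (cong not (all-fin-complete (λ i → not (C (y ⊕ d i))) (λ i → cong not (¬true⇒false (λ x → none (i , x)))))))

  opaque
    typical-B : ∀ {y} → y ∈ Typical → y ∈ B
    typical-B {y} p with typical p
    ... | i , v∈ = subst (_∈ B) (⊕-cancel y (d i)) (C∈ v∈ i)

  δ-injective : ∀ {i j} → δ i ≡ δ j → i ≡ j
  δ-injective {i} {j} e with i Fin.≟ j
  ... | yes p = p
  ... | no n = ⊥-elim (d-injective n (cong ι e))

  opaque
    5f≤#Typical : 5 * f ≤ # Typical
    5f≤#Typical = begin
      5 * f                                            ≡⟨ lem f ⟩
      sum-fin (λ _ → f)                                ≤⟨ sum-fin-mono (λ i → ≤-reflexive (sym (#-shift C (d i)))) ⟩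
      sum-fin (λ i → # (λ y → C (y ⊕ d i)))             ≡⟨ sym (sum-fin-∑ (λ i y → ind (C (y ⊕ d i)))) ⟩
      ∑ (λ y → sum-fin (λ i → ind (C (y ⊕ d i))))       ≤⟨ ∑-mono pt ⟩
      # Typical                                        ∎
      where
      open ≤-Reasoning
      lem : ∀ f → 5 * f ≡ f + (f + (f + (f + f)))
      lem = solve-∀
      one : ∀ {y i j} → y ⊕ d i ∈ C → y ⊕ d j ∈ C → i ≡ j
      one {y} {i} {j} p p' = δ-injective (⊕≡𝟎⇒≡ (one-centre p (subst (_∈ C) (trans (group (y ∷ d i ∷ d j ∷ []) (x₀ ∔ x₂) (x₀ ∔ x₁ ∔ (x₁ ∔ x₂)) refl)
                              (cong (y ⊕ d i ⊕_) (sym (ι-⊕ (δ i) (δ j))))) p')))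
      single-index : (g : Fin 5 → Bool) → (∀ {i j} → g i ≡ true → g j ≡ true → i ≡ j) → sum-fin (λ i → ind (g i)) ≤ ind (not (all-fin (λ i → not (g i))))
      single-index g u with g 0F in e₀ | g 1F in e₁ | g 2F in e₂ | g 3F in e₃ | g 4F in e₄
      ... | true | true | _ | _ | _ with u e₀ e₁
      ...   | ()
      single-index g u | true | _ | true | _ | _ with u e₀ e₂
      ...   | ()
      single-index g u | true | _ | _ | true | _ with u e₀ e₃
      ...   | ()
      single-index g u | true | _ | _ | _ | true with u e₀ e₄
      ...   | ()
      single-index g u | _ | true | true | _ | _ with u e₁ e₂
      ...   | ()
      single-index g u | _ | true | _ | true | _ with u e₁ e₃
      ...   | ()
      single-index g u | _ | true | _ | _ | true with u e₁ e₄
      ...   | ()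
      single-index g u | _ | _ | true | true | _ with u e₂ e₃
      ...   | ()
      single-index g u | _ | _ | true | _ | true with u e₂ e₄
      ...   | ()
      single-index g u | _ | _ | _ | true | true with u e₃ e₄
      ...   | ()
      single-index g u | true | false | false | false | false = ≤-refl
      single-index g u | false | true | false | false | false = ≤-refl
      single-index g u | false | false | true | false | false = ≤-refl
      single-index g u | false | false | false | true | false = ≤-refl
      single-index g u | false | false | false | false | true = ≤-refl
      single-index g u | false | false | false | false | false = z≤n
      pt : ∀ y → sum-fin (λ i → ind (C (y ⊕ d i))) ≤ ind (Typical y)
      pt y = single-index (λ i → C (y ⊕ d i)) one

  opaque
    -- Such an edge would be the sum of two centres, `d i` and `d j`; but `δ i ⊕ δ j` is not a
    -- generator.
    typical-independent : ∀ {y e} → y ∈ Typical → e ∈ D → y ⊕ e ∈ Typical → ⊥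
    typical-independent {y} {e} p e∈ p' with typical p | typical p'
    ... | i , v∈ | j , v'∈ = true≢false (sums-of-centres {b = δ i ⊕ δ j} v∈ v'∈ (subst (_∈ D)
          (trans (group (y ∷ e ∷ d i ∷ d j ∷ []) x₁ (x₀ ∔ x₂ ∔ (x₀ ∔ x₁ ∔ x₃) ∔ (x₂ ∔ x₃)) refl)
                 (cong ((y ⊕ d i ⊕ (y ⊕ e ⊕ d j)) ⊕_) (sym (ι-⊕ (δ i) (δ j))))) e∈)) (generators-far i j)

  opaque
    -- By independence an edge has at most one typical end, so typical vertices other than `o` lie
    -- on distinct edges.
    #Typical≤ : # Typical ≤ 1 + # D
    #Typical≤ = begin
      # Typical
        ≤⟨ ∑-mono pt ⟩
      ∑ (λ y → ind (⁅ o ⁆ y) + # (λ e → Typical y ∧ (D e ∧ B (y ⊕ e))))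
        ≡⟨ ∑-+ (λ y → ind (⁅ o ⁆ y)) (λ y → # (λ e → Typical y ∧ (D e ∧ B (y ⊕ e)))) ⟩
      # ⁅ o ⁆ + ∑ (λ y → # (λ e → Typical y ∧ (D e ∧ B (y ⊕ e))))
        ≡⟨ cong₂ _+_ (#⁅⁆ o) (∑-swap (λ y e → ind (Typical y ∧ (D e ∧ B (y ⊕ e))))) ⟩
      1 + ∑ (λ e → # (λ y → Typical y ∧ (D e ∧ B (y ⊕ e))))
        ≤⟨ s≤s (∑-mono pt') ⟩
      1 + # D ∎
      where
      open ≤-Reasoning
      pt : ∀ y → ind (Typical y) ≤ ind (⁅ o ⁆ y) + # (λ e → Typical y ∧ (D e ∧ B (y ⊕ e)))
      pt y with Typical y in p | y ≟ o
      ... | false | _ = z≤n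
      ... | true | yes _ = s≤s z≤n
      ... | true | no n with cover y (typical-B p) n
      ...   | e , e∈ , y'∈ = ∈⇒#-pos {X = λ e → D e ∧ B (y ⊕ e)} (∧-intro e∈ y'∈)
      pt' : ∀ e → # (λ y → Typical y ∧ (D e ∧ B (y ⊕ e))) ≤ ind (D e)
      pt' e with D e in e∈
      ... | false = ≤-reflexive (#-empty {X = λ y → Typical y ∧ false} λ y p → true≢false (∧-trueʳ {Typical y} p) refl)
      ... | true = ∑-at-most-one {P = λ y → Typical y ∧ B (y ⊕ e)} one
        where
        one : ∀ {x y} → Typical x ∧ B (x ⊕ e) ≡ true → Typical y ∧ B (y ⊕ e) ≡ true → x ≡ y
        one {x} {y} p p' with unique e∈ (typical-B (∧-trueˡ p)) (∧-trueʳ {Typical x} p) (typical-B (∧-trueˡ p')) (∧-trueʳ {Typical y} p')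
        ... | inj₁ eq = eq
        ... | inj₂ refl = ⊥-elim (typical-independent (∧-trueˡ p') e∈ (∧-trueˡ p))

  opaque
    #D≥ : 5 * f ≤ 1 + # D
    #D≥ = ≤-trans 5f≤#Typical #Typical≤

  -- If two elements of C + C differed by ι b, the cosets through v₁ ⊕ C or v₂ ⊕ C would contain few elements of D.
  opaque
    sums-differ : ∀ {v₁ v₂ v₃ v₄ b} → v₁ ∈ C → v₂ ∈ C → v₃ ∈ C → v₄ ∈ C → (v₁ ⊕ v₂) ⊕ (v₃ ⊕ v₄) ≡ ι b → b ≡ 𝟎
    sums-differ {v₁} {v₂} {v₃} {v₄} {b} p₁ p₂ p₃ p₄ eq with b ≟ 𝟎
    ... | yes e = e
    ... | no n = ⊥-elim (refute {ρ = f ∷ # D ∷ q ∷ []}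
          (1 ⊗ 96 ⊠ y₀ ⊞ 32 ⊠ y₁ ≼ 13 ⊠ (512 ⊠ y₂) by subst (λ N → 96 * f + 32 * # D ≤ 13 * N) 2^r≡ total ∷
           32 ⊗ 5 ⊠ y₀ ≼ $ 1 ⊞ y₁ by #D≥ ∷ 256 ⊗ 28 ⊠ y₂ ≼ y₀ by f≥ ∷ 33 ⊗ $ 1 ≼ y₂ by q≥1 ∷ []) refl)
      where
      -- The weight 3 balances the cases: 3 + 5 + 5 and 3 + 3 + 5 + 2 are both 13.
      F : F₂^ r → ℕ
      F g = (3 * c g + 3 * c (g ⊕ (v₁ ⊕ v₃))) + (h (g ⊕ v₁) + h (g ⊕ v₂))
      few : ∀ {v v' w w' e} → v ∈ C → v' ∈ C → w ∈ C → w' ∈ C → (v ⊕ v') ⊕ (w ⊕ w') ≡ ι e → v ⊕ v' ≢ w ⊕ w' → h (v ⊕ v') ≤ 2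
      few {v} {v'} {w} {w'} {e} a a' m m' i neq = two-centres {b = e} a a' m m' i λ { refl → neq (⊕≡𝟎⇒≡ (trans i (lin-𝟎 (e₁ ∷ e₂ ∷ e₃ ∷ e₄ ∷ [])))) }
      -- Let `w` and `w'` be the two centres. Then `w ⊕ v₁` and `w' ⊕ v₃` share the coset of
      -- `g ⊕ v₁`, while `w ⊕ v₂` and `w' ⊕ v₄` share that of `g ⊕ v₂`. Not both pairs coincide, as
      -- their differences differ by `ι b`; a pair of distinct points leaves room for only two
      -- elements of `D`.
      both : ∀ g → c g ≡ 1 → c (g ⊕ (v₁ ⊕ v₃)) ≡ 1 → h (g ⊕ v₁) + h (g ⊕ v₂) ≤ 7
      both g c₁ c₂ with fibre-pos C {g} (≤-reflexive (sym c₁)) | fibre-pos C {g ⊕ (v₁ ⊕ v₃)} (≤-reflexive (sym c₂))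
      ... | a , w∈ | a' , w'∈ with (g ⊕ ι a ⊕ v₁) ≟ (g ⊕ (v₁ ⊕ v₃) ⊕ ι a' ⊕ v₃)
      ...   | no neq = +-mono-≤ (subst (_≤ 2) (trans (cong h (group (g ∷ ι a ∷ v₁ ∷ []) (x₀ ∔ x₁ ∔ x₂) (x₀ ∔ x₂ ∔ x₁) refl)) (fibre-shift D (g ⊕ v₁) a))
                  (few {e = a ⊕ a'} w∈ p₁ w'∈ p₃ (trans (group (g ∷ ι a ∷ ι a' ∷ v₁ ∷ v₃ ∷ []) (x₀ ∔ x₁ ∔ x₃ ∔ (x₀ ∔ (x₃ ∔ x₄) ∔ x₂ ∔ x₄)) (x₁ ∔ x₂) refl) (sym (ι-⊕ a a'))) neq))
                  (h≤5 (g ⊕ v₂))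
      ...   | yes same = +-mono-≤ (h≤5 (g ⊕ v₁)) (subst (_≤ 2) (trans (cong h (group (g ∷ ι a ∷ v₂ ∷ []) (x₀ ∔ x₁ ∔ x₂) (x₀ ∔ x₂ ∔ x₁) refl)) (fibre-shift D (g ⊕ v₂) a))
                  (two-centres {b = b} w∈ p₂ w'∈ p₄ (trans (group (g ⊕ ι a ∷ g ⊕ (v₁ ⊕ v₃) ⊕ ι a' ∷ v₁ ∷ v₂ ∷ v₃ ∷ v₄ ∷ [])
                       (x₀ ∔ x₃ ∔ (x₁ ∔ x₅)) (x₀ ∔ x₂ ∔ (x₁ ∔ x₄) ∔ (x₂ ∔ x₃ ∔ (x₄ ∔ x₅))) refl)
                     (trans (cong₂ _⊕_ (trans (cong (_⊕ (g ⊕ (v₁ ⊕ v₃) ⊕ ι a' ⊕ v₃)) same) (⊕-self _)) eq) (⊕-identityˡ (ι b)))) n))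
      pt : ∀ g → F g ≤ 13
      pt g with c g in c₁ | c (g ⊕ (v₁ ⊕ v₃)) in c₂ | c≤1 g | c≤1 (g ⊕ (v₁ ⊕ v₃))
      ... | 0 | u | _ | u≤ = +-mono-≤ (*-monoʳ-≤ 3 u≤) (+-mono-≤ (h≤5 (g ⊕ v₁)) (h≤5 (g ⊕ v₂)))
      ... | 1 | 0 | _ | _ = +-monoʳ-≤ 3 (+-mono-≤ (h≤5 (g ⊕ v₁)) (h≤5 (g ⊕ v₂)))
      ... | 1 | 1 | _ | _ = +-monoʳ-≤ 6 (both g c₁ c₂)
      ... | suc (suc _) | _ | s≤s () | _
      ... | 1 | suc (suc _) | _ | s≤s ()
      total : 96 * f + 32 * # D ≤ 13 * 2 ^ r
      total = begin
        96 * f + 32 * # D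
          ≡⟨ lem f (# D) ⟩
        (3 * (16 * f) + 3 * (16 * f)) + (16 * # D + 16 * # D)
          ≡⟨ sym (cong₂ _+_
               (cong₂ _+_ (trans (∑-* 3 c) (cong (3 *_) (∑-fibre C))) (trans (∑-* 3 (λ g → c (g ⊕ (v₁ ⊕ v₃)))) (cong (3 *_) (∑-c-shift (v₁ ⊕ v₃)))))
               (cong₂ _+_ (trans (∑-shift h v₁) (∑-fibre D)) (trans (∑-shift h v₂) (∑-fibre D)))) ⟩
        (∑ (λ g → 3 * c g) + ∑ (λ g → 3 * c (g ⊕ (v₁ ⊕ v₃)))) + (∑ (λ g → h (g ⊕ v₁)) + ∑ (λ g → h (g ⊕ v₂)))
          ≡⟨ sym (trans (∑-+ (λ g → 3 * c g + 3 * c (g ⊕ (v₁ ⊕ v₃))) (λ g → h (g ⊕ v₁) + h (g ⊕ v₂)))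
               (cong₂ _+_ (∑-+ (λ g → 3 * c g) (λ g → 3 * c (g ⊕ (v₁ ⊕ v₃)))) (∑-+ (λ g → h (g ⊕ v₁)) (λ g → h (g ⊕ v₂))))) ⟩
        ∑ F
          ≤⟨ ∑-mono pt ⟩
        ∑ {r} (λ _ → 13)
          ≡⟨ ∑-const {r} 13 ⟩
        13 * 2 ^ r ∎
        where
        open ≤-Reasoning
        lem : ∀ f D → 96 * f + 32 * D ≡ (3 * (16 * f) + 3 * (16 * f)) + (16 * D + 16 * D)
        lem = solve-∀

  Z : Subset r
  Z g = ⌊ any? (λ v → v ∈? (λ v → C v ∧ C (v ⊕ g))) ⌋

  opaque
    Z∈ : ∀ {g} → g ∈ Z → ∃[ v ] v ∈ C × v ⊕ g ∈ C
    Z∈ {g} p with any? (λ v → v ∈? (λ v → C v ∧ C (v ⊕ g)))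
    ... | yes (v , x) = v , ∧-trueˡ x , ∧-trueʳ {C v} x

    ∈Z : ∀ {g v} → v ∈ C → v ⊕ g ∈ C → g ∈ Z
    ∈Z {g} {v} p p' with any? (λ v → v ∈? (λ v → C v ∧ C (v ⊕ g)))
    ... | yes _ = refl
    ... | no n = ⊥-elim (n (v , ∧-intro p p'))

    Z-sum : ∀ {v v'} → v ∈ C → v' ∈ C → v ⊕ v' ∈ Z
    Z-sum {v} {v'} p p' = ∈Z p (subst (_∈ C) (group (v ∷ v' ∷ []) x₁ (x₀ ∔ (x₀ ∔ x₁)) refl) p')

    Z-one : ∀ {z b} → z ∈ Z → z ⊕ ι b ∈ Z → b ≡ 𝟎
    Z-one {z} {b} p p' with Z∈ p | Z∈ p'
    ... | v , v∈ , vz∈ | w , w∈ , wz∈ = sums-differ v∈ vz∈ w∈ wz∈ (group (v ∷ w ∷ z ∷ ι b ∷ []) (x₀ ∔ (x₀ ∔ x₂) ∔ (x₁ ∔ (x₁ ∔ (x₂ ∔ x₃)))) x₃ refl)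

    Z-covers : ∀ g → ∃[ b ] g ⊕ ι b ∈ Z
    Z-covers g with covered g
    ... | v , v' , b , p , p' , e = b , subst (_∈ Z) e (Z-sum p p')

    #Z≤ : # Z ≤ 32 * q
    #Z≤ = derive {ρ = # Z ∷ q ∷ []} (y₀ ≼ 32 ⊠ y₁) 16 (1 ⊗ 16 ⊠ y₀ ≼ 512 ⊠ y₁ by (begin
      16 * # Z            ≡⟨ sym (∑-fibre Z) ⟩
      ∑ (fibre Z)         ≤⟨ ∑-mono (fibre≤1 Z Z-one) ⟩
      ∑ {r} (λ _ → 1)     ≡⟨ ∑-const {r} 1 ⟩
      1 * 2 ^ r           ≡⟨ trans (*-identityˡ (2 ^ r)) 2^r≡ ⟩
      512 * q             ∎) ∷ []) refl
      where open ≤-Reasoning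

    three-fibres : ∀ z z' → 2 * 2 ^ r < ∑ (λ x → c x + (c (x ⊕ z) + c (x ⊕ z')))
    three-fibres z z' = begin-strict
      2 * 2 ^ r                                             ≡⟨ cong (2 *_) 2^r≡ ⟩
      2 * (512 * q)                                         <⟨ derive {ρ = q ∷ f ∷ []} ($ 1 ⊞ 2 ⊠ (512 ⊠ y₀) ≼ 16 ⊠ y₁ ⊞ (16 ⊠ y₁ ⊞ 16 ⊠ y₁)) 1
                                                                 (48 ⊗ 28 ⊠ y₀ ≼ y₁ by f≥ ∷ 1 ⊗ $ 1 ≼ y₀ by q≥1 ∷ []) refl ⟩
      16 * f + (16 * f + 16 * f)                            ≡⟨ sym (cong₂ _+_ (∑-fibre C) (cong₂ _+_ (∑-c-shift z) (∑-c-shift z'))) ⟩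
      ∑ c + (∑ (λ x → c (x ⊕ z)) + ∑ (λ x → c (x ⊕ z')))     ≡⟨ cong (∑ c +_) (sym (∑-+ (λ x → c (x ⊕ z)) (λ x → c (x ⊕ z')))) ⟩
      ∑ c + ∑ (λ x → c (x ⊕ z) + c (x ⊕ z'))                ≡⟨ sym (∑-+ c (λ x → c (x ⊕ z) + c (x ⊕ z'))) ⟩
      ∑ (λ x → c x + (c (x ⊕ z) + c (x ⊕ z')))              ∎
      where open ≤-Reasoning

    all-positive : ∀ {a b c} → 2 < a + (b + c) → a ≤ 1 → b ≤ 1 → c ≤ 1 → 0 < a × 0 < b × 0 < c
    all-positive {0} p _ b≤ c≤ = ⊥-elim (<⇒≱ p (+-mono-≤ b≤ c≤))
    all-positive {suc _} {0} p a≤ _ c≤ = ⊥-elim (<⇒≱ p (+-mono-≤ a≤ c≤))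
    all-positive {suc _} {suc _} {0} p a≤ b≤ _ = ⊥-elim (<⇒≱ p (+-mono-≤ a≤ (≤-trans (≤-reflexive (+-identityʳ _)) b≤)))
    all-positive {suc _} {suc _} {suc _} _ _ _ _ = s≤s z≤n , s≤s z≤n , s≤s z≤n

    -- The sum of the two centres and `z` itself lie in `Z` and in the same coset, so they are
    -- equal.
    Z-translate : ∀ {x z b b'} → z ∈ Z → x ⊕ ι b ∈ C → x ⊕ z ⊕ ι b' ∈ C → x ⊕ ι b ⊕ z ∈ C
    Z-translate {x} {z} {b} {b'} z∈ p p' = subst (_∈ C) (cong (_⊕ z) (cong (λ t → x ⊕ ι t) (sym b≡b'))) (subst (_∈ C) (group (x ∷ z ∷ ι b' ∷ []) (x₀ ∔ x₁ ∔ x₂) (x₀ ∔ x₂ ∔ x₁) refl) p')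
      where
      b≡b' : b ≡ b'
      b≡b' = ⊕≡𝟎⇒≡ (Z-one z∈ (subst (_∈ Z) (trans (group (x ∷ z ∷ ι b ∷ ι b' ∷ []) (x₀ ∔ x₂ ∔ (x₀ ∔ x₁ ∔ x₃)) (x₁ ∔ (x₂ ∔ x₃)) refl) (cong (z ⊕_) (sym (ι-⊕ b b')))) (Z-sum p p')))

    -- More than two thirds of the cosets contain a centre, so for some `x` the cosets of `x`,
    -- `x ⊕ z` and `x ⊕ z'` all do. If `w` is the first centre, the others are `w ⊕ z` and `w ⊕ z'`,
    -- with sum `z ⊕ z'`.
    Z-closed : ∀ {z z'} → z ∈ Z → z' ∈ Z → z ⊕ z' ∈ Z
    Z-closed {z} {z'} p p' with ∑-exceeds (λ x → c x + (c (x ⊕ z) + c (x ⊕ z'))) 2 (three-fibres z z')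
    ... | x , m with all-positive m (c≤1 x) (c≤1 (x ⊕ z)) (c≤1 (x ⊕ z'))
    ... | m₀ , m₁ , m₂ with fibre-pos C {x} m₀ | fibre-pos C {x ⊕ z} m₁ | fibre-pos C {x ⊕ z'} m₂
    ... | b , w∈ | b₁ , w₁∈ | b₂ , w₂∈ = subst (_∈ Z) (group (x ∷ ι b ∷ z ∷ z' ∷ []) (x₀ ∔ x₁ ∔ x₂ ∔ (x₀ ∔ x₁ ∔ x₃)) (x₂ ∔ x₃) refl)
          (Z-sum (Z-translate {x} {z} {b} {b₁} p w∈ w₁∈) (Z-translate {x} {z'} {b} {b₂} p' w∈ w₂∈))

    v₀∈C : ∃[ v ] v ∈ C
    v₀∈C = #-pos {X = C} (derive {ρ = q ∷ f ∷ []} ($ 1 ≼ y₁) 1 (1 ⊗ 28 ⊠ y₀ ≼ y₁ by f≥ ∷ 1 ⊗ $ 1 ≼ y₀ by q≥1 ∷ []) refl)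

  v₀ : F₂^ r
  v₀ = proj₁ v₀∈C

  opaque
    𝟎∈Z : 𝟎 ∈ Z
    𝟎∈Z = subst (_∈ Z) (⊕-self v₀) (Z-sum (proj₂ v₀∈C) (proj₂ v₀∈C))

  -- Colour classes

  -- As `Z` is complementary to the image of `ι`, a colour is a component in that image. All centres
  -- lie in the coset of `Z` through `v₀`, and their neighbours are offset by some `d m`.
  Bᶜ Dᶜ : Fin 5 → Subset r
  Bᶜ m y = B y ∧ Z (y ⊕ (v₀ ⊕ d m))
  Dᶜ i e = D e ∧ Z (e ⊕ d i)

  opaque
    colour : ∀ {e} → e ∈ D → ∃[ i ] e ⊕ d i ∈ Z
    colour {e} e∈ with Z-covers e
    ... | b , z∈ with Z∈ z∈
    ... | v , v∈ , v'∈ with kind b | sums-of-centres {v} {v ⊕ (e ⊕ ι b)} {b} v∈ v'∈ (subst (_∈ D) (group (v ∷ e ∷ ι b ∷ []) x₁ (x₀ ∔ (x₀ ∔ (x₁ ∔ x₂)) ∔ x₂) refl) e∈)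
    ... | generator i refl | _ = i , z∈
    ... | even i j i' j' _ refl _ | x = ⊥-elim (true≢false x (generators-far i i'))

    f≤#Bᶜ : ∀ m → f ≤ # (Bᶜ m)
    f≤#Bᶜ m = ≤-trans (≤-reflexive (sym (#-shift C (d m)))) (#-mono {X = λ y → C (y ⊕ d m)} {Y = Bᶜ m} λ y p →
      ∧-intro (subst (_∈ B) (⊕-cancel y (d m)) (C∈ p m))
              (subst (_∈ Z) (group (y ∷ d m ∷ v₀ ∷ []) (x₀ ∔ x₁ ∔ x₂) (x₀ ∔ (x₂ ∔ x₁)) refl) (Z-sum p (proj₂ v₀∈C))))

    #Dᶜ≤ : ∀ i → # (Dᶜ i) ≤ # Z
    #Dᶜ≤ i = ≤-trans (#-mono {X = Dᶜ i} {Y = λ e → Z (e ⊕ d i)} (λ e p → ∧-trueʳ {D e} p)) (≤-reflexive (#-shift Z (d i)))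

    #D≤ : ∀ i → # D ≤ # (Dᶜ i) + 4 * # Z
    #D≤ i = begin
      # D                                        ≤⟨ ∑-mono pt ⟩
      ∑ (λ e → sum-fin (λ i → ind (Dᶜ i e)))      ≡⟨ sum-fin-∑ (λ i e → ind (Dᶜ i e)) ⟩
      sum-fin (λ i → # (Dᶜ i))                   ≤⟨ sum-fin-but-one (λ i → # (Dᶜ i)) (# Z) #Dᶜ≤ i ⟩
      # (Dᶜ i) + 4 * # Z                         ∎
      where
      open ≤-Reasoning
      term≤sum : (g : Fin 5 → ℕ) → ∀ i → g i ≤ sum-fin g
      term≤sum g 0F = m≤m+n _ _
      term≤sum g 1F = ≤-trans (m≤m+n _ _) (m≤n+m _ (g 0F))
      term≤sum g 2F = ≤-trans (m≤m+n _ _) (≤-trans (m≤n+m _ (g 1F)) (m≤n+m _ (g 0F)))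
      term≤sum g 3F = ≤-trans (m≤m+n _ _) (≤-trans (m≤n+m _ (g 2F)) (≤-trans (m≤n+m _ (g 1F)) (m≤n+m _ (g 0F))))
      term≤sum g 4F = ≤-trans (m≤n+m _ (g 3F)) (≤-trans (m≤n+m _ (g 2F)) (≤-trans (m≤n+m _ (g 1F)) (m≤n+m _ (g 0F))))
      pt : ∀ e → ind (D e) ≤ sum-fin (λ i → ind (Dᶜ i e))
      pt e with D e in e∈
      ... | false = z≤n
      ... | true with colour e∈
      ...   | i , z∈ = ≤-trans (ind-true z∈) (term≤sum (λ i → ind (Z (e ⊕ d i))) i)

  -- The vertex u is of the kind that an edge of colour i reaches from a vertex of colour m; an edge count shows that
  -- each i admits only one such u in B.
  Acts : F₂^ r → Fin 5 → Set
  Acts u i = ∃[ m ] u ⊕ (v₀ ⊕ (d m ⊕ d i)) ∈ Z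

  opaque
    -- The translate of `Dᶜ i` by `u` and the set `Bᶜ m` lie in one coset of `Z`, so they overlap
    -- when together larger than `Z`; common points are edges of colour `i` at `u`.
    acts-bound : ∀ {u i} → Acts u i → # (Dᶜ i) + f ≤ # Z + # (λ e → Dᶜ i e ∧ B (e ⊕ u))
    acts-bound {u} {i} (m , t) = begin
      # (Dᶜ i) + f
        ≤⟨ +-monoʳ-≤ (# (Dᶜ i)) (f≤#Bᶜ m) ⟩
      # (Dᶜ i) + # (Bᶜ m)
        ≡⟨ cong (_+ # (Bᶜ m)) (sym (#-shift (Dᶜ i) u)) ⟩
      # (λ y → Dᶜ i (y ⊕ u)) + # (Bᶜ m)
        ≡⟨ sym (∑-+ (λ y → ind (Dᶜ i (y ⊕ u))) (λ y → ind (Bᶜ m y))) ⟩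
      ∑ (λ y → ind (Dᶜ i (y ⊕ u)) + ind (Bᶜ m y))
        ≤⟨ ∑-mono pt ⟩
      ∑ (λ y → ind (Z (y ⊕ (v₀ ⊕ d m))) + ind (Dᶜ i (y ⊕ u) ∧ B (y ⊕ u ⊕ u)))
        ≡⟨ ∑-+ (λ y → ind (Z (y ⊕ (v₀ ⊕ d m)))) (λ y → ind (Dᶜ i (y ⊕ u) ∧ B (y ⊕ u ⊕ u))) ⟩
      # (λ y → Z (y ⊕ (v₀ ⊕ d m))) + # (λ y → Dᶜ i (y ⊕ u) ∧ B (y ⊕ u ⊕ u))
        ≡⟨ cong₂ _+_ (#-shift Z (v₀ ⊕ d m)) (#-shift (λ e → Dᶜ i e ∧ B (e ⊕ u)) u) ⟩
      # Z + # (λ e → Dᶜ i e ∧ B (e ⊕ u)) ∎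
      where
      open ≤-Reasoning
      two : ∀ a b {s t} → (a ≡ true → s ≡ true) → (b ≡ true → s ≡ true) → (b ≡ true → t ≡ true) → ind a + ind b ≤ ind s + ind (a ∧ t)
      two false false _ _ _ = z≤n
      two false true _ h _ rewrite h refl = s≤s z≤n
      two true false h _ _ rewrite h refl = s≤s z≤n
      two true true h _ h' rewrite h refl | h' refl = ≤-refl
      pt : ∀ y → ind (Dᶜ i (y ⊕ u)) + ind (Bᶜ m y) ≤ ind (Z (y ⊕ (v₀ ⊕ d m))) + ind (Dᶜ i (y ⊕ u) ∧ B (y ⊕ u ⊕ u))
      pt y = two (Dᶜ i (y ⊕ u)) (Bᶜ m y)
        (λ p → subst (_∈ Z) (group (y ∷ u ∷ v₀ ∷ d m ∷ d i ∷ []) (x₀ ∔ x₁ ∔ x₄ ∔ (x₁ ∔ (x₂ ∔ (x₃ ∔ x₄)))) (x₀ ∔ (x₂ ∔ x₃)) refl)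
                 (Z-closed (∧-trueʳ {D (y ⊕ u)} p) t))
        (λ p → ∧-trueʳ {B y} p)
        (λ p → subst (_∈ B) (sym (⊕-cancel y u)) (∧-trueˡ p))

    -- Only `u ⊕ u'` can be an edge at both vertices, so 2(|Dᶜ i| + f - |Z|) is at most |Dᶜ i| + 1.
    -- The other bounds turn this into 7f ≤ 6|Z| + 2, contrary to 7 * 28 > 6 * 32.
    acts-unique : ∀ {u u' i} → u ∈ B → u' ∈ B → Acts u i → Acts u' i → u ≡ u'
    acts-unique {u} {u'} {i} u∈ u'∈ t t' with u ≟ u'
    ... | yes e = e
    ... | no n = ⊥-elim (refute {ρ = f ∷ # Z ∷ # (Dᶜ i) ∷ # (λ e → Dᶜ i e ∧ B (e ⊕ u)) ∷ # (λ e → Dᶜ i e ∧ B (e ⊕ u')) ∷ # D ∷ q ∷ []}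
          (1 ⊗ y₂ ⊞ y₀ ≼ y₁ ⊞ y₃ by acts-bound {u} {i} t ∷ 1 ⊗ y₂ ⊞ y₀ ≼ y₁ ⊞ y₄ by acts-bound {u'} {i} t' ∷
           1 ⊗ y₃ ⊞ y₄ ≼ y₂ ⊞ $ 1 by at-most ∷ 1 ⊗ y₅ ≼ y₂ ⊞ 4 ⊠ y₁ by #D≤ i ∷ 1 ⊗ 5 ⊠ y₀ ≼ $ 1 ⊞ y₅ by #D≥ ∷
           6 ⊗ y₁ ≼ 32 ⊠ y₆ by #Z≤ ∷ 7 ⊗ 28 ⊠ y₆ ≼ y₀ by f≥ ∷ 3 ⊗ $ 1 ≼ y₆ by q≥1 ∷ []) refl)
      where
      open ≤-Reasoning
      two : ∀ a b b' {s} → (a ≡ true → b ≡ true → b' ≡ true → s ≡ true) → ind (a ∧ b) + ind (a ∧ b') ≤ ind a + ind s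
      two false _ _ _ = z≤n
      two true false false _ = z≤n
      two true false true _ = s≤s z≤n
      two true true false _ = s≤s z≤n
      two true true true h rewrite h refl refl refl = ≤-refl
      pt : ∀ e → ind (Dᶜ i e ∧ B (e ⊕ u)) + ind (Dᶜ i e ∧ B (e ⊕ u')) ≤ ind (Dᶜ i e) + ind (⁅ u ⊕ u' ⁆ e)
      pt e = two (Dᶜ i e) (B (e ⊕ u)) (B (e ⊕ u')) λ p x x' → same (unique (∧-trueˡ p) u∈ (subst (_∈ B) (⊕-comm e u) x) u'∈ (subst (_∈ B) (⊕-comm e u') x'))
        where
        same : u ≡ u' ⊎ u ≡ u' ⊕ e → ⌊ e ≟ (u ⊕ u') ⌋ ≡ true
        same (inj₁ eq) = ⊥-elim (n eq)
        same (inj₂ eq) = subst (λ t → ⌊ e ≟ t ⌋ ≡ true) (trans (group (u' ∷ e ∷ []) x₁ (x₀ ∔ x₁ ∔ x₀) refl) (cong (_⊕ u') (sym eq))) (≟-refl e)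
      at-most : # (λ e → Dᶜ i e ∧ B (e ⊕ u)) + # (λ e → Dᶜ i e ∧ B (e ⊕ u')) ≤ # (Dᶜ i) + 1
      at-most = begin
        # (λ e → Dᶜ i e ∧ B (e ⊕ u)) + # (λ e → Dᶜ i e ∧ B (e ⊕ u'))
          ≡⟨ sym (∑-+ (λ e → ind (Dᶜ i e ∧ B (e ⊕ u))) (λ e → ind (Dᶜ i e ∧ B (e ⊕ u')))) ⟩
        ∑ (λ e → ind (Dᶜ i e ∧ B (e ⊕ u)) + ind (Dᶜ i e ∧ B (e ⊕ u')))
          ≤⟨ ∑-mono pt ⟩
        ∑ (λ e → ind (Dᶜ i e) + ind (⁅ u ⊕ u' ⁆ e))
          ≡⟨ ∑-+ (λ e → ind (Dᶜ i e)) (λ e → ind (⁅ u ⊕ u' ⁆ e)) ⟩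
        # (Dᶜ i) + # ⁅ u ⊕ u' ⁆
          ≡⟨ cong (# (Dᶜ i) +_) (#⁅⁆ (u ⊕ u')) ⟩
        # (Dᶜ i) + 1 ∎

  -- The component of the far end is symmetric in the colour `m` of `y` and the colour `index` of
  -- the edge; hence it acts for both.
  record Link (m : Fin 5) (y : F₂^ r) : Set where
    field
      {e} : F₂^ r
      index : Fin 5
      e∈ : e ∈ D
      u∈ : y ⊕ e ∈ B
      type : (y ⊕ e) ⊕ (v₀ ⊕ (d m ⊕ d index)) ∈ Z

    acts-index : Acts (y ⊕ e) index
    acts-index = m , type

    acts-m : Acts (y ⊕ e) m
    acts-m = index , subst (λ t → (y ⊕ e) ⊕ (v₀ ⊕ t) ∈ Z) (⊕-comm (d m) (d index)) type

  opaque
    link : ∀ {m y} → y ∈ Bᶜ m → y ≢ o → Link m y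
    link {m} {y} p n with cover y (∧-trueˡ p) n
    ... | e , e∈ , y'∈ with colour e∈
    ... | i , z∈ = record { index = i ; e∈ = e∈ ; u∈ = y'∈ ; type =
            subst (_∈ Z) (group (y ∷ v₀ ∷ d m ∷ e ∷ d i ∷ []) (x₀ ∔ (x₁ ∔ x₂) ∔ (x₃ ∔ x₄)) (x₀ ∔ x₃ ∔ (x₁ ∔ (x₂ ∔ x₄))) refl)
              (Z-closed (∧-trueʳ {B y} p) z∈) }

    chosen : ∀ m → ∃[ y ] Link m y
    chosen m with #-pos {X = Bᶜ m ─ o} (derive {ρ = # (Bᶜ m ─ o) ∷ # (Bᶜ m) ∷ f ∷ q ∷ []} ($ 1 ≼ y₀) 1
        (1 ⊗ y₁ ≼ y₀ ⊞ $ 1 by #-─ (Bᶜ m) o ∷ 1 ⊗ y₂ ≼ y₁ by f≤#Bᶜ m ∷ 1 ⊗ 28 ⊠ y₃ ≼ y₂ by f≥ ∷ 2 ⊗ $ 1 ≼ y₃ by q≥1 ∷ []) refl)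
    ... | y , p = y , link (proj₁ (─-∈ {X = Bᶜ m} p)) (proj₂ (─-∈ {X = Bᶜ m} p))

  opposite : Fin 5 → F₂^ r
  opposite m = proj₁ (chosen m) ⊕ Link.e (proj₂ (chosen m))

  index : Fin 5 → Fin 5
  index m = Link.index (proj₂ (chosen m))

  opaque
    -- Both `opposite m` and `opposite (index m)` act for the colour `index m`, so they coincide;
    -- comparing their components gives the claim.
    index-involutive : ∀ m → index (index m) ≡ m
    index-involutive m = δ-injective (sym (⊕≡𝟎⇒≡ (Z-one 𝟎∈Z (subst (_∈ Z)
        (trans (group (opposite m ∷ v₀ ∷ d m ∷ d (index m) ∷ d (index (index m)) ∷ []) (x₀ ∔ (x₁ ∔ (x₂ ∔ x₃)) ∔ (x₀ ∔ (x₁ ∔ (x₃ ∔ x₄)))) (nul ∔ (x₂ ∔ x₄)) refl)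
               (cong (𝟎 ⊕_) (sym (ι-⊕ (δ m) (δ (index (index m)))))))
        (Z-closed (Link.type (proj₂ (chosen m)))
          (subst (λ t → t ⊕ (v₀ ⊕ (d (index m) ⊕ d (index (index m)))) ∈ Z) (sym same) (Link.type (proj₂ (chosen (index m))))))))))
      where
      same : opposite m ≡ opposite (index m)
      same = acts-unique {i = index m} (Link.u∈ (proj₂ (chosen m))) (Link.u∈ (proj₂ (chosen (index m))))
               (Link.acts-index (proj₂ (chosen m))) (Link.acts-m (proj₂ (chosen (index m))))

    -- At a fixed colour the two generators cancel, so the vertex lies in the coset of `Z` through
    -- `v₀`. It then acts for every `i`, with `m` equal to `i`.
    hub : ∃[ u ] u ∈ B × (∀ i → Acts u i)
    hub with involution-fixes index index-involutive
    ... | m , e = opposite m , Link.u∈ (proj₂ (chosen m)) , λ i → i , subst (_∈ Z)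
            (trans (cong (λ t → opposite m ⊕ (v₀ ⊕ (d m ⊕ d t))) e) (group (opposite m ∷ v₀ ∷ d m ∷ d i ∷ []) (x₀ ∔ (x₁ ∔ (x₂ ∔ x₂))) (x₀ ∔ (x₁ ∔ (x₃ ∔ x₃))) refl))
            (Link.type (proj₂ (chosen m)))

    -- The edge found at a typical vertex of colour `m` leads to a vertex that acts for `m`. So does
    -- `u`, hence the edge leads to `u`.
    hub-degree : ∀ {u} → u ∈ B → (∀ i → Acts u i) → # Typical ≤ # (Neighbours U u) + 1
    hub-degree {u} u∈ acts = begin
      # Typical                                             ≤⟨ ∑-mono pt ⟩
      ∑ (λ y → ind (Neighbours U u y) + ind (⁅ o ⁆ y))       ≡⟨ ∑-+ (λ y → ind (Neighbours U u y)) (λ y → ind (⁅ o ⁆ y)) ⟩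
      # (Neighbours U u) + # ⁅ o ⁆                           ≡⟨ cong (# (Neighbours U u) +_) (#⁅⁆ o) ⟩
      # (Neighbours U u) + 1                                ∎
      where
      open ≤-Reasoning
      adjacent : ∀ {y} → y ∈ Typical → y ≢ o → u ⊕ y ∈ D
      adjacent {y} p n with typical p
      ... | m , v∈ with link {m} {y} (∧-intro (typical-B p) (subst (_∈ Z) (group (y ∷ d m ∷ v₀ ∷ []) (x₀ ∔ x₁ ∔ x₂) (x₀ ∔ (x₂ ∔ x₁)) refl) (Z-sum v∈ (proj₂ v₀∈C)))) n
      ... | l = subst (_∈ D) (trans (group (y ∷ Link.e l ∷ []) x₁ (x₀ ∔ x₁ ∔ x₀) refl) (cong (_⊕ y) (acts-unique {i = m} (Link.u∈ l) u∈ (Link.acts-m l) (acts m)))) (Link.e∈ l)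
      pt : ∀ y → ind (Typical y) ≤ ind (Neighbours U u y) + ind (⁅ o ⁆ y)
      pt y with Typical y in p | y ≟ o
      ... | false | _ = z≤n
      ... | true | yes _ = m≤n+m 1 _
      ... | true | no n = ≤-trans (ind-true (∧-intro (typical-B p) (adjacent p n))) (m≤m+n (ind (B y ∧ D (u ⊕ y))) 0)

    hub-large : ∀ {u} → u ∈ B → (∀ i → Acts u i) → 2 ^ r < 4 * # (Neighbours U u)
    hub-large {u} u∈ acts = subst (_< 4 * # (Neighbours U u)) (sym 2^r≡)
      (derive {ρ = q ∷ f ∷ # Typical ∷ # (Neighbours U u) ∷ []} ($ 1 ⊞ 512 ⊠ y₀ ≼ 4 ⊠ y₃) 1
        (4 ⊗ y₂ ≼ y₃ ⊞ $ 1 by hub-degree u∈ acts ∷ 4 ⊗ 5 ⊠ y₁ ≼ y₂ by 5f≤#Typical ∷ 20 ⊗ 28 ⊠ y₀ ≼ y₁ by f≥ ∷ 5 ⊗ $ 1 ≼ y₀ by q≥1 ∷ []) refl)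

  pentagon-star : ∃[ u ] u ∈ B × (∀ x → x ∈ B → x ≢ o → x ≢ u → u ⊕ x ∈ D)
  pentagon-star = u , proj₁ (proj₂ hub) , joins
    where
    u : F₂^ r
    u = proj₁ hub
    joins : ∀ x → x ∈ B → x ≢ o → x ≢ u → u ⊕ x ∈ D
    joins x x∈ x≢o x≢u = let (e , e∈ , x'∈) = cover x x∈ x≢o in
      subst (_∈ D) (trans (group (x ∷ e ∷ []) x₁ (x₀ ∔ x₁ ∔ x₀) refl)
        (cong (_⊕ x) (hub-meets-all-edges U sf (proj₁ (proj₂ hub)) (hub-large (proj₁ (proj₂ hub)) (proj₂ (proj₂ hub))) x∈ e∈ x'∈ x≢u))) e∈

-- Large sets with few isolated vertices are stars

module _ {B D : Subset r} (U : UniqueSums B D) (o : F₂^ r)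
  (cover : ∀ x → x ∈ B → x ≢ o → ∃[ e ] e ∈ D × x ⊕ e ∈ B) where
  open UniqueSums U

  #B≤1+2#D : # B ≤ 1 + 2 * # D
  #B≤1+2#D = begin
    # B
      ≤⟨ ∑-mono pt ⟩
    ∑ (λ x → ind (⁅ o ⁆ x) + # (λ e → B x ∧ (D e ∧ B (x ⊕ e))))
      ≡⟨ ∑-+ (λ x → ind (⁅ o ⁆ x)) (λ x → # (λ e → B x ∧ (D e ∧ B (x ⊕ e)))) ⟩
    # ⁅ o ⁆ + ∑ (λ x → # (λ e → B x ∧ (D e ∧ B (x ⊕ e))))
      ≡⟨ cong₂ _+_ (#⁅⁆ o) (∑-swap (λ x e → ind (B x ∧ (D e ∧ B (x ⊕ e))))) ⟩
    1 + ∑ (λ e → # (λ x → B x ∧ (D e ∧ B (x ⊕ e))))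
      ≤⟨ s≤s (∑-mono pt') ⟩
    1 + ∑ (λ e → 2 * ind (D e))
      ≡⟨ cong suc (∑-* 2 (λ e → ind (D e))) ⟩
    1 + 2 * # D ∎
    where
    open ≤-Reasoning
    pt : ∀ x → ind (B x) ≤ ind (⁅ o ⁆ x) + # (λ e → B x ∧ (D e ∧ B (x ⊕ e)))
    pt x with B x in p | x ≟ o
    ... | false | _ = z≤n
    ... | true | yes _ = s≤s z≤n
    ... | true | no n with cover x p n
    ...   | e , e∈ , x'∈ = ∈⇒#-pos {X = λ e → D e ∧ B (x ⊕ e)} (∧-intro e∈ x'∈)
    pt' : ∀ e → # (λ x → B x ∧ (D e ∧ B (x ⊕ e))) ≤ 2 * ind (D e)
    pt' e with D e in e∈
    ... | false = ≤-reflexive (#-empty {X = λ x → B x ∧ false} λ x p → true≢false (∧-trueʳ {B x} p) refl)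
    ... | true with represented e∈
    ...   | a , a∈ , a'∈ = ≤-trans (∑-mono ends) (≤-reflexive (trans (∑-+ (λ x → ind (⁅ a ⁆ x)) (λ x → ind (⁅ a ⊕ e ⁆ x))) (cong₂ _+_ (#⁅⁆ a) (#⁅⁆ (a ⊕ e)))))
      where
      ends : ∀ x → ind (B x ∧ B (x ⊕ e)) ≤ ind (⁅ a ⁆ x) + ind (⁅ a ⊕ e ⁆ x)
      ends x with B x ∧ B (x ⊕ e) in p
      ... | false = z≤n
      ... | true with unique e∈ (∧-trueˡ p) (∧-trueʳ {B x} p) a∈ a'∈
      ...   | inj₁ q rewrite q | ≟-refl a = s≤s z≤n
      ...   | inj₂ q rewrite q | ≟-refl (a ⊕ e) = m≤n+m 1 _

  unique-sums-star : 11 * 2 ^ r + 145 ≤ 36 * # B → ∃[ u ] u ∈ B × (∀ x → x ∈ B → x ≢ o → x ≢ u → u ⊕ x ∈ D)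
  unique-sums-star large = conclude (odd-relation⊎functional D)
    where
    sf : SumFree₂ D
    sf = unique-sums-sum-free U large

    dense : 2 ^ r < 8 * # D
    dense = derive {ρ = 2 ^ r ∷ # B ∷ # D ∷ []} ($ 1 ⊞ y₀ ≼ 8 ⊠ y₂) 9
      (36 ⊗ y₁ ≼ $ 1 ⊞ 2 ⊠ y₂ by #B≤1+2#D ∷ 1 ⊗ 11 ⊠ y₀ ⊞ $ 145 ≼ 36 ⊠ y₁ by large ∷ []) refl

    -- No edge contains `o`, so removing it keeps all edges and completes the cover; the price of 36
    -- turns 145 into 109.
    isolated-o : (φ : F₂^ r → Bool) → Additive φ → (∀ d → d ∈ D → φ d ≡ true) → ¬ (∃[ e ] e ∈ (λ e → D e ∧ B (o ⊕ e))) →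
                 ∃[ u ] u ∈ B × (∀ x → x ∈ B → x ≢ o → x ≢ u → u ⊕ x ∈ D)
    isolated-o φ φ-add φ-D none =
      let (u , u∈ , h) = bipartite-star φ φ-add X D UX (φ-D _) covX large'
      in u , proj₁ (─-∈ {X = B} u∈) , λ x x∈ n n' → h x (∈-─ {X = B} x∈ n) n'
      where
      X : Subset r
      X = B ─ o
      not-o : ∀ {d a} → d ∈ D → a ∈ B → a ⊕ d ∈ B → a ⊕ d ≢ o
      not-o {d} {a} d∈ a∈ _ refl = none (d , ∧-intro d∈ (subst (_∈ B) (sym (⊕-cancel a d)) a∈))
      not-o' : ∀ {d a} → d ∈ D → a ⊕ d ∈ B → a ≢ o
      not-o' {d} d∈ p refl = none (d , ∧-intro d∈ p)
      UX : UniqueSums X D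
      UX = record
        { represented = λ d∈ → let (a , a∈ , a'∈) = represented d∈ in a , ∈-─ {X = B} a∈ (not-o' d∈ a'∈) , ∈-─ {X = B} a'∈ (not-o d∈ a∈ a'∈)
        ; unique = λ d∈ p p' q q' → unique d∈ (proj₁ (─-∈ {X = B} p)) (proj₁ (─-∈ {X = B} p')) (proj₁ (─-∈ {X = B} q)) (proj₁ (─-∈ {X = B} q')) }
      covX : Cover X D
      covX x p = let (x∈ , n) = ─-∈ {X = B} p
                     (e , e∈ , x'∈) = cover x x∈ n
                 in e , e∈ , ∈-─ {X = B} x'∈ (not-o e∈ x∈ x'∈)
      large' : 11 * 2 ^ r + 109 ≤ 36 * # X
      large' = derive {ρ = 2 ^ r ∷ # B ∷ # X ∷ []} (11 ⊠ y₀ ⊞ $ 109 ≼ 36 ⊠ y₂) 1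
        (1 ⊗ 11 ⊠ y₀ ⊞ $ 145 ≼ 36 ⊠ y₁ by large ∷ 36 ⊗ y₁ ≼ y₂ ⊞ $ 1 by #-─ B o ∷ []) refl

    bipartite : (φ : F₂^ r → Bool) → Additive φ → (∀ d → d ∈ D → φ d ≡ true) → ∃[ u ] u ∈ B × (∀ x → x ∈ B → x ≢ o → x ≢ u → u ⊕ x ∈ D)
    bipartite φ φ-add φ-D with any? (λ e → e ∈? (λ e → D e ∧ B (o ⊕ e)))
    ... | no none = isolated-o φ φ-add φ-D none
    ... | yes (e , p) =
      let (u , u∈ , h) = bipartite-star φ φ-add B D U (φ-D _) cov
            (≤-trans (+-monoʳ-≤ (11 * 2 ^ r) (≤ᵇ⇒≤ 109 145 tt)) large)
      in u , u∈ , λ x x∈ _ n → h x x∈ n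
      where
      cov : Cover B D
      cov x x∈ with x ≟ o
      ... | yes refl = e , ∧-trueˡ p , ∧-trueʳ {D e} p
      ... | no n = cover x x∈ n

    conclude : OddRelation D ⊎ OddFunctional D → ∃[ u ] u ∈ B × (∀ x → x ∈ B → x ≢ o → x ≢ u → u ⊕ x ∈ D)
    conclude (inj₁ odd) = Pentagon.pentagon-star U sf o cover large (odd-relation⇒five-cycle D dense odd)
    conclude (inj₂ (φ , φ-add , φ-D)) = bipartite φ φ-add φ-D

-- Minimal 1-saturating sets

with-zero : Subset r → Subset r
with-zero A x = A x ∨ ⌊ x ≟ 𝟎 ⌋

with-zero∈ : {A : Subset r} {x : F₂^ r} → x ∈ with-zero A → x ∈ A ⊎ x ≡ 𝟎
with-zero∈ {A = A} {x} p with ∨-true {A x} p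
... | inj₁ q = inj₁ q
... | inj₂ q = inj₂ (≟-true q)

∈with-zero : (A : Subset r) {x : F₂^ r} → x ∈ A → x ∈ with-zero A
∈with-zero _ p = ∨-introˡ p

𝟎∈with-zero : (A : Subset r) → 𝟎 ∈ with-zero A
𝟎∈with-zero {r} A = ∨-introʳ {A 𝟎} (≟-refl {r} 𝟎)

-- For non-zero `d`, `meet` contains both ends of every pair, so a single pair means two elements;
-- as the number is even, the bounds one and two suffice.
uniqueSums : Subset r → Subset r
uniqueSums B d = (# (meet B d) ≤ᵇ 2) ∧ ((1 ≤ᵇ # (meet B d)) ∧ not ⌊ d ≟ 𝟎 ⌋)

uniqueSums-unique : (B : Subset r) → UniqueSums B (uniqueSums B)
uniqueSums-unique {r} B = record { represented = represented ; unique = unique }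
  where
  represented : ∀ {d} → d ∈ uniqueSums B → ∃[ a ] a ∈ B × a ⊕ d ∈ B
  represented {d} p =
    let (_ , q) = ∧-true {# (meet B d) ≤ᵇ 2} p
        (a , m) = #-pos {X = meet B d} (≤ᵇ⇒≤ 1 _ (T-true (∧-trueˡ {1 ≤ᵇ # (meet B d)} q)))
    in a , ∧-trueˡ m , ∧-trueʳ {B a} m
  unique : ∀ {d x y} → d ∈ uniqueSums B → x ∈ B → x ⊕ d ∈ B → y ∈ B → y ⊕ d ∈ B → x ≡ y ⊎ x ≡ y ⊕ d
  unique {d} {x} {y} p x∈ x'∈ y∈ y'∈ with x ≟ y | x ≟ (y ⊕ d)
  ... | yes e | _ = inj₁ e
  ... | no _ | yes e = inj₂ e
  ... | no n | no n' = ⊥-elim (<⇒≱ (s≤s (s≤s (s≤s z≤n))) (≤-trans three (≤ᵇ⇒≤ _ 2 (T-true (∧-trueˡ {# (meet B d) ≤ᵇ 2} p)))))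
    where
    d≢𝟎 : d ≢ 𝟎
    d≢𝟎 refl = true≢false (∧-trueʳ {1 ≤ᵇ # (meet B d)} (∧-trueʳ {# (meet B d) ≤ᵇ 2} p)) (cong not (≟-refl d))
    y≢y' : y ≢ y ⊕ d
    y≢y' e = d≢𝟎 (trans (group (y ∷ d ∷ []) x₁ (x₀ ∔ (x₀ ∔ x₁)) refl) (trans (cong (y ⊕_) (sym e)) (⊕-self y)))
    three : 3 ≤ # (meet B d)
    three = ≤-trans (+-mono-≤ (ind-true (∧-intro {B x} x∈ x'∈)) (+-mono-≤ (ind-true (∧-intro {B y} y∈ y'∈))
              (+-monoˡ-≤ 0 (ind-true (∧-intro {B (y ⊕ d)} y'∈ (subst (_∈ B) (sym (⊕-cancel y d)) y∈))))))
            (lsum≤∑ (λ x → ind (meet B d x)) {x ∷ y ∷ y ⊕ d ∷ []} ((n ∷ n' ∷ []) ∷ (y≢y' ∷ []) ∷ [] ∷ []))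

∈uniqueSums : {B : Subset r} {d a : F₂^ r} → d ≢ 𝟎 → a ∈ B → a ⊕ d ∈ B → (∀ x → x ∈ B → x ⊕ d ∈ B → x ≡ a ⊎ x ≡ a ⊕ d) → d ∈ uniqueSums B
∈uniqueSums {B = B} {d} {a} n a∈ a'∈ only = ∧-intro (T⇒true (≤⇒≤ᵇ two))
  (∧-intro (T⇒true (≤⇒≤ᵇ (∈⇒#-pos {X = meet B d} {a} (∧-intro a∈ a'∈)))) (cong not (≟-false n)))
  where
  pt : ∀ x → ind (meet B d x) ≤ ind (⁅ a ⁆ x) + ind (⁅ a ⊕ d ⁆ x)
  pt x with meet B d x in p
  ... | false = z≤n
  ... | true with only x (∧-trueˡ p) (∧-trueʳ {B x} p)
  ...   | inj₁ q rewrite q | ≟-refl a = s≤s z≤n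
  ...   | inj₂ q rewrite q | ≟-refl (a ⊕ d) = m≤n+m 1 _
  two : # (meet B d) ≤ 2
  two = ≤-trans (∑-mono pt) (≤-reflexive (trans (∑-+ (λ x → ind (⁅ a ⁆ x)) (λ x → ind (⁅ a ⊕ d ⁆ x))) (cong₂ _+_ (#⁅⁆ a) (#⁅⁆ (a ⊕ d)))))

_∈2?_ : (y : F₂^ r) (X : Subset r) → Dec (y ∈2 X)
y ∈2? X with any? (λ x → x ∈? (λ x → X x ∧ X (x ⊕ y)))
... | yes (x , p) = yes (x , x ⊕ y , ∧-trueˡ p , ∧-trueʳ {X x} p , group (x ∷ y ∷ []) x₁ (x₀ ∔ (x₀ ∔ x₁)) refl)
... | no none = no λ { (a , b , a∈ , b∈ , refl) → none (a , ∧-intro a∈ (subst (_∈ X) (group (a ∷ b ∷ []) x₁ (x₀ ∔ (x₀ ∔ x₁)) refl) b∈)) }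

ShiftedSumFree : Subset r → Set
ShiftedSumFree {r} A = ∃[ S ] ∃[ s ] (MaximalSumFree S × (s ∈ S ⊎ s ≡ 𝟎) ×
  (∀ (x : F₂^ r) → x ∈ A ⇔ (¬ (x ≡ 𝟎) × (s ⊕ x ∈ S ⊎ s ⊕ x ≡ 𝟎))))

module _ {r : ℕ} (A : Subset r) (𝟎∉A : ¬ 𝟎 ∈ A) (large : 11 * 2 ^ r + 109 ≤ 36 * # A) where

  A-nonempty : ∃[ a ] a ∈ A
  A-nonempty = #-pos {X = A} (derive {ρ = 2 ^ r ∷ # A ∷ []} ($ 1 ≼ y₁) 36 (1 ⊗ 11 ⊠ y₀ ⊞ $ 109 ≼ 36 ⊠ y₁ by large ∷ []) refl)

  B : Subset r
  B = with-zero A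

  -- From minimal saturating sets to sum-free sets

  module _ (minimal : MinimalOneSaturating A) where

    saturating : ∀ y → y ∈ A ⊎ y ∈2 A
    saturating = proj₂ (proj₁ minimal)

    sum-of-two : ∀ y → ∃[ p ] p ∈ B × p ⊕ y ∈ B
    sum-of-two y with saturating y
    ... | inj₁ y∈ = 𝟎 , 𝟎∈with-zero A , ∈with-zero A (subst (_∈ A) (sym (⊕-identityˡ y)) y∈)
    ... | inj₂ (a , b , a∈ , b∈ , refl) = a , ∈with-zero A a∈ , ∈with-zero A (subst (_∈ A) (group (a ∷ b ∷ []) x₁ (x₀ ∔ (x₀ ∔ x₁)) refl) b∈)

    essential : ∀ {a} → a ∈ A → ∃[ y ] ¬ y ∈ (A ─ a) × ¬ y ∈2 (A ─ a)
    essential {a} a∈ with all⊎any {P = λ y → y ∈ (A ─ a) ⊎ y ∈2 (A ─ a)} {Q = λ y → ¬ y ∈ (A ─ a) × ¬ y ∈2 (A ─ a)} decide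
      where
      decide : ∀ y → (y ∈ (A ─ a) ⊎ y ∈2 (A ─ a)) ⊎ (¬ y ∈ (A ─ a) × ¬ y ∈2 (A ─ a))
      decide y with y ∈? (A ─ a) | y ∈2? (A ─ a)
      ... | yes p | _ = inj₁ (inj₁ p)
      ... | no _ | yes p = inj₁ (inj₂ p)
      ... | no n | no n' = inj₂ (n , n')
    ... | inj₂ q = q
    ... | inj₁ sat = ⊥-elim (proj₂ minimal (A ─ a) ((λ x p → proj₁ (─-∈ {X = A} p)) , a , a∈ , λ p → proj₂ (─-∈ {X = A} p) refl)
                       ((λ p → 𝟎∉A (proj₁ (─-∈ {X = A} p))) , sat))

    -- An element `y` that is lost with `a` can be written as a sum of two elements of `B` only by
    -- means of `a`, so it is an edge at `a`. It is not 0, which stays the double of any remaining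
    -- element.
    edge : ∀ {a} → a ∈ A → ∃[ d ] d ∈ uniqueSums B × a ⊕ d ∈ B
    edge {a} a∈ with essential a∈
    ... | y , y∉ , y∉2 = y , ∈uniqueSums y≢𝟎 (∈with-zero A a∈) a'∈ only , a'∈
      where
      another : ∃[ b ] b ∈ (A ─ a)
      another = #-pos {X = A ─ a} (derive {ρ = 2 ^ r ∷ # A ∷ # (A ─ a) ∷ []} ($ 1 ≼ y₂) 36
        (1 ⊗ 11 ⊠ y₀ ⊞ $ 109 ≼ 36 ⊠ y₁ by large ∷ 36 ⊗ y₁ ≼ y₂ ⊞ $ 1 by #-─ A a ∷ []) refl)
      y≢𝟎 : y ≢ 𝟎
      y≢𝟎 e = y∉2 (proj₁ another , proj₁ another , proj₂ another , proj₂ another , trans e (sym (⊕-self (proj₁ another))))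
      swap : ∀ {x} → x ⊕ y ≡ a → x ≡ a ⊕ y
      swap {x} refl = sym (⊕-cancel x y)
      only : ∀ x → x ∈ B → x ⊕ y ∈ B → x ≡ a ⊎ x ≡ a ⊕ y
      only x x∈ x'∈ with x ≟ a | (x ⊕ y) ≟ a
      ... | yes e | _ = inj₁ e
      ... | no _ | yes e = inj₂ (swap e)
      ... | no n | no n' with with-zero∈ {A = A} x∈ | with-zero∈ {A = A} x'∈
      ...   | inj₁ p | inj₁ p' = ⊥-elim (y∉2 (x , x ⊕ y , ∈-─ {X = A} p n , ∈-─ {X = A} p' n' , group (x ∷ y ∷ []) x₁ (x₀ ∔ (x₀ ∔ x₁)) refl))
      ...   | inj₁ p | inj₂ e = ⊥-elim (y∉ (subst (_∈ (A ─ a)) (⊕≡𝟎⇒≡ e) (∈-─ {X = A} p n)))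
      ...   | inj₂ refl | inj₁ p' = ⊥-elim (y∉ (subst (_∈ (A ─ a)) (⊕-identityˡ y) (∈-─ {X = A} p' n')))
      ...   | inj₂ refl | inj₂ e = ⊥-elim (y≢𝟎 (trans (sym (⊕-identityˡ y)) e))
      a'∈ : a ⊕ y ∈ B
      a'∈ with sum-of-two y
      ... | p , p∈ , p'∈ with only p p∈ p'∈
      ...   | inj₁ refl = p'∈
      ...   | inj₂ refl = p∈

    cover : ∀ x → x ∈ B → x ≢ 𝟎 → ∃[ e ] e ∈ uniqueSums B × x ⊕ e ∈ B
    cover x p n with with-zero∈ {A = A} p
    ... | inj₁ x∈ = edge x∈
    ... | inj₂ e = ⊥-elim (n e)

    large-B : 11 * 2 ^ r + 145 ≤ 36 * # B
    large-B = derive {ρ = 2 ^ r ∷ # A ∷ # ⁅ 𝟎 {r} ⁆ ∷ # B ∷ []} (11 ⊠ y₀ ⊞ $ 145 ≼ 36 ⊠ y₃) 1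
      (1 ⊗ 11 ⊠ y₀ ⊞ $ 109 ≼ 36 ⊠ y₁ by large ∷
       36 ⊗ y₁ ⊞ y₂ ≼ y₃ by disjoint-bound B A ⁅ 𝟎 ⁆ (λ x → ∈with-zero A) (λ x p → ∨-introʳ {A x} p) (λ { x p q → 𝟎∉A (subst (_∈ A) (≟-true q) p) }) ∷
       36 ⊗ $ 1 ≼ y₂ by ≤-reflexive (sym (#⁅⁆ (𝟎 {r}))) ∷ []) refl

    shifted : ∃[ u ] u ∈ B × (∀ x → x ∈ B → x ≢ 𝟎 → x ≢ u → u ⊕ x ∈ uniqueSums B) → ShiftedSumFree A
    shifted (u , u∈ , joins) = S , u , (sum-free , maximal) , u-cases , λ x → mk⇔ (to x) (from x)
      where
      open UniqueSums (uniqueSums-unique B)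
      S : Subset r
      S = (λ x → B (x ⊕ u)) ─ 𝟎
      S∈ : ∀ {x} → x ∈ S → x ⊕ u ∈ B × x ≢ 𝟎
      S∈ p = ─-∈ {X = λ x → B (x ⊕ u)} p
      ∈S : ∀ {x} → x ⊕ u ∈ B → x ≢ 𝟎 → x ∈ S
      ∈S p n = ∈-─ {X = λ x → B (x ⊕ u)} p n
      shift≢ : ∀ {x} → x ≢ 𝟎 → x ⊕ u ≢ u
      shift≢ {x} n e = n (trans (sym (⊕-cancel x u)) (trans (cong (_⊕ u) e) (⊕-self u)))
      unique-if : ∀ {x} → x ∈ S → x ⊕ u ≢ 𝟎 → x ∈ uniqueSums B
      unique-if {x} p n = subst (_∈ uniqueSums B) (group (x ∷ u ∷ []) (x₁ ∔ (x₀ ∔ x₁)) x₀ refl) (joins (x ⊕ u) (proj₁ (S∈ p)) n (shift≢ (proj₂ (S∈ p))))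
      -- The sum `a ⊕ b` would join `a ⊕ u` to `b ⊕ u`, and also `u` to `a ⊕ b ⊕ u`.
      no-sum : ∀ {a b} → a ∈ S → b ∈ S → a ⊕ b ∈ uniqueSums B → a ⊕ b ⊕ u ∈ B → ⊥
      no-sum {a} {b} p q m c with unique m (proj₁ (S∈ p)) (subst (_∈ B) (group (a ∷ b ∷ u ∷ []) (x₁ ∔ x₂) (x₀ ∔ x₂ ∔ (x₀ ∔ x₁)) refl) (proj₁ (S∈ q)))
                                        u∈ (subst (_∈ B) (⊕-comm (a ⊕ b) u) c)
      ... | inj₁ e = shift≢ (proj₂ (S∈ p)) e
      ... | inj₂ e = shift≢ (proj₂ (S∈ q)) (trans (group (a ∷ b ∷ u ∷ []) (x₁ ∔ x₂) (x₀ ∔ x₁ ∔ (x₀ ∔ x₂)) refl)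
                       (trans (cong (a ⊕ b ⊕_) e) (group (a ∷ b ∷ u ∷ []) (x₀ ∔ x₁ ∔ (x₂ ∔ (x₀ ∔ x₁))) x₂ refl)))
      sum-free : SumFree S
      -- The element `u` of `S` corresponds to the possibly isolated 0 and need not be a unique sum.
      -- If `y` is `u`, the relation is read as `a = y ⊕ b` instead; if `a` is `u` too, then `b`
      -- would be 0.
      sum-free y y∈ (a , b , a∈ , b∈ , refl) = cases ((a ⊕ b ⊕ u) ≟ 𝟎) ((a ⊕ u) ≟ 𝟎)
        where
        a≡ : a ≡ a ⊕ b ⊕ b
        a≡ = sym (⊕-cancel a b)
        cases : Dec (a ⊕ b ⊕ u ≡ 𝟎) → Dec (a ⊕ u ≡ 𝟎) → ⊥
        cases (no n) _ = no-sum a∈ b∈ (unique-if y∈ n) (proj₁ (S∈ y∈))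
        cases (yes e) (yes e') = proj₂ (S∈ b∈) (trans (group (a ∷ b ∷ u ∷ []) x₁ (x₀ ∔ x₁ ∔ x₂ ∔ (x₀ ∔ x₂)) refl) (trans (cong₂ _⊕_ e e') (⊕-self 𝟎)))
        cases (yes e) (no n') = no-sum y∈ b∈ (subst (_∈ uniqueSums B) a≡ (unique-if a∈ n')) (subst (λ t → t ⊕ u ∈ B) a≡ (proj₁ (S∈ a∈)))
      -- Write `t` as a sum of two elements of `B` and translate both by `u`. If neither becomes 0,
      -- `t` is a sum of two elements of `S`; if exactly one does, `t` lies in `S`.
      maximal : ∀ (T : Subset r) → S ⊆ T → SumFree T → T ⊆ S
      maximal T S⊆T T-free t t∈ with sum-of-two t
      ... | p , p∈ , p'∈ with (p ⊕ u) ≟ 𝟎 | (p ⊕ t ⊕ u) ≟ 𝟎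
      ...   | no n | no n' = ⊥-elim (T-free t t∈ (p ⊕ u , p ⊕ t ⊕ u ,
                S⊆T _ (∈S (subst (_∈ B) (sym (⊕-cancel p u)) p∈) n) , S⊆T _ (∈S (subst (_∈ B) (sym (⊕-cancel (p ⊕ t) u)) p'∈) n') ,
                group (p ∷ t ∷ u ∷ []) x₁ (x₀ ∔ x₂ ∔ (x₀ ∔ x₁ ∔ x₂)) refl))
      ...   | yes e | no n' = ∈S (subst (_∈ B) (trans (cong (_⊕ t) (⊕≡𝟎⇒≡ e)) (⊕-comm u t)) p'∈)
                (λ e' → n' (trans (group (p ∷ t ∷ u ∷ []) (x₀ ∔ x₁ ∔ x₂) (x₀ ∔ x₂ ∔ x₁) refl) (trans (cong₂ _⊕_ e e') (⊕-self 𝟎))))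
      ...   | no n | yes e' = ∈S (subst (_∈ B) (⊕≡𝟎⇒≡ (trans (group (p ∷ t ∷ u ∷ []) (x₀ ∔ (x₁ ∔ x₂)) (x₀ ∔ x₁ ∔ x₂) refl) e')) p∈)
                (λ e'' → n (trans (group (p ∷ t ∷ u ∷ []) (x₀ ∔ x₂) (x₀ ∔ x₁ ∔ x₂ ∔ x₁) refl) (trans (cong₂ _⊕_ e' e'') (⊕-self 𝟎))))
      ...   | yes e | yes e' = ⊥-elim (T-free t t∈ (t , t , t∈ , t∈ , trans t≡𝟎 (sym (⊕-self t))))
        where
        t≡𝟎 : t ≡ 𝟎
        t≡𝟎 = trans (group (p ∷ t ∷ u ∷ []) x₁ (x₀ ∔ x₂ ∔ (x₀ ∔ x₁ ∔ x₂)) refl) (trans (cong₂ _⊕_ e e') (⊕-self 𝟎))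
      S₀ : ∀ {x} → x ⊕ u ∈ B → Dec (x ≡ 𝟎) → x ∈ S ⊎ x ≡ 𝟎
      S₀ _ (yes e) = inj₂ e
      S₀ p (no n) = inj₁ (∈S p n)
      u-cases : u ∈ S ⊎ u ≡ 𝟎
      u-cases = S₀ (subst (_∈ B) (sym (⊕-self u)) (𝟎∈with-zero A)) (u ≟ 𝟎)
      to : ∀ x → x ∈ A → ¬ (x ≡ 𝟎) × (u ⊕ x ∈ S ⊎ u ⊕ x ≡ 𝟎)
      to x x∈ = (λ { refl → 𝟎∉A x∈ }) ,
                S₀ (subst (_∈ B) (group (u ∷ x ∷ []) x₁ (x₀ ∔ x₁ ∔ x₀) refl) (∈with-zero A x∈)) ((u ⊕ x) ≟ 𝟎)
      nonzero : ∀ {x} → x ∈ B → ¬ (x ≡ 𝟎) → x ∈ A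
      nonzero {x} p n with with-zero∈ {A = A} p
      ... | inj₁ x∈ = x∈
      ... | inj₂ e = ⊥-elim (n e)
      from : ∀ x → ¬ (x ≡ 𝟎) × (u ⊕ x ∈ S ⊎ u ⊕ x ≡ 𝟎) → x ∈ A
      from x (n , inj₁ p) = nonzero (subst (_∈ B) (group (u ∷ x ∷ []) (x₀ ∔ x₁ ∔ x₀) x₁ refl) (proj₁ (S∈ p))) n
      from x (n , inj₂ e) = nonzero (subst (_∈ B) (⊕≡𝟎⇒≡ e) u∈) n

    minimal⇒shifted : ShiftedSumFree A
    minimal⇒shifted = shifted (unique-sums-star (uniqueSums-unique B) 𝟎 cover large-B)

  -- From sum-free sets to minimal saturating sets

  shifted⇒minimal : ShiftedSumFree A → MinimalOneSaturating A
  shifted⇒minimal (S , s , (sum-free , maximal) , s-case , char) = (𝟎∉A , sat) , min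
    where
    to : ∀ {x} → x ∈ A → ¬ (x ≡ 𝟎) × (s ⊕ x ∈ S ⊎ s ⊕ x ≡ 𝟎)
    to {x} = Equivalence.to (char x)
    from : ∀ {x} → ¬ (x ≡ 𝟎) → s ⊕ x ∈ S ⊎ s ⊕ x ≡ 𝟎 → x ∈ A
    from {x} n p = Equivalence.from (char x) (n , p)
    𝟎∉S : ¬ 𝟎 ∈ S
    𝟎∉S p = sum-free 𝟎 p (𝟎 , 𝟎 , p , p , sym (⊕-self 𝟎))
    S-nonempty : ∃[ t ] t ∈ S
    S-nonempty = pick s-case (proj₂ A-nonempty)
      where
      pick : ∀ {a} → s ∈ S ⊎ s ≡ 𝟎 → a ∈ A → ∃[ t ] t ∈ S
      pick (inj₁ p) _ = s , p
      pick {a} (inj₂ e) a∈ with to a∈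
      ... | _ , inj₁ p = s ⊕ a , p
      ... | n , inj₂ e' = ⊥-elim (n (trans (sym (⊕≡𝟎⇒≡ e')) e))
    -- A `y` that is no sum of two elements of `S` can be adjoined to `S`; since `S` is not empty,
    -- such a `y` is not 0.
    complete : ∀ y → y ∈ S ⊎ y ∈2 S
    complete y with y ∈2? S
    ... | yes p = inj₂ p
    ... | no y∉2 = inj₁ (maximal S′ (λ x p → ∨-introˡ p) S′-free y (∨-introʳ {S y} (≟-refl y)))
      where
      S′ : Subset r
      S′ x = S x ∨ ⌊ x ≟ y ⌋
      S′∈ : ∀ {x} → x ∈ S′ → x ∈ S ⊎ x ≡ y
      S′∈ {x} p with ∨-true {S x} p
      ... | inj₁ q = inj₁ q
      ... | inj₂ q = inj₂ (≟-true q)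
      y≢𝟎 : y ≢ 𝟎
      y≢𝟎 e = let (t , t∈) = S-nonempty in y∉2 (t , t , t∈ , t∈ , trans e (sym (⊕-self t)))
      S′-free : SumFree S′
      S′-free x x∈ (a , b , a∈ , b∈ , eq) with S′∈ x∈ | S′∈ a∈ | S′∈ b∈
      ... | inj₁ p | inj₁ p₁ | inj₁ p₂ = sum-free x p (a , b , p₁ , p₂ , eq)
      ... | inj₂ refl | inj₁ p₁ | inj₁ p₂ = y∉2 (a , b , p₁ , p₂ , eq)
      ... | inj₁ p | inj₂ refl | inj₁ p₂ = y∉2 (x , b , p , p₂ , trans (group (a ∷ b ∷ []) x₀ (x₀ ∔ x₁ ∔ x₁) refl) (cong (_⊕ b) (sym eq)))
      ... | inj₁ p | inj₁ p₁ | inj₂ refl = y∉2 (x , a , p , p₁ , trans (group (a ∷ b ∷ []) x₁ (x₀ ∔ x₁ ∔ x₀) refl) (cong (_⊕ a) (sym eq)))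
      ... | inj₁ p | inj₂ refl | inj₂ refl = 𝟎∉S (subst (_∈ S) (trans eq (⊕-self y)) p)
      ... | inj₂ refl | inj₂ refl | inj₂ refl = y≢𝟎 (trans eq (⊕-self y))
      ... | inj₂ refl | inj₂ refl | inj₁ p₂ = 𝟎∉S (subst (_∈ S) (trans (group (y ∷ b ∷ []) x₁ (x₀ ∔ (x₀ ∔ x₁)) refl) (trans (cong (y ⊕_) (sym eq)) (⊕-self y))) p₂)
      ... | inj₂ refl | inj₁ p₁ | inj₂ refl = 𝟎∉S (subst (_∈ S) (trans (group (y ∷ a ∷ []) x₁ (x₁ ∔ x₀ ∔ x₀) refl) (trans (cong (_⊕ y) (sym eq)) (⊕-self y))) p₁)
    S₀-sum : ∀ y → ∃[ t ] (t ∈ S ⊎ t ≡ 𝟎) × (t ⊕ y ∈ S ⊎ t ⊕ y ≡ 𝟎)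
    S₀-sum y with complete y
    ... | inj₁ p = 𝟎 , inj₂ refl , inj₁ (subst (_∈ S) (sym (⊕-identityˡ y)) p)
    ... | inj₂ (a , b , a∈ , b∈ , refl) = a , inj₁ a∈ , inj₁ (subst (_∈ S) (group (a ∷ b ∷ []) x₁ (x₀ ∔ (x₀ ∔ x₁)) refl) b∈)
    sat : ∀ y → y ∈ A ⊎ y ∈2 A
    sat y with S₀-sum y
    ... | t , p , p' with (s ⊕ t) ≟ 𝟎 | (s ⊕ (t ⊕ y)) ≟ 𝟎
    ...   | no n | no n' = inj₂ (s ⊕ t , s ⊕ (t ⊕ y) , from n (back p) , from n' (back p') , group (s ∷ t ∷ y ∷ []) x₂ (x₀ ∔ x₁ ∔ (x₀ ∔ (x₁ ∔ x₂))) refl)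
      where
      back : ∀ {t} → t ∈ S ⊎ t ≡ 𝟎 → s ⊕ (s ⊕ t) ∈ S ⊎ s ⊕ (s ⊕ t) ≡ 𝟎
      back {t} = subst (λ v → v ∈ S ⊎ v ≡ 𝟎) (group (s ∷ t ∷ []) x₁ (x₀ ∔ (x₀ ∔ x₁)) refl)
    ...   | yes e | no n' = inj₁ (from (λ y≡ → n' (trans (trans (group (s ∷ t ∷ y ∷ []) (x₀ ∔ (x₁ ∔ x₂)) (x₀ ∔ x₁ ∔ x₂) refl) (cong₂ _⊕_ e y≡)) (⊕-self 𝟎)))
              (subst (λ v → v ⊕ y ∈ S ⊎ v ⊕ y ≡ 𝟎) (sym (⊕≡𝟎⇒≡ e)) p'))
    ...   | no n | yes e' = inj₁ (from (λ y≡ → n (trans (trans (group (s ∷ t ∷ y ∷ []) (x₀ ∔ x₁) (x₀ ∔ (x₁ ∔ x₂) ∔ x₂) refl) (cong₂ _⊕_ e' y≡)) (⊕-self 𝟎)))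
              (subst (λ v → v ∈ S ⊎ v ≡ 𝟎) (⊕≡𝟎⇒≡ (trans (group (s ∷ t ∷ y ∷ []) (x₁ ∔ (x₀ ∔ x₂)) (x₀ ∔ (x₁ ∔ x₂)) refl) e')) p))
    ...   | yes e | yes e' = inj₂ (let (a , a∈) = A-nonempty in a , a , a∈ , a∈ ,
              trans (group (s ∷ t ∷ y ∷ []) x₂ (x₀ ∔ x₁ ∔ (x₀ ∔ (x₁ ∔ x₂))) refl) (trans (cong₂ _⊕_ e e') (trans (⊕-self 𝟎) (sym (⊕-self a)))))
    -- Without `x`, the element `s ⊕ x` of `S` is lost, or `s` itself if `x` is `s`: a
    -- representation by `A'` and 0, with both terms translated by `s`, would make it a sum of two
    -- elements of `S`, unless a term becomes 0, and then `x` was used after all.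
    min : ∀ (A' : Subset r) → A' ⊂ A → ¬ OneSaturating A'
    min A' (A'⊆ , x , x∈ , x∉) (𝟎∉A' , sat') = refuted-by (x ≟ s)
      where
      A'₀ : F₂^ r → Set
      A'₀ b = b ∈ A' ⊎ b ≡ 𝟎
      x∉₀ : ¬ A'₀ x
      x∉₀ (inj₁ p) = x∉ p
      x∉₀ (inj₂ refl) = 𝟎∉A x∈
      rep : ∀ y → ∃[ b ] A'₀ b × A'₀ (b ⊕ y)
      rep y with sat' y
      ... | inj₁ p = 𝟎 , inj₂ refl , inj₁ (subst (_∈ A') (sym (⊕-identityˡ y)) p)
      ... | inj₂ (a , b , a∈ , b∈ , refl) = a , inj₁ a∈ , inj₁ (subst (_∈ A') (group (a ∷ b ∷ []) x₁ (x₀ ∔ (x₀ ∔ x₁)) refl) b∈)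
      shift : ∀ {b} → A'₀ b → s ⊕ b ∈ S ⊎ s ⊕ b ≡ 𝟎
      shift (inj₁ p) = proj₂ (to (A'⊆ _ p))
      shift (inj₂ refl) = subst (λ v → v ∈ S ⊎ v ≡ 𝟎) (sym (⊕-identityʳ s)) s-case
      refuted-by : Dec (x ≡ s) → ⊥
      refuted-by (yes refl) = at-s s-case
        where
        at-s : x ∈ S ⊎ x ≡ 𝟎 → ⊥
        at-s (inj₂ e) = x∉₀ (inj₂ e)
        at-s (inj₁ x∈S) with rep x
        ... | b , p , p' with shift p | shift p'
        ...   | inj₁ q | inj₁ q' = sum-free x x∈S (x ⊕ b , x ⊕ (b ⊕ x) , q , q' , group (x ∷ b ∷ []) x₀ (x₀ ∔ x₁ ∔ (x₀ ∔ (x₁ ∔ x₀))) refl)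
        ...   | inj₂ e | _ = x∉₀ (subst A'₀ (sym (⊕≡𝟎⇒≡ e)) p)
        ...   | inj₁ _ | inj₂ e = x∉₀ (subst A'₀ (sym (⊕≡𝟎⇒≡ e)) p')
      refuted-by (no n) with rep (s ⊕ x) | to x∈
      ... | _ | _ , inj₂ e = n (sym (⊕≡𝟎⇒≡ e))
      ... | b , p , p' | _ , inj₁ sx∈ with shift p | shift p'
      ...   | inj₁ q | inj₁ q' = sum-free (s ⊕ x) sx∈ (s ⊕ b , s ⊕ (b ⊕ (s ⊕ x)) , q , q' , group (s ∷ b ∷ x ∷ []) (x₀ ∔ x₂) (x₀ ∔ x₁ ∔ (x₀ ∔ (x₁ ∔ (x₀ ∔ x₂)))) refl)
      ...   | inj₂ e | _ = x∉₀ (subst A'₀ (trans (group (s ∷ b ∷ x ∷ []) (x₁ ∔ (x₀ ∔ x₂)) (x₀ ∔ x₁ ∔ x₂) refl) (trans (cong (_⊕ x) e) (⊕-identityˡ x))) p')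
      ...   | inj₁ _ | inj₂ e = x∉₀ (subst A'₀ (trans (group (s ∷ b ∷ x ∷ []) x₁ (x₀ ∔ (x₁ ∔ (x₀ ∔ x₂)) ∔ x₂) refl) (trans (cong (_⊕ x) e) (⊕-identityˡ x))) p)

theorem1p1 : (r : ℕ) → 1 ≤ r → (A : Subset r) → ¬ (𝟎 ∈ A) →
    11 * 2 ^ r + 108 < 36 * card A →
    MinimalOneSaturating A ⇔
    (∃[ S ] ∃[ s ] (MaximalSumFree S × (s ∈ S ⊎ s ≡ 𝟎) ×
    (∀ (x : F₂^ r) → x ∈ A ⇔ (¬ (x ≡ 𝟎) × (s ⊕ x ∈ S ⊎ s ⊕ x ≡ 𝟎)))))
theorem1p1 r _ A 𝟎∉A large = mk⇔ (minimal⇒shifted A 𝟎∉A large') (shifted⇒minimal A 𝟎∉A large')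
  where
  large' : 11 * 2 ^ r + 109 ≤ 36 * # A
  large' = subst₂ (λ u v → u ≤ 36 * v) (sym (+-suc (11 * 2 ^ r) 108)) (card≡# A) large
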